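{- Let $p\geq 1$, $c=5/6$ and $\alpha=1/2$. There is a deterministic polynomial-time (Karp) reduction from $\mathsf{SS}_{c}^{p,\alpha}$ to $\mathsf{GapSVP}_p$ that reduces instances with $n$ weights to instances with a lattice of rank $n+1$.
   Context: $\mathbb{N}$ denotes the positive integers. For $1\le p<\infty$, $\|\mathbf{x}\|_p=(\sum_i|x_i|^p)^{1/p}$. $p$-dependency: for $0<\alpha<1$ and $p\ge1$, non-negative integers $a_1,\ldots,a_n$ are called $p$-dependent with respect to $\alpha$ if there exists $\mathbf{x}=(x_1,\ldots,x_n)\in\mathbb{Z}^n$, $\mathbf{x}\ne\mathbf{0}$, such that $\sum_{i=1}^n a_ix_i=0$, $\sum_{i=1}^n x_i=0$ and $\|\mathbf{x}\|_p\le\alpha\cdot n^{1/p}$. The $c$-full subset-sum problem $\mathsf{SS}_c$, for a constant $c\in(0,1)$: given $s\in\mathbb{N}$ and non-negative integers $a_1,\ldots,a_n$ (the weights) such that $cn\in\mathbb{N}$, decide whether there exists $(x_1,\ldots,x_n)\in\{0,1\}^n$ with $\sum_{i=1}^n a_ix_i=s$ and $|\{i:x_i=1\}|=cn$ (YES-instance) or not (NO-instance). $\mathsf{SS}_c^{p,\alpha}$ denotes $\mathsf{SS}_c$ restricted to inputs $a_1,\ldots,a_n$ that are not $p$-dependent with respect to $\alpha$. A lattice $\mathcal{L}$ of rank $n$ and dimension $m$ is the set of all integer linear combinations of $n$ linearly independent vectors in $\mathbb{R}^m$; $\lambda_{1,p}(\mathcal{L})=\min_{\mathbf{v}\in\mathcal{L}\setminus\{0\}}\|\mathbf{v}\|_p$.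 The (exact) problem $\mathsf{GapSVP}_p$: given a lattice $\mathcal{L}$ and a distance threshold $\delta>0$, decide whether $\lambda_{1,p}(\mathcal{L})\le\delta$ (YES-instance) or $\lambda_{1,p}(\mathcal{L})>\delta$ (NO-instance). -}

module Defs where

open import Level using (Level; 0ℓ) renaming (suc to lsuc)
open import Algebra.Bundles using (CommutativeRing)
open import Data.Bool using (Bool; true; false; if_then_else_)
open import Data.Fin using (Fin; zero)
open import Data.Fin.Subset using (Subset) renaming (∣_∣ to card)
open import Data.Integer as ℤ using (ℤ; +_; -[1+_]; 0ℤ)
import Data.Integer.Properties as ℤₚ
open import Data.List using (List; []; _∷_; _++_; length; head; drop; concatMap)
open import Data.Maybe using (Maybe)
open import Data.Nat as ℕ using (ℕ; zero; suc)
import Data.Nat.Properties as ℕₚ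
open import Data.Nat.Binary using (ℕᵇ; zero; 2[1+_]; 1+[2_]; fromℕ)
open import Data.Product using (Σ; ∃-syntax; _×_; _,_; proj₁; proj₂)
open import Data.Rational
import Data.Rational.Properties as ℚₚ
import Data.Rational.Unnormalised as ℚᵘ
import Data.Rational.Unnormalised.Properties as ℚᵘₚ
open import Data.Sum using (_⊎_; inj₁; inj₂)
open import Data.Vec as Vec using (Vec; []; _∷_; lookup; updateAt; replicate; zipWith; toList; foldr′)
open import Function using (_∘_)
open import Relation.Binary.PropositionalEquality
  using (_≡_; _≢_; refl; sym; trans; cong; subst; subst₂)
open import Relation.Nullary using (¬_)

open import Algebra.Properties.Semiring.Exp (CommutativeRing.semiring ℚₚ.+-*-commutativeRing)
  using (_^_; ^-homo-*; ^-assocʳ)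

toℚ : ℤ → ℚ
toℚ z = z / 1

-- A real x is a Dedekind cut, given by its lower class { q ∈ ℚ | q < x }.
record ℝ : Set₁ where
  field
    Below     : ℚ → Set
    inhabited : ∃[ q ] Below q
    bounded   : ∃[ q ] ¬ Below q
    down      : ∀ {q r} → q < r → Below r → Below q
    rounded   : ∀ {q} → Below q → ∃[ r ] q < r × Below r
open ℝ public

-- Order is inclusion of lower classes.  The double negation makes it the
-- classical order without asking for membership in a cut to be decidable.
infix 4 _≤ℝ_ _<ℝ_ _≈ℝ_
_≤ℝ_ : ℝ → ℝ → Set
x ≤ℝ y = ∀ {q} → Below x q → ¬ ¬ Below y q

_<ℝ_ : ℝ → ℝ → Set
x <ℝ y = ¬ (y ≤ℝ x)

_≈ℝ_ : ℝ → ℝ → Set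
x ≈ℝ y = x ≤ℝ y × y ≤ℝ x

private
  below≤bound : ∀ x {q u} → Below x q → ¬ Below x u → q ≤ u
  below≤bound x {q} {u} bq ¬bu = ℚₚ.≮⇒≥ λ u<q → ¬bu (down x u<q bq)

  pred : ∀ q → q - 1ℚ < q
  pred q = subst (q - 1ℚ <_) (ℚₚ.+-identityʳ q) (ℚₚ.+-monoʳ-< q (ℚₚ.negative⁻¹ (- 1ℚ)))

fromℚ : ℚ → ℝ
fromℚ x = record
  { Below     = _< x
  ; inhabited = x - 1ℚ , pred x
  ; bounded   = x , ℚₚ.<-irrefl refl
  ; down      = ℚₚ.<-trans
  ; rounded   = λ q<x → let (r , q<r , r<x) = ℚₚ.<-dense q<x in r , q<r , r<x
  }

infixl 6 _+ℝ_
_+ℝ_ : ℝ → ℝ → ℝ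
x +ℝ y = record
  { Below     = λ r → ∃[ a ] ∃[ b ] Below x a × Below y b × r < a + b
  ; inhabited = let (a , ba) = inhabited x ; (b , bb) = inhabited y
                in (a + b) - 1ℚ , a , b , ba , bb , pred (a + b)
  ; bounded   = let (u , ¬bu) = bounded x ; (w , ¬bw) = bounded y
                in u + w , λ (a , b , ba , bb , u+w<a+b) → ℚₚ.<-irrefl refl
                     (ℚₚ.<-≤-trans u+w<a+b
                       (ℚₚ.+-mono-≤ (below≤bound x ba ¬bu) (below≤bound y bb ¬bw)))
  ; down      = λ q<r (a , b , ba , bb , r<a+b) → a , b , ba , bb , ℚₚ.<-trans q<r r<a+b
  ; rounded   = λ (a , b , ba , bb , q<a+b) →
                let (r , q<r , r<a+b) = ℚₚ.<-dense q<a+b in r , q<r , a , b , ba , bb , r<a+b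
  }

infixr 7 _·_
_·_ : (c : ℚ) .{{_ : Positive c}} → ℝ → ℝ
c · x = record
  { Below     = λ r → ∃[ a ] Below x a × r < c * a
  ; inhabited = let (a , ba) = inhabited x in (c * a) - 1ℚ , a , ba , pred (c * a)
  ; bounded   = let (u , ¬bu) = bounded x
                in c * u , λ (a , ba , cu<ca) → ℚₚ.<-irrefl refl
                     (ℚₚ.<-≤-trans cu<ca
                       (ℚₚ.*-monoˡ-≤-nonNeg c {{ℚₚ.pos⇒nonNeg c}} (below≤bound x ba ¬bu)))
  ; down      = λ q<r (a , ba , r<ca) → a , ba , ℚₚ.<-trans q<r r<ca
  ; rounded   = λ (a , ba , q<ca) →
                let (r , q<r , r<ca) = ℚₚ.<-dense q<ca in r , q<r , a , ba , r<ca
  }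

private
  0<1 : 0ℚ < 1ℚ
  0<1 = ℚₚ.positive⁻¹ 1ℚ

  0≤1 : 0ℚ ≤ 1ℚ
  0≤1 = ℚₚ.<⇒≤ 0<1

  *-mono-≤ : ∀ {w x y z} → 0ℚ ≤ w → 0ℚ ≤ z → w ≤ x → y ≤ z → w * y ≤ x * z
  *-mono-≤ {w} {x} {y} {z} 0≤w 0≤z w≤x y≤z = ℚₚ.≤-trans
    (ℚₚ.*-monoˡ-≤-nonNeg w {{nonNegative 0≤w}} y≤z)
    (ℚₚ.*-monoʳ-≤-nonNeg z {{nonNegative 0≤z}} w≤x)

  ^-≥0 : ∀ {x} → 0ℚ ≤ x → ∀ n → 0ℚ ≤ x ^ n
  ^-≥0         0≤x zero    = 0≤1
  ^-≥0 {x} 0≤x (suc n) = subst (_≤ x * x ^ n) (ℚₚ.*-zeroʳ 0ℚ)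
    (*-mono-≤ ℚₚ.≤-refl (^-≥0 0≤x n) 0≤x (^-≥0 0≤x n))

  ^-monoˡ-≤ : ∀ {x y} → 0ℚ ≤ x → x ≤ y → ∀ n → x ^ n ≤ y ^ n
  ^-monoˡ-≤ 0≤x x≤y zero    = ℚₚ.≤-refl
  ^-monoˡ-≤ 0≤x x≤y (suc n) =
    *-mono-≤ 0≤x (^-≥0 (ℚₚ.≤-trans 0≤x x≤y) n) x≤y (^-monoˡ-≤ 0≤x x≤y n)

  ^-monoˡ-< : ∀ {x y} → 0ℚ < x → x < y → ∀ n → x ^ suc n < y ^ suc n
  ^-monoˡ-< {x} {y} 0<x x<y n = ℚₚ.≤-<-trans
    (ℚₚ.*-monoˡ-≤-nonNeg x {{nonNegative (ℚₚ.<⇒≤ 0<x)}} (^-monoˡ-≤ (ℚₚ.<⇒≤ 0<x) (ℚₚ.<⇒≤ x<y) n))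
    (ℚₚ.*-monoˡ-<-pos (y ^ n) {{y^-pos n}} x<y)
    where
    y^-pos : ∀ n → Positive (y ^ n)
    y^-pos zero    = _
    y^-pos (suc n) = positive (subst (_< y * y ^ n) (ℚₚ.*-zeroʳ y)
      (ℚₚ.*-monoʳ-<-pos y {{positive (ℚₚ.<-trans 0<x x<y)}} (ℚₚ.positive⁻¹ (y ^ n) {{y^-pos n}})))

  ^-≥1 : ∀ {x} → 1ℚ ≤ x → ∀ n → 1ℚ ≤ x ^ n
  ^-≥1         1≤x zero    = ℚₚ.≤-refl
  ^-≥1 {x} 1≤x (suc n) = subst (_≤ x * x ^ n) (ℚₚ.*-identityʳ 1ℚ)
    (*-mono-≤ 0≤1 (^-≥0 (ℚₚ.≤-trans 0≤1 1≤x) n) 1≤x (^-≥1 1≤x n))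

  ^-≤1 : ∀ {x} → 0ℚ ≤ x → x ≤ 1ℚ → ∀ n → x ^ n ≤ 1ℚ
  ^-≤1         0≤x x≤1 zero    = ℚₚ.≤-refl
  ^-≤1 {x} 0≤x x≤1 (suc n) = subst (x * x ^ n ≤_) (ℚₚ.*-identityʳ 1ℚ)
    (*-mono-≤ 0≤x 0≤1 x≤1 (^-≤1 0≤x x≤1 n))

  ^-monoʳ-≤ : ∀ {x} → 1ℚ ≤ x → ∀ {m n} → m ℕ.≤ n → x ^ m ≤ x ^ n
  ^-monoʳ-≤ {x} 1≤x {m} {n} m≤n = subst₂ _≤_ (ℚₚ.*-identityʳ (x ^ m))
    (trans (sym (^-homo-* x m (n ℕ.∸ m))) (cong (x ^_) (ℕₚ.m+[n∸m]≡n m≤n)))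
    (*-mono-≤ 0≤x^m (^-≥0 0≤x (n ℕ.∸ m)) ℚₚ.≤-refl (^-≥1 1≤x (n ℕ.∸ m)))
    where
    0≤x = ℚₚ.≤-trans 0≤1 1≤x
    0≤x^m = ^-≥0 0≤x m

  fraction≤ : ∀ a b u → + a / suc b ≤ u → a ℕ.≤ ℤ.∣ ↥ u ∣ ℕ.* suc b
  fraction≤ a b u@record{} a/b≤u = ℤ.drop‿+≤+ (subst₂ ℤ._≤_
      (ℤₚ.*-identityʳ (+ a)) (sym (ℤₚ.pos-* ℤ.∣ ↥ u ∣ (suc b))) (ℚᵘₚ.drop-*≤* chain))
    where
    ≤abs : ∀ z → z ℤ.≤ + ℤ.∣ z ∣
    ≤abs (+ _)    = ℤₚ.≤-refl
    ≤abs -[1+ _ ] = ℤ.-≤+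

    u≤abs : toℚᵘ u ℚᵘ.≤ ℚᵘ.mkℚᵘ (+ ℤ.∣ ↥ u ∣) 0
    u≤abs = ℚᵘ.*≤* (ℤₚ.≤-trans (ℤₚ.≤-reflexive (ℤₚ.*-identityʳ (↥ u)))
      (ℤₚ.≤-trans (≤abs (↥ u))
        (subst₂ ℤ._≤_ (ℤₚ.*-identityʳ _) refl
          (ℤₚ.*-monoˡ-≤-nonNeg (+ ℤ.∣ ↥ u ∣) (ℤ.+≤+ (ℕ.s≤s (ℕ.z≤n {↧ₙ u ℕ.∸ 1})))))))

    chain : ℚᵘ.mkℚᵘ (+ a) b ℚᵘ.≤ ℚᵘ.mkℚᵘ (+ ℤ.∣ ↥ u ∣) 0
    chain = ℚᵘₚ.≤-trans
      (ℚᵘₚ.≤-reflexive (ℚᵘₚ.≃-sym (ℚₚ.toℚᵘ-fromℚᵘ (ℚᵘ.mkℚᵘ (+ a) b))))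
      (ℚᵘₚ.≤-trans (ℚₚ.toℚᵘ-mono-≤ a/b≤u) u≤abs)

-- ∣ q ∣^ p is the real power |q|^p, for a real p > 0, as the supremum of
--   |q|^(a/b) over rationals 0 ≤ a/b < p   when |q| ≥ 1,
--   |q|^(a/b) over rationals a/b ≥ p       when |q| ≤ 1,
-- where s ≤ |q|^(a/b) is expressed by s^b ≤ |q|^a.
ExponentFor : ℚ → ℝ → ℚ → Set
ExponentFor q p e = (1ℚ ≤ ∣ q ∣ × Below p e) ⊎ (∣ q ∣ ≤ 1ℚ × ¬ Below p e)

infix 8 ∣_∣^_
∣_∣^_ : ℚ → ℝ → ℝ
∣ q ∣^ p = record
  { Below     = λ r → ∃[ s ] r < s × (s ≤ 0ℚ ⊎
                  ∃[ a ] ∃[ b ] ExponentFor q p (+ a / suc b) × s ^ suc b ≤ ∣ q ∣ ^ a)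
  ; inhabited = 0ℚ - 1ℚ , 0ℚ , pred 0ℚ , inj₁ ℚₚ.≤-refl
  ; bounded   = bound , not-below
  ; down      = λ t<r (s , r<s , h) → s , ℚₚ.<-trans t<r r<s , h
  ; rounded   = λ (s , r<s , h) → let (t , r<t , t<s) = ℚₚ.<-dense r<s in t , r<t , s , t<s , h
  }
  where
  u = proj₁ (bounded p)
  N = ℤ.∣ ↥ u ∣
  Q = 1ℚ ⊔ ∣ q ∣
  bound = Q ^ N

  1≤Q : 1ℚ ≤ Q
  1≤Q = ℚₚ.p≤p⊔q 1ℚ ∣ q ∣

  1≤bound : 1ℚ ≤ bound
  1≤bound = ^-≥1 1≤Q N

  power≤ : ∀ a b → ExponentFor q p (+ a / suc b) → ∣ q ∣ ^ a ≤ bound ^ suc b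
  power≤ a b (inj₁ (_ , e<p)) = ℚₚ.≤-trans (^-monoˡ-≤ (ℚₚ.0≤∣p∣ q) (ℚₚ.p≤q⊔p 1ℚ ∣ q ∣) a)
    (subst (Q ^ a ≤_) (sym (^-assocʳ Q N (suc b)))
      (^-monoʳ-≤ 1≤Q (fraction≤ a b u (below≤bound p e<p (proj₂ (bounded p))))))
  power≤ a b (inj₂ (q≤1 , _)) =
    ℚₚ.≤-trans (^-≤1 (ℚₚ.0≤∣p∣ q) q≤1 a) (^-≥1 1≤bound (suc b))

  not-below : ¬ (∃[ s ] bound < s × (s ≤ 0ℚ ⊎
                  ∃[ a ] ∃[ b ] ExponentFor q p (+ a / suc b) × s ^ suc b ≤ ∣ q ∣ ^ a))
  not-below (s , B<s , inj₁ s≤0) = ℚₚ.<-irrefl refl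
    (ℚₚ.<-≤-trans (ℚₚ.<-trans (ℚₚ.<-≤-trans 0<1 1≤bound) B<s) s≤0)
  not-below (s , B<s , inj₂ (a , b , e , s^b≤q^a)) = ℚₚ.<-irrefl refl
    (ℚₚ.<-≤-trans (^-monoˡ-< (ℚₚ.<-≤-trans 0<1 1≤bound) B<s b) (ℚₚ.≤-trans s^b≤q^a (power≤ a b e)))

module _ (p : ℝ) (1≤p : fromℚ 1ℚ ≤ℝ p) where

  -- x^(1/p) for x ≥ 0, as the supremum of the rationals s ≥ 0 with s^p ≤ x.
  root : ℝ → ℝ
  root x = record
    { Below     = λ r → ∃[ s ] r < s × (s ≤ 0ℚ ⊎ (0ℚ < s × ∣ s ∣^ p ≤ℝ x))
    ; inhabited = 0ℚ - 1ℚ , 0ℚ , pred 0ℚ , inj₁ ℚₚ.≤-refl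
    ; bounded   = M * M , not-below
    ; down      = λ t<r (s , r<s , h) → s , ℚₚ.<-trans t<r r<s , h
    ; rounded   = λ (s , r<s , h) → let (t , r<t , t<s) = ℚₚ.<-dense r<s in t , r<t , s , t<s , h
    }
    where
    u = proj₁ (bounded x)
    M = 1ℚ ⊔ (u + 1ℚ)

    1≤M : 1ℚ ≤ M
    1≤M = ℚₚ.p≤p⊔q 1ℚ (u + 1ℚ)

    1≤M*M : 1ℚ ≤ M * M
    1≤M*M = subst (_≤ M * M) (ℚₚ.*-identityʳ 1ℚ)
      (*-mono-≤ 0≤1 (ℚₚ.≤-trans 0≤1 1≤M) 1≤M 1≤M)

    u<M : u < M
    u<M = ℚₚ.<-≤-trans
      (subst (_< u + 1ℚ) (ℚₚ.+-identityʳ u) (ℚₚ.+-monoʳ-< u 0<1))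
      (ℚₚ.p≤q⊔p 1ℚ (u + 1ℚ))

    not-below : ¬ (∃[ s ] M * M < s × (s ≤ 0ℚ ⊎ (0ℚ < s × ∣ s ∣^ p ≤ℝ x)))
    not-below (s , M²<s , inj₁ s≤0) = ℚₚ.<-irrefl refl
      (ℚₚ.<-≤-trans (ℚₚ.<-trans (ℚₚ.<-≤-trans 0<1 1≤M*M) M²<s) s≤0)
    not-below (s , M²<s , inj₂ (0<s , s^p≤x)) = 1≤p {½} ½<1 λ ½<p →
      s^p≤x (M , u<M , inj₂ (1 , 1 , inj₁ (1≤∣s∣ , ½<p) , M²≤∣s∣)) (proj₂ (bounded x))
      where
      ½<1 : ½ < 1ℚ
      ½<1 = *<* (ℤ.+<+ (ℕ.s≤s (ℕ.s≤s ℕ.z≤n)))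
      s≡∣s∣ : s ≡ ∣ s ∣
      s≡∣s∣ = sym (ℚₚ.0≤p⇒∣p∣≡p (ℚₚ.<⇒≤ 0<s))
      M*M≤∣s∣ : M * M ≤ ∣ s ∣
      M*M≤∣s∣ = subst (M * M ≤_) s≡∣s∣ (ℚₚ.<⇒≤ M²<s)
      1≤∣s∣ : 1ℚ ≤ ∣ s ∣
      1≤∣s∣ = ℚₚ.≤-trans 1≤M*M M*M≤∣s∣
      M²≤∣s∣ : M ^ 2 ≤ ∣ s ∣ ^ 1
      M²≤∣s∣ = subst₂ _≤_ (cong (M *_) (sym (ℚₚ.*-identityʳ M))) (sym (ℚₚ.*-identityʳ ∣ s ∣)) M*M≤∣s∣

  norm : ∀ {n} → Vec ℚ n → ℝ
  norm v = root (foldr′ _+ℝ_ (fromℚ 0ℚ) (Vec.map (∣_∣^ p) v))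

-- Symbols of the words in which inputs and outputs are written.
data Symbol : Set where
  one two minus slash comma semicolon : Symbol

Word : Set
Word = List Symbol

-- Programs for a machine with k stacks of symbols.  Every executed push, pop
-- and test inspects or changes a single top symbol and costs one step, so that
-- time agrees with that of multi-tape Turing machines up to a polynomial (two
-- stacks make one tape, and a stack is a tape used from one end).
data Program (k : ℕ) : Set where
  skip   : Program k
  push   : Fin k → Symbol → Program k
  pop    : Fin k → Program k
  _⨾_    : Program k → Program k → Program k
  branch : Fin k → (Maybe Symbol → Program k) → Program k
  while  : Fin k → (Maybe Symbol → Bool) → Program k → Program k

infixr 5 _⨾_

Stacks : ℕ → Set
Stacks k = Vec Word k

top : ∀ {k} → Stacks k → Fin k → Maybe Symbol
top σ i = head (lookup σ i)

-- ⟨ P , σ ⟩⇓[ t ] τ : started on the stacks σ, P halts after t steps with τ.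
data ⟨_,_⟩⇓[_]_ {k : ℕ} : Program k → Stacks k → ℕ → Stacks k → Set where
  skip   : ∀ {σ} → ⟨ skip , σ ⟩⇓[ 1 ] σ
  push   : ∀ {σ i a} → ⟨ push i a , σ ⟩⇓[ 1 ] updateAt σ i (a ∷_)
  pop    : ∀ {σ i} → ⟨ pop i , σ ⟩⇓[ 1 ] updateAt σ i (drop 1)
  seq    : ∀ {P Q σ τ υ s t} → ⟨ P , σ ⟩⇓[ s ] τ → ⟨ Q , τ ⟩⇓[ t ] υ →
           ⟨ P ⨾ Q , σ ⟩⇓[ s ℕ.+ t ] υ
  branch : ∀ {i f σ τ t} → ⟨ f (top σ i) , σ ⟩⇓[ t ] τ → ⟨ branch i f , σ ⟩⇓[ suc t ] τ
  done   : ∀ {i c P σ} → c (top σ i) ≡ false → ⟨ while i c P , σ ⟩⇓[ 1 ] σ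
  loop   : ∀ {i c P σ τ υ s t} → c (top σ i) ≡ true → ⟨ P , σ ⟩⇓[ s ] τ →
           ⟨ while i c P , τ ⟩⇓[ t ] υ → ⟨ while i c P , σ ⟩⇓[ suc (s ℕ.+ t) ] υ

-- The word occupies the first stack, its first symbol on top.
PolynomialTime : {A B : Set} → (A → Word) → (B → Word) → (A → B) → Set
PolynomialTime encA encB f =
  ∃[ k ] Σ (Program (suc k)) λ P → ∃[ C ] ∃[ d ] ∀ x →
    ∃[ t ] ∃[ τ ] ⟨ P , encA x ∷ replicate k [] ⟩⇓[ t ] τ
      × lookup τ zero ≡ encB (f x)
      × t ℕ.≤ C ℕ.+ C ℕ.* length (encA x) ℕ.^ d

record DecisionProblem (ℓ : Level) : Set (lsuc ℓ) where
  field
    Instance : Set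
    encode   : Instance → Word
    YES NO   : Instance → Set ℓ
open DecisionProblem public

restrict : ∀ {ℓ} (A : DecisionProblem ℓ) → (Instance A → Set) → DecisionProblem ℓ
restrict A Allowed = record
  { Instance = Σ (Instance A) Allowed
  ; encode   = encode A ∘ proj₁
  ; YES      = YES A ∘ proj₁
  ; NO       = NO A ∘ proj₁
  }

record KarpReduction {ℓ ℓ′} (A : DecisionProblem ℓ) (B : DecisionProblem ℓ′) : Set (ℓ Level.⊔ ℓ′) where
  field
    map      : Instance A → Instance B
    polytime : PolynomialTime (encode A) (encode B) map
    yes⇒yes  : ∀ x → YES A x → YES B (map x)
    no⇒no    : ∀ x → NO A x → NO B (map x)

-- Numbers are written in binary, with digits 1 and 2 and least significant
-- digit first.
encodeℕᵇ : ℕᵇ → Word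
encodeℕᵇ zero     = []
encodeℕᵇ 2[1+ b ] = two ∷ encodeℕᵇ b
encodeℕᵇ 1+[2 b ] = one ∷ encodeℕᵇ b

encodeℕ : ℕ → Word
encodeℕ = encodeℕᵇ ∘ fromℕ

encodeℤ : ℤ → Word
encodeℤ (+ n)    = encodeℕ n
encodeℤ -[1+ n ] = minus ∷ encodeℕ (suc n)

encodeℚ : ℚ → Word
encodeℚ q = encodeℤ (↥ q) ++ slash ∷ encodeℕ (↧ₙ q)

encodeList : {A : Set} → (A → Word) → Symbol → List A → Word
encodeList enc end = concatMap (λ a → enc a ++ end ∷ [])

-- A rational c is no restriction: c n ∈ ℕ and n ≥ 1 force it.
record SSInstance (c : ℚ) : Set where
  field
    n               : ℕ
    weights         : Vec ℕ n
    target          : ℕ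
    {{target≢0}}    : ℕ.NonZero target
    cn              : ℕ
    {{cn≢0}}        : ℕ.NonZero cn
    cn-correct      : c * toℚ (+ n) ≡ toℚ (+ cn)

-- The 0/1-vectors are the Boolean vectors Subset n, with true as 1.
subsetSum : ∀ {n} → Vec ℕ n → Subset n → ℕ
subsetSum a x = Vec.sum (zipWith (λ aᵢ xᵢ → if xᵢ then aᵢ else 0) a x)

SS : ℚ → DecisionProblem 0ℓ
SS c = record
  { Instance = SSInstance c
  ; encode   = λ I → let open SSInstance I in encodeList encodeℕ comma (target ∷ toList weights)
  ; YES      = Solvable
  ; NO       = λ I → ¬ Solvable I
  }
  where
  Solvable : SSInstance c → Set
  Solvable I = ∃[ x ] subsetSum weights x ≡ target × card x ≡ cn
    where open SSInstance I

sumℤ : ∀ {n} → Vec ℤ n → ℤ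
sumℤ = foldr′ ℤ._+_ 0ℤ

module _ (p : ℝ) (1≤p : fromℚ 1ℚ ≤ℝ p) where

  Dependent : (α : ℚ) .{{_ : Positive α}} → ∀ {n} → Vec ℕ n → Set
  Dependent α {n} a = Σ (Vec ℤ n) λ x →
    x ≢ replicate n 0ℤ
    × sumℤ (zipWith (λ aᵢ xᵢ → + aᵢ ℤ.* xᵢ) a x) ≡ 0ℤ
    × sumℤ x ≡ 0ℤ
    × norm p 1≤p (Vec.map toℚ x) ≤ℝ α · root p 1≤p (fromℚ (toℚ (+ n)))

  -- The restriction of SS c to weights that are not p-dependent w.r.t. α.
  SSIndep : ℚ → (α : ℚ) .{{_ : Positive α}} → DecisionProblem 0ℓ
  SSIndep c α = restrict (SS c) λ I → ¬ Dependent α (SSInstance.weights I)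

combination : ∀ {n m} → Vec ℚ n → Vec (Vec ℚ m) n → Vec ℚ m
combination []       []       = replicate _ 0ℚ
combination (x ∷ xs) (b ∷ bs) = zipWith _+_ (Vec.map (x *_) b) (combination xs bs)

-- Rational coefficients suffice, the vectors being rational.
LinearlyIndependent : ∀ {n m} → Vec (Vec ℚ m) n → Set
LinearlyIndependent {n} {m} B =
  (x : Vec ℚ n) → combination x B ≡ replicate m 0ℚ → x ≡ replicate n 0ℚ

_∈Lattice_ : ∀ {n m} → Vec ℚ m → Vec (Vec ℚ m) n → Set
v ∈Lattice B = ∃[ x ] combination (Vec.map toℚ x) B ≡ v

-- Inputs have to be finite objects: the lattice is given by a rational basis,
-- and the threshold δ = factor · radicand^(1/p) by two positive rationals.
-- This covers rational thresholds as well as irrational ones such as n^(1/p)/2.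
record SVPInstance : Set where
  field
    rank dimension  : ℕ
    {{rank≢0}}      : ℕ.NonZero rank
    basis           : Vec (Vec ℚ dimension) rank
    independent     : LinearlyIndependent basis
    factor          : ℚ
    {{factor>0}}    : Positive factor
    radicand        : ℚ
    {{radicand>0}}  : Positive radicand

encodeSVP : SVPInstance → Word
encodeSVP I =
  encodeList (encodeList encodeℚ comma ∘ toList) semicolon (toList basis)
    ++ encodeList encodeℚ comma (factor ∷ radicand ∷ [])
  where open SVPInstance I

module _ (p : ℝ) (1≤p : fromℚ 1ℚ ≤ℝ p) where

  IsFirstMinimum : ∀ {n m} → Vec (Vec ℚ m) n → ℝ → Set
  IsFirstMinimum {m = m} B λ₁ =
    (∃[ v ] v ∈Lattice B × v ≢ replicate m 0ℚ × norm p 1≤p v ≈ℝ λ₁)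
    × (∀ v → v ∈Lattice B → v ≢ replicate m 0ℚ → λ₁ ≤ℝ norm p 1≤p v)

  threshold : SVPInstance → ℝ
  threshold I = factor · root p 1≤p (fromℚ radicand)
    where open SVPInstance I

  -- A first minimum exists (the rank being positive) and is unique up to ≈ℝ,
  -- but it cannot be computed for a real p, hence a relation rather than a
  -- function: "the first minimum satisfies ..." is read as ∃ in YES and ∀ in NO.
  GapSVP : DecisionProblem (lsuc 0ℓ)
  GapSVP = record
    { Instance = SVPInstance
    ; encode   = encodeSVP
    ; YES      = λ I → ∃[ λ₁ ] IsFirstMinimum (SVPInstance.basis I) λ₁ × λ₁ ≤ℝ threshold I
    ; NO       = λ I → ∀ λ₁ → IsFirstMinimum (SVPInstance.basis I) λ₁ → threshold I <ℝ λ₁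
    }

-- Weights a₁, …, aₙ and a target s go to the lattice of the integer vectors
--   (2xⱼ − t, Σ aᵢ xᵢ − t s, 6 Σ xᵢ − 5 t n)   for j = 1, …, n,
-- with the n triples concatenated, and the threshold n^(1/p).  A solution x with
-- t = 1 gives n entries ±1 and zeros otherwise.  Conversely |y| ≤ |y|^p for integers
-- y, so a vector within the threshold has ℓ₁-norm at most n.  The last two entries,
-- being repeated n times, then vanish, and 3 Σ (2xᵢ − t) = 2 n t forces |t| ≤ 1.
-- For t = ±1 all 2xᵢ − t are odd, hence ±1, and ±x is a solution; for t = 0 the
-- vector x is a dependency, since its norm is half that of 2x.
-- All weak inequalities of reals are stable, so the real analysis is classical.

module Submission where

open import Defs
open import Data.Integer using (+_)
open import Data.Nat using (suc)
open import Data.Product using (Σ; proj₁)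
open import Data.Rational using (1ℚ; ½; _/_)
open import Relation.Binary.PropositionalEquality using (_≡_)

-- When the repeated entries vanish, the sum of all 2xᵢ - t is (2c - 1) n t. The choice c = 5/6
-- makes 2c - 1 = 2/3 exceed 1/2, which is what rules out |t| ≥ 2; with c = 1/2 nothing would bound
-- t. Repetition takes the place of a large multiplier, so the machine only copies words, and
-- grouping into triples lets one loop body write a whole row.
--
-- The main obstacle is the norm at an arbitrary real p. Powers and roots are suprema over rational
-- exponents and bases, and no laws of real powers are at hand. Two facts are extracted instead: a
-- power sum above n has a root above n^(1/p), and halving an integer vector halves its norm. In
-- both, bases are 0 or at least 1, where the approximating exponents lie below p, and irrational
-- roots are replaced by rationals that are off by a factor close to 1.
--
-- A second obstacle is that YES asks for an actual first minimum. None is searched for: for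
-- independent weights every nonzero lattice vector has norm at least n^(1/p), so the vector of a
-- solution attains the minimum.

module Reals where
  open import Algebra.Bundles using (CommutativeRing)
  open import Data.Empty using (⊥)
  open import Data.Integer as ℤ using (ℤ; +_; -[1+_])
  import Data.Integer.Properties as ℤₚ
  open import Data.Nat as ℕ using (ℕ; zero; suc)
  import Data.Nat.Properties as ℕₚ
  open import Data.Product using (∃-syntax; _×_; _,_; proj₁; proj₂)
  open import Data.Rational
  import Data.Rational.Properties as ℚₚ
  import Data.Rational.Unnormalised as ℚᵘ
  import Data.Rational.Unnormalised.Properties as ℚᵘₚ
  open import Data.Rational.Solver using (module +-*-Solver)
  open import Data.Sum using (_⊎_; inj₁; inj₂)
  open import Data.Vec as Vec using (Vec; []; _∷_; foldr′)
  open import Data.Vec.Relation.Unary.All using (All; []; _∷_)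
  open import Relation.Binary.PropositionalEquality
  open import Relation.Binary.Definitions using (tri<; tri≈; tri>)
  open import Relation.Nullary using (¬_; yes; no; contradiction)

  open import Algebra.Properties.CommutativeSemiring.Exp (CommutativeRing.commutativeSemiring ℚₚ.+-*-commutativeRing)
    using (_^_; ^-homo-*; ^-assocʳ; ^-distrib-*)

  -- Powers of rationals.

  0<1 : 0ℚ < 1ℚ
  0<1 = ℚₚ.positive⁻¹ 1ℚ

  0≤1 : 0ℚ ≤ 1ℚ
  0≤1 = ℚₚ.<⇒≤ 0<1

  <⇒≱ : ∀ {x y} → x < y → ¬ (y ≤ x)
  <⇒≱ x<y y≤x = ℚₚ.<-irrefl refl (ℚₚ.<-≤-trans x<y y≤x)

  p≤p+q : ∀ {p q} → 0ℚ ≤ q → p ≤ p + q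
  p≤p+q {p} {q} 0≤q = subst (_≤ p + q) (ℚₚ.+-identityʳ p) (ℚₚ.+-monoʳ-≤ p 0≤q)

  p≤q+p : ∀ {p q} → 0ℚ ≤ q → p ≤ q + p
  p≤q+p {p} {q} 0≤q = subst (_≤ q + p) (ℚₚ.+-identityˡ p) (ℚₚ.+-monoˡ-≤ p 0≤q)

  *-mono-≤ : ∀ {w x y z} → 0ℚ ≤ w → 0ℚ ≤ z → w ≤ x → y ≤ z → w * y ≤ x * z
  *-mono-≤ {w} {x} {y} {z} 0≤w 0≤z w≤x y≤z = ℚₚ.≤-trans
    (ℚₚ.*-monoˡ-≤-nonNeg w {{nonNegative 0≤w}} y≤z)
    (ℚₚ.*-monoʳ-≤-nonNeg z {{nonNegative 0≤z}} w≤x)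

  *-pos : ∀ {x y} → 0ℚ < x → 0ℚ < y → 0ℚ < x * y
  *-pos {x} {y} 0<x 0<y = subst (_< x * y) (ℚₚ.*-zeroʳ x) (ℚₚ.*-monoʳ-<-pos x {{positive 0<x}} 0<y)

  1≤* : ∀ {x y} → 1ℚ ≤ x → 1ℚ ≤ y → 1ℚ ≤ x * y
  1≤* {x} {y} 1≤x 1≤y = subst (_≤ x * y) (ℚₚ.*-identityʳ 1ℚ) (*-mono-≤ 0≤1 (ℚₚ.≤-trans 0≤1 1≤y) 1≤x 1≤y)

  ^-≥0 : ∀ {x} → 0ℚ ≤ x → ∀ n → 0ℚ ≤ x ^ n
  ^-≥0         0≤x zero    = 0≤1
  ^-≥0 {x} 0≤x (suc n) = subst (_≤ x * x ^ n) (ℚₚ.*-zeroʳ 0ℚ)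
    (*-mono-≤ ℚₚ.≤-refl (^-≥0 0≤x n) 0≤x (^-≥0 0≤x n))

  ^-pos : ∀ {x} → 0ℚ < x → ∀ n → 0ℚ < x ^ n
  ^-pos 0<x zero    = 0<1
  ^-pos 0<x (suc n) = *-pos 0<x (^-pos 0<x n)

  ^-≥1 : ∀ {x} → 1ℚ ≤ x → ∀ n → 1ℚ ≤ x ^ n
  ^-≥1 1≤x zero    = ℚₚ.≤-refl
  ^-≥1 1≤x (suc n) = 1≤* 1≤x (^-≥1 1≤x n)

  ^-monoˡ-≤ : ∀ {x y} → 0ℚ ≤ x → x ≤ y → ∀ n → x ^ n ≤ y ^ n
  ^-monoˡ-≤ 0≤x x≤y zero    = ℚₚ.≤-refl
  ^-monoˡ-≤ 0≤x x≤y (suc n) =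
    *-mono-≤ 0≤x (^-≥0 (ℚₚ.≤-trans 0≤x x≤y) n) x≤y (^-monoˡ-≤ 0≤x x≤y n)

  ^-monoˡ-< : ∀ {x y} → 0ℚ ≤ x → x < y → ∀ n → x ^ suc n < y ^ suc n
  ^-monoˡ-< {x} {y} 0≤x x<y n = ℚₚ.≤-<-trans
    (ℚₚ.*-monoˡ-≤-nonNeg x {{nonNegative 0≤x}} (^-monoˡ-≤ 0≤x (ℚₚ.<⇒≤ x<y) n))
    (ℚₚ.*-monoˡ-<-pos (y ^ n) {{positive (^-pos (ℚₚ.≤-<-trans 0≤x x<y) n)}} x<y)

  ^-cancelˡ-≤ : ∀ {x y} → 0ℚ ≤ y → ∀ n → x ^ suc n ≤ y ^ suc n → x ≤ y
  ^-cancelˡ-≤ 0≤y n xⁿ≤yⁿ = ℚₚ.≮⇒≥ λ y<x → <⇒≱ (^-monoˡ-< 0≤y y<x n) xⁿ≤yⁿ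

  ^-monoʳ-≤ : ∀ {x} → 1ℚ ≤ x → ∀ {m n} → m ℕ.≤ n → x ^ m ≤ x ^ n
  ^-monoʳ-≤ {x} 1≤x {m} {n} m≤n = subst₂ _≤_ (ℚₚ.*-identityʳ (x ^ m))
    (trans (sym (^-homo-* x m (n ℕ.∸ m))) (cong (x ^_) (ℕₚ.m+[n∸m]≡n m≤n)))
    (*-mono-≤ 0≤x^m (^-≥0 0≤x (n ℕ.∸ m)) ℚₚ.≤-refl (^-≥1 1≤x (n ℕ.∸ m)))
    where
    0≤x = ℚₚ.≤-trans 0≤1 1≤x
    0≤x^m = ^-≥0 0≤x m

  -- Integers and fractions inside the rationals.

  toℚ-homo-+ : ∀ a b → toℚ (a ℤ.+ b) ≡ toℚ a + toℚ b
  toℚ-homo-+ a b = ℚₚ.toℚᵘ-injective (begin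
    toℚᵘ (toℚ (a ℤ.+ b))                ≈⟨ ℚₚ.toℚᵘ-fromℚᵘ (ℚᵘ.mkℚᵘ (a ℤ.+ b) 0) ⟩
    ℚᵘ.mkℚᵘ (a ℤ.+ b) 0                ≈⟨ ℚᵘ.*≡* (cong (ℤ._* + 1) (sym (cong₂ ℤ._+_ (ℤₚ.*-identityʳ a) (ℤₚ.*-identityʳ b)))) ⟩
    ℚᵘ.mkℚᵘ a 0 ℚᵘ.+ ℚᵘ.mkℚᵘ b 0      ≈⟨ ℚᵘₚ.+-cong (ℚₚ.toℚᵘ-fromℚᵘ (ℚᵘ.mkℚᵘ a 0)) (ℚₚ.toℚᵘ-fromℚᵘ (ℚᵘ.mkℚᵘ b 0)) ⟨
    toℚᵘ (toℚ a) ℚᵘ.+ toℚᵘ (toℚ b)      ≈⟨ ℚₚ.toℚᵘ-homo-+ (toℚ a) (toℚ b) ⟨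
    toℚᵘ (toℚ a + toℚ b)                ∎)
    where open ℚᵘₚ.≃-Reasoning

  toℚ-homo-* : ∀ a b → toℚ (a ℤ.* b) ≡ toℚ a * toℚ b
  toℚ-homo-* a b = ℚₚ.toℚᵘ-injective (begin
    toℚᵘ (toℚ (a ℤ.* b))                ≈⟨ ℚₚ.toℚᵘ-fromℚᵘ (ℚᵘ.mkℚᵘ (a ℤ.* b) 0) ⟩
    ℚᵘ.mkℚᵘ a 0 ℚᵘ.* ℚᵘ.mkℚᵘ b 0      ≈⟨ ℚᵘₚ.*-cong (ℚₚ.toℚᵘ-fromℚᵘ (ℚᵘ.mkℚᵘ a 0)) (ℚₚ.toℚᵘ-fromℚᵘ (ℚᵘ.mkℚᵘ b 0)) ⟨
    toℚᵘ (toℚ a) ℚᵘ.* toℚᵘ (toℚ b)      ≈⟨ ℚₚ.toℚᵘ-homo-* (toℚ a) (toℚ b) ⟨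
    toℚᵘ (toℚ a * toℚ b)                ∎)
    where open ℚᵘₚ.≃-Reasoning

  private
    fromℚᵘ-≤ : ∀ u v → u ℚᵘ.≤ v → fromℚᵘ u ≤ fromℚᵘ v
    fromℚᵘ-≤ u v u≤v = ℚₚ.toℚᵘ-cancel-≤
      (ℚᵘₚ.≤-trans (ℚᵘₚ.≤-reflexive (ℚₚ.toℚᵘ-fromℚᵘ u))
        (ℚᵘₚ.≤-trans u≤v (ℚᵘₚ.≤-reflexive (ℚᵘₚ.≃-sym (ℚₚ.toℚᵘ-fromℚᵘ v)))))

    fromℚᵘ-cancel-≤ : ∀ u v → fromℚᵘ u ≤ fromℚᵘ v → u ℚᵘ.≤ v
    fromℚᵘ-cancel-≤ u v u≤v =
      ℚᵘₚ.≤-trans (ℚᵘₚ.≤-reflexive (ℚᵘₚ.≃-sym (ℚₚ.toℚᵘ-fromℚᵘ u)))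
        (ℚᵘₚ.≤-trans (ℚₚ.toℚᵘ-mono-≤ u≤v) (ℚᵘₚ.≤-reflexive (ℚₚ.toℚᵘ-fromℚᵘ v)))

  fraction-cancel-≤ : ∀ a b c d → + a / suc b ≤ + c / suc d → a ℕ.* suc d ℕ.≤ c ℕ.* suc b
  fraction-cancel-≤ a b c d h = ℤ.drop‿+≤+
    (subst₂ ℤ._≤_ (sym (ℤₚ.pos-* a (suc d))) (sym (ℤₚ.pos-* c (suc b))) (ℚᵘₚ.drop-*≤* (fromℚᵘ-cancel-≤ (ℚᵘ.mkℚᵘ (+ a) b) (ℚᵘ.mkℚᵘ (+ c) d) h)))

  fraction-mono-< : ∀ a b c d → a ℕ.* suc d ℕ.< c ℕ.* suc b → + a / suc b < + c / suc d
  fraction-mono-< a b c d ad<cb = ℚₚ.≰⇒> λ le → ℕₚ.<⇒≱ ad<cb (fraction-cancel-≤ c d a b le)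

  toℚ-mono-≤ : ∀ a b → a ℤ.≤ b → toℚ a ≤ toℚ b
  toℚ-mono-≤ a b a≤b = fromℚᵘ-≤ (ℚᵘ.mkℚᵘ a 0) (ℚᵘ.mkℚᵘ b 0) (ℚᵘ.*≤* (subst₂ ℤ._≤_ (sym (ℤₚ.*-identityʳ a)) (sym (ℤₚ.*-identityʳ b)) a≤b))

  toℚ-cancel-≤ : ∀ a b → toℚ a ≤ toℚ b → a ℤ.≤ b
  toℚ-cancel-≤ a b h = subst₂ ℤ._≤_ (ℤₚ.*-identityʳ a) (ℤₚ.*-identityʳ b) (ℚᵘₚ.drop-*≤* (fromℚᵘ-cancel-≤ (ℚᵘ.mkℚᵘ a 0) (ℚᵘ.mkℚᵘ b 0) h))

  toℚ-injective : ∀ a b → toℚ a ≡ toℚ b → a ≡ b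
  toℚ-injective a b eq = ℤₚ.≤-antisym (toℚ-cancel-≤ a b (ℚₚ.≤-reflexive eq)) (toℚ-cancel-≤ b a (ℚₚ.≤-reflexive (sym eq)))

  toℚ-mono-< : ∀ a b → a ℤ.< b → toℚ a < toℚ b
  toℚ-mono-< a b a<b = ℚₚ.≰⇒> λ le → ℤₚ.<⇒≱ a<b (toℚ-cancel-≤ b a le)

  ∣toℚ∣ : ∀ z → ∣ toℚ z ∣ ≡ toℚ (+ ℤ.∣ z ∣)
  ∣toℚ∣ (+ n)    = ℚₚ.0≤p⇒∣p∣≡p (toℚ-mono-≤ (+ 0) (+ n) (ℤ.+≤+ ℕ.z≤n))
  ∣toℚ∣ -[1+ n ] = trans (ℚₚ.∣-p∣≡∣p∣ (toℚ (+ suc n))) (∣toℚ∣ (+ suc n))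

  upper-integer : ∀ q → ∃[ N ] q ≤ toℚ (+ N)
  upper-integer q@record{} = ℤ.∣ ↥ q ∣ , subst (_≤ toℚ (+ ℤ.∣ ↥ q ∣)) (ℚₚ.↥p/↧p≡p q)
    (fromℚᵘ-≤ (ℚᵘ.mkℚᵘ (↥ q) (↧ₙ q ℕ.∸ 1)) (ℚᵘ.mkℚᵘ (+ ℤ.∣ ↥ q ∣) 0) (ℚᵘ.*≤* (ℤₚ.≤-trans (ℤₚ.≤-reflexive (ℤₚ.*-identityʳ (↥ q)))
      (ℤₚ.≤-trans (≤abs (↥ q))
        (subst₂ ℤ._≤_ (ℤₚ.*-identityʳ _) refl
          (ℤₚ.*-monoˡ-≤-nonNeg (+ ℤ.∣ ↥ q ∣) (ℤ.+≤+ (ℕ.s≤s (ℕ.z≤n {↧ₙ q ℕ.∸ 1})))))))))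
    where
    ≤abs : ∀ z → z ℤ.≤ + ℤ.∣ z ∣
    ≤abs (+ _)    = ℤₚ.≤-refl
    ≤abs -[1+ _ ] = ℤ.-≤+

  -- Growth of powers, in place of roots and logarithms.

  bernoulli : ∀ {δ} → 0ℚ ≤ δ → ∀ n → 1ℚ + toℚ (+ n) * δ ≤ (1ℚ + δ) ^ n
  bernoulli {δ} 0≤δ zero    = ℚₚ.≤-reflexive (solve 1 (λ δ → con 1ℚ :+ con 0ℚ :* δ := con 1ℚ) refl δ)
    where open +-*-Solver
  bernoulli {δ} 0≤δ (suc n) = begin
    1ℚ + toℚ (+ suc n) * δ                  ≡⟨ cong (λ m → 1ℚ + m * δ) (toℚ-homo-+ (+ 1) (+ n)) ⟩
    1ℚ + (1ℚ + N) * δ                       ≤⟨ p≤p+q 0≤Nδδ ⟩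
    1ℚ + (1ℚ + N) * δ + N * (δ * δ)         ≡⟨ solve 2 (λ δ N → con 1ℚ :+ (con 1ℚ :+ N) :* δ :+ N :* (δ :* δ)
                                                 := (con 1ℚ :+ δ) :* (con 1ℚ :+ N :* δ)) refl δ N ⟩
    (1ℚ + δ) * (1ℚ + N * δ)                 ≤⟨ ℚₚ.*-monoˡ-≤-nonNeg (1ℚ + δ) {{nonNegative (ℚₚ.+-mono-≤ 0≤1 0≤δ)}} (bernoulli 0≤δ n) ⟩
    (1ℚ + δ) * (1ℚ + δ) ^ n                 ∎
    where
    open ℚₚ.≤-Reasoning
    open +-*-Solver
    N = toℚ (+ n)
    0≤N : 0ℚ ≤ N
    0≤N = toℚ-mono-≤ (+ 0) (+ n) (ℤ.+≤+ ℕ.z≤n)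
    0≤Nδδ : 0ℚ ≤ N * (δ * δ)
    0≤Nδδ = *-mono-≤ {0ℚ} {N} {0ℚ} ℚₚ.≤-refl (*-mono-≤ {0ℚ} {δ} {0ℚ} ℚₚ.≤-refl 0≤δ 0≤δ 0≤δ) 0≤N
      (*-mono-≤ {0ℚ} {δ} {0ℚ} ℚₚ.≤-refl 0≤δ 0≤δ 0≤δ)

  <⇒∃+ : ∀ {x y} → x < y → ∃[ δ ] 0ℚ < δ × x + δ ≡ y
  <⇒∃+ {x} {y} x<y = y - x
    , subst (_< y - x) (ℚₚ.+-inverseʳ x) (ℚₚ.+-monoˡ-< (- x) x<y)
    , solve 2 (λ x y → x :+ (y :- x) := y) refl x y
    where open +-*-Solver

  divide : ∀ {x} y → 0ℚ < x → ∃[ z ] x * z ≡ y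
  divide {x} y 0<x = 1/ x * y , (begin
    x * (1/ x * y) ≡⟨ ℚₚ.*-assoc x (1/ x) y ⟨
    x * 1/ x * y   ≡⟨ cong (_* y) (ℚₚ.*-inverseʳ x) ⟩
    1ℚ * y         ≡⟨ ℚₚ.*-identityˡ y ⟩
    y              ∎)
    where
    open ≡-Reasoning
    instance x≢0 = ℚₚ.pos⇒nonZero x {{positive 0<x}}

  -- Bernoulli's inequality for ρ = 1 + δ, with an exponent at least x / δ.
  powers-unbounded : ∀ {ρ} → 1ℚ < ρ → ∀ x → ∃[ n ] x ≤ ρ ^ n
  powers-unbounded {ρ} 1<ρ x =
    let δ , 0<δ , 1+δ≡ρ = <⇒∃+ 1<ρ
        y , δy≡x = divide x 0<δ
        N , y≤N = upper-integer y
    in N , (begin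
    x                    ≡⟨ δy≡x ⟨
    δ * y                ≤⟨ ℚₚ.*-monoˡ-≤-nonNeg δ {{nonNegative (ℚₚ.<⇒≤ 0<δ)}} y≤N ⟩
    δ * toℚ (+ N)        ≡⟨ ℚₚ.*-comm δ (toℚ (+ N)) ⟩
    toℚ (+ N) * δ        ≤⟨ p≤q+p {toℚ (+ N) * δ} 0≤1 ⟩
    1ℚ + toℚ (+ N) * δ   ≤⟨ bernoulli (ℚₚ.<⇒≤ 0<δ) N ⟩
    (1ℚ + δ) ^ N         ≡⟨ cong (_^ N) 1+δ≡ρ ⟩
    ρ ^ N                ∎)
    where open ℚₚ.≤-Reasoning

  quotient>1 : ∀ {x y} → 0ℚ < x → x < y → ∃[ ρ ] 1ℚ < ρ × x * ρ ≡ y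
  quotient>1 {x} {y} 0<x x<y with ρ , xρ≡y ← divide y 0<x = ρ , 1<ρ , xρ≡y
    where
    1<ρ = ℚₚ.*-cancelˡ-<-nonNeg x {{nonNegative (ℚₚ.<⇒≤ 0<x)}}
      (subst₂ _<_ (sym (ℚₚ.*-identityʳ x)) (sym xρ≡y) x<y)

  -- Replaces the k-th root of y / x, which need not be rational. Each factor gets its own share of
  -- the gap: ρ serves x < z, σ = z⁻¹ y serves z < y, and the smaller of the two serves both.
  small-factor : ∀ {x y} → 0ℚ < x → x < y → ∀ k → ∃[ ρ ] 1ℚ < ρ × x * ρ ^ k < y
  small-factor {x} {y} 0<x x<y zero = 1ℚ + 1ℚ , ℚₚ.+-monoʳ-< 1ℚ 0<1 , subst (_< y) (sym (ℚₚ.*-identityʳ x)) x<y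
  small-factor {x} {y} 0<x x<y (suc k) =
    let z , x<z , z<y = ℚₚ.<-dense x<y
        ρ , 1<ρ , xρᵏ<z = small-factor 0<x x<z k
        σ , 1<σ , zσ≡y = quotient>1 (ℚₚ.<-trans 0<x x<z) z<y
        1<τ = minimum>1 1<ρ 1<σ
    in ρ ⊓ σ , 1<τ ,
      bound (ℚₚ.<-trans 0<1 1<τ) (ℚₚ.p⊓q≤p ρ σ) (ℚₚ.p⊓q≤q ρ σ) (ℚₚ.<-trans 0<x x<z) xρᵏ<z zσ≡y
    where
    minimum>1 : ∀ {ρ σ} → 1ℚ < ρ → 1ℚ < σ → 1ℚ < ρ ⊓ σ
    minimum>1 {ρ} {σ} 1<ρ 1<σ with ℚₚ.⊓-sel ρ σ
    ... | inj₁ eq = subst (1ℚ <_) (sym eq) 1<ρ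
    ... | inj₂ eq = subst (1ℚ <_) (sym eq) 1<σ

    bound : ∀ {τ ρ σ z} → 0ℚ < τ → τ ≤ ρ → τ ≤ σ → 0ℚ < z → x * ρ ^ k < z → z * σ ≡ y → x * τ ^ suc k < y
    bound {τ} {ρ} {σ} {z} 0<τ τ≤ρ τ≤σ 0<z xρᵏ<z zσ≡y = begin-strict
      x * (τ * τ ^ k)  ≡⟨ cong (x *_) (ℚₚ.*-comm τ (τ ^ k)) ⟩
      x * (τ ^ k * τ)  ≡⟨ ℚₚ.*-assoc x (τ ^ k) τ ⟨
      x * τ ^ k * τ    ≤⟨ ℚₚ.*-monoʳ-≤-nonNeg τ {{nonNegative (ℚₚ.<⇒≤ 0<τ)}}
                            (ℚₚ.*-monoˡ-≤-nonNeg x {{nonNegative (ℚₚ.<⇒≤ 0<x)}} (^-monoˡ-≤ (ℚₚ.<⇒≤ 0<τ) τ≤ρ k)) ⟩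
      x * ρ ^ k * τ    <⟨ ℚₚ.*-monoˡ-<-pos τ {{positive 0<τ}} xρᵏ<z ⟩
      z * τ            ≤⟨ ℚₚ.*-monoˡ-≤-nonNeg z {{nonNegative (ℚₚ.<⇒≤ 0<z)}} τ≤σ ⟩
      z * σ            ≡⟨ zσ≡y ⟩
      y                ∎
      where open ℚₚ.≤-Reasoning

  toℚ-neg : ∀ a → toℚ (ℤ.- a) ≡ - toℚ a
  toℚ-neg (+ zero)  = refl
  toℚ-neg (+ suc n) = refl
  toℚ-neg -[1+ n ]  = sym (neg-involutive (toℚ (+ suc n)))
    where
    neg-involutive : ∀ x → - (- x) ≡ x
    neg-involutive = solve 1 (λ x → :- (:- x) := x) refl
      where open +-*-Solver

  toℚ-minus : ∀ a b → toℚ (a ℤ.- b) ≡ toℚ a - toℚ b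
  toℚ-minus a b = trans (toℚ-homo-+ a (ℤ.- b)) (cong (λ z → toℚ a + z) (toℚ-neg b))

  cancel-positive : ∀ {r p q} → 0ℚ < r → r * p ≡ r * q → p ≡ q
  cancel-positive {r} 0<r eq = ℚₚ.≤-antisym
    (ℚₚ.*-cancelˡ-≤-pos r {{positive 0<r}} (ℚₚ.≤-reflexive eq))
    (ℚₚ.*-cancelˡ-≤-pos r {{positive 0<r}} (ℚₚ.≤-reflexive (sym eq)))

  -- Order and addition of Dedekind cuts.

  ≤ℝ-refl : ∀ x → x ≤ℝ x
  ≤ℝ-refl x b k = k b

  ≤ℝ-trans : ∀ x y z → x ≤ℝ y → y ≤ℝ z → x ≤ℝ z
  ≤ℝ-trans x y z x≤y y≤z b k = x≤y b λ b′ → y≤z b′ k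

  ≤ℝ-stable : ∀ x y → ¬ ¬ (x ≤ℝ y) → x ≤ℝ y
  ≤ℝ-stable x y h b k = h λ x≤y → x≤y b k

  -- A rational r below y but not below x bounds x from above, so everything below x would lie below
  -- y. No cut has to be decided.
  ≰ℝ⇒≥ℝ : ∀ x y → ¬ (x ≤ℝ y) → y ≤ℝ x
  ≰ℝ⇒≥ℝ x y x≰y {r} r∈y r∉x = x≰y λ {q} q∈x k → k (below-≤ y (ℚₚ.≮⇒≥ λ r<q → r∉x (down x r<q q∈x)) r∈y)
    where
    below-≤ : ∀ z {q r} → q ≤ r → Below z r → Below z q
    below-≤ z {q} {r} q≤r r∈z with ℚₚ.<-cmp q r
    ... | tri< q<r _ _ = down z q<r r∈z
    ... | tri≈ _ refl _ = r∈z
    ... | tri> _ _ r<q = contradiction q≤r (<⇒≱ r<q)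

  fromℚ-mono : ∀ {x y} → x ≤ y → fromℚ x ≤ℝ fromℚ y
  fromℚ-mono x≤y q<x k = k (ℚₚ.<-≤-trans q<x x≤y)

  fromℚ-cancel : ∀ {x y} → fromℚ x ≤ℝ fromℚ y → x ≤ y
  fromℚ-cancel x≤y = ℚₚ.≮⇒≥ λ y<x → x≤y y<x (ℚₚ.<-irrefl refl)

  +ℝ-mono : ∀ x x′ y y′ → x ≤ℝ x′ → y ≤ℝ y′ → x +ℝ y ≤ℝ x′ +ℝ y′
  +ℝ-mono x x′ y y′ x≤x′ y≤y′ (a , b , ba , bb , lt) k =
    x≤x′ ba λ ba′ → y≤y′ bb λ bb′ → k (a , b , ba′ , bb′ , lt)

  fromℚ-+-≤ : ∀ x y → fromℚ x +ℝ fromℚ y ≤ℝ fromℚ (x + y)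
  fromℚ-+-≤ x y (a , b , a<x , b<y , lt) k = k (ℚₚ.<-trans lt (ℚₚ.+-mono-< a<x b<y))

  -- First a is placed between r - y and x, then b between r - a and y.
  split-< : ∀ {r x y} → r < x + y → ∃[ a ] ∃[ b ] a < x × b < y × r < a + b
  split-< {r} {x} {y} r<x+y =
    let a , r-y<a , a<x = ℚₚ.<-dense (subst (r - y <_) x+y-y (ℚₚ.+-monoˡ-< (- y) r<x+y))
        b , r-a<b , b<y = ℚₚ.<-dense (subst₂ _<_ (left a) (right a) (ℚₚ.+-monoˡ-< (y - a) r-y<a))
    in a , b , a<x , b<y , subst (_< a + b) (cancel a) (ℚₚ.+-monoʳ-< a r-a<b)
    where
    open +-*-Solver
    x+y-y : x + y - y ≡ x
    x+y-y = solve 2 (λ x y → x :+ y :- y := x) refl x y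
    left : ∀ a → r - y + (y - a) ≡ r - a
    left a = solve 3 (λ r y a → r :- y :+ (y :- a) := r :- a) refl r y a
    right : ∀ a → a + (y - a) ≡ y
    right a = solve 2 (λ y a → a :+ (y :- a) := y) refl y a
    cancel : ∀ a → a + (r - a) ≡ r
    cancel a = solve 2 (λ r a → a :+ (r :- a) := r) refl r a

  fromℚ-+-≥ : ∀ x y → fromℚ (x + y) ≤ℝ fromℚ x +ℝ fromℚ y
  fromℚ-+-≥ x y r<x+y k = k (split-< r<x+y)

  ≤ℝ-1· : ∀ {x} → x ≤ℝ 1ℚ · x
  ≤ℝ-1· {x} {q} bq k = let r , q<r , br = rounded x bq in k (r , br , subst (q <_) (sym (ℚₚ.*-identityˡ r)) q<r)

  1·-≤ℝ : ∀ {x} → 1ℚ · x ≤ℝ x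
  1·-≤ℝ {x} {q} (a , ba , q<a) k = k (down x (subst (q <_) (ℚₚ.*-identityˡ a) q<a) ba)

  2ℚ : ℚ
  2ℚ = 1ℚ + 1ℚ

  1≤2 : 1ℚ ≤ 2ℚ
  1≤2 = p≤p+q {1ℚ} 0≤1

  ^-assoc-comm : ∀ x m n → (x ^ m) ^ n ≡ (x ^ n) ^ m
  ^-assoc-comm x m n = trans (^-assocʳ x m n) (trans (cong (x ^_) (ℕₚ.*-comm m n)) (sym (^-assocʳ x n m)))

  ^-one : ∀ n → 1ℚ ^ n ≡ 1ℚ
  ^-one zero    = refl
  ^-one (suc n) = trans (ℚₚ.*-identityˡ (1ℚ ^ n)) (^-one n)

  -- With real exponents: u ≤ x^(a/b) and s ≤ y^(c/d) give u s ≤ (x y)^(c/d) if a/b ≤ c/d.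
  *-power-≤ : ∀ {u s x y} a b c d → 0ℚ ≤ u → 0ℚ ≤ s → 1ℚ ≤ x → 1ℚ ≤ y →
    u ^ suc b ≤ x ^ a → s ^ suc d ≤ y ^ c → a ℕ.* suc d ℕ.≤ c ℕ.* suc b →
    (u * s) ^ suc d ≤ (x * y) ^ c
  *-power-≤ {u} {s} {x} {y} a b c d 0≤u 0≤s 1≤x 1≤y uᵇ≤xᵃ sᵈ≤yᶜ ad≤cb =
    ^-cancelˡ-≤ (^-≥0 (ℚₚ.≤-trans 0≤1 (1≤* 1≤x 1≤y)) c) b (begin
      ((u * s) ^ D) ^ B                ≡⟨ cong (_^ B) (^-distrib-* u s D) ⟩
      (u ^ D * s ^ D) ^ B              ≡⟨ ^-distrib-* (u ^ D) (s ^ D) B ⟩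
      (u ^ D) ^ B * (s ^ D) ^ B        ≡⟨ cong (_* (s ^ D) ^ B) (^-assoc-comm u D B) ⟩
      (u ^ B) ^ D * (s ^ D) ^ B        ≤⟨ *-mono-≤ (^-≥0 (^-≥0 0≤u B) D) (^-≥0 (^-≥0 (ℚₚ.≤-trans 0≤1 1≤y) c) B)
                                            u-part (^-monoˡ-≤ (^-≥0 0≤s D) sᵈ≤yᶜ B) ⟩
      (x ^ c) ^ B * (y ^ c) ^ B        ≡⟨ ^-distrib-* (x ^ c) (y ^ c) B ⟨
      (x ^ c * y ^ c) ^ B              ≡⟨ cong (_^ B) (^-distrib-* x y c) ⟨
      ((x * y) ^ c) ^ B                ∎)
    where
    open ℚₚ.≤-Reasoning
    B = suc b
    D = suc d
    u-part : (u ^ B) ^ D ≤ (x ^ c) ^ B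
    u-part = ℚₚ.≤-trans (^-monoˡ-≤ (^-≥0 0≤u B) uᵇ≤xᵃ D)
      (subst₂ _≤_ (sym (^-assocʳ x a D)) (sym (^-assocʳ x c B)) (^-monoʳ-≤ 1≤x ad≤cb))

  -- Roundedness of y leaves a gap r - q, wide enough to absorb a negative rational a, and every
  -- negative rational is below x.
  ≤ℝ-+ℝ : ∀ x y → fromℚ 0ℚ ≤ℝ x → y ≤ℝ x +ℝ y
  ≤ℝ-+ℝ x y 0≤x {q} q∈y k =
    let r , q<r , r∈y = rounded y q∈y
        a , q-r<a , a<0 = ℚₚ.<-dense (subst (q - r <_) (ℚₚ.+-inverseʳ r) (ℚₚ.+-monoˡ-< (- r) q<r))
    in 0≤x a<0 λ a∈x → k (a , r , a∈x , r∈y , subst (_< a + r) (q-r+r r) (ℚₚ.+-monoˡ-< r q-r<a))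
    where
    open +-*-Solver
    q-r+r : ∀ r → q - r + r ≡ q
    q-r+r r = solve 2 (λ q r → q :- r :+ r := q) refl q r

  -- The power ρ^k stands in for the (b+1)-th root of y, from below and short by less than a factor
  -- ρ. The search descends from a power known to be too large.
  power-crossing : ∀ {ρ y} → 1ℚ < ρ → 1ℚ ≤ y → ∀ b → ∃[ k ] (ρ ^ k) ^ suc b ≤ y × y < (ρ ^ suc k) ^ suc b
  power-crossing {ρ} {y} 1<ρ 1≤y b = search (proj₁ start) above
    where
    start = powers-unbounded 1<ρ (y + 1ℚ)
    1≤ρᴹ : ∀ M → 1ℚ ≤ ρ ^ M
    1≤ρᴹ = ^-≥1 (ℚₚ.<⇒≤ 1<ρ)
    -- Here y < y + 1 ≤ ρ^M, and raising a number that is at least 1 to the exponent b + 1 only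
    -- enlarges it.
    above : y < (ρ ^ proj₁ start) ^ suc b
    above = ℚₚ.<-≤-trans (subst (_< y + 1ℚ) (ℚₚ.+-identityʳ y) (ℚₚ.+-monoʳ-< y 0<1))
      (ℚₚ.≤-trans (proj₂ start) (subst (_≤ (ρ ^ proj₁ start) ^ suc b) (ℚₚ.*-identityʳ (ρ ^ proj₁ start))
        (^-monoʳ-≤ (1≤ρᴹ (proj₁ start)) {1} {suc b} (ℕ.s≤s ℕ.z≤n))))

    search : ∀ M → y < (ρ ^ M) ^ suc b → ∃[ k ] (ρ ^ k) ^ suc b ≤ y × y < (ρ ^ suc k) ^ suc b
    search zero    y<1 = contradiction 1≤y (<⇒≱ (subst (y <_) (^-one (suc b)) y<1))
    search (suc M) y<  with (ρ ^ M) ^ suc b ≤? y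
    ... | yes ≤y = M , ≤y , y<
    ... | no ≰y  = search M (ℚₚ.≰⇒> ≰y)

  -- Powers, power sums and norms for a real exponent.

  module PowerSums (p : ℝ) (1≤p : fromℚ 1ℚ ≤ℝ p) where

    powerSum : ∀ {n} → Vec ℚ n → ℝ
    powerSum v = foldr′ _+ℝ_ (fromℚ 0ℚ) (Vec.map (∣_∣^ p) v)

    0∈p : ¬ ¬ Below p 0ℚ
    0∈p = 1≤p {0ℚ} 0<1

    -- A natural number P in place of p: for ρ ≥ 1 the crude factor ρ^P dominates every admissible
    -- rational power of ρ.
    exponent-bound : ∃[ P ] ∀ a b → Below p (+ a / suc b) → a ℕ.≤ P ℕ.* suc b
    exponent-bound =
      let u , ¬bu = bounded p
          N , u≤N = upper-integer u
      in N , λ a b e∈p → subst (ℕ._≤ N ℕ.* suc b) (ℕₚ.*-identityʳ a)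
        (fraction-cancel-≤ a b N 0 (ℚₚ.≤-trans (ℚₚ.≮⇒≥ λ u<e → ¬bu (down p u<e e∈p)) u≤N))

    -- A normal form of the witnesses for a base of absolute value at least 1: only exponents below
    -- `p`, and s ≥ 1, so that no sign has to be examined.
    record Approximation (q r : ℚ) : Set where
      constructor approximation
      field
        s      : ℚ
        r<s    : r < s
        1≤s    : 1ℚ ≤ s
        a b    : ℕ
        e∈p    : Below p (+ a / suc b)
        sᵇ≤qᵃ  : s ^ suc b ≤ ∣ q ∣ ^ a

    pow-intro : ∀ {q r} → 1ℚ ≤ ∣ q ∣ → Approximation q r → Below (∣ q ∣^ p) r
    pow-intro 1≤∣q∣ (approximation s r<s _ a b e∈p sᵇ≤qᵃ) = s , r<s , inj₂ (a , b , inj₁ (1≤∣q∣ , e∈p) , sᵇ≤qᵃ)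

    -- A witness s ≤ 1 is raised to 1, which the exponent 0 justifies. A witness of the branch for
    -- small bases forces |q| = 1, hence s ≤ 1, and the exponent 0 serves again. The double negation
    -- is that of 0 lying below `p`.
    pow-elim : ∀ {q r} → Below (∣ q ∣^ p) r → 1ℚ ≤ ∣ q ∣ → ¬ ¬ Approximation q r
    pow-elim {q} {r} (s , r<s , h) 1≤q k with ℚₚ.≤-total s 1ℚ
    ... | inj₁ s≤1 = 0∈p λ 0∈p → k (approximation 1ℚ (ℚₚ.<-≤-trans r<s s≤1) ℚₚ.≤-refl 0 0 0∈p ℚₚ.≤-refl)
    pow-elim {q} {r} (s , r<s , inj₁ s≤0) 1≤q k | inj₂ 1≤s =
      contradiction (ℚₚ.≤-trans 1≤s s≤0) (<⇒≱ 0<1)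
    pow-elim {q} {r} (s , r<s , inj₂ (a , b , inj₁ (_ , e∈p) , sᵇ≤qᵃ)) 1≤q k | inj₂ 1≤s =
      k (approximation s r<s 1≤s a b e∈p sᵇ≤qᵃ)
    pow-elim {q} {r} (s , r<s , inj₂ (a , b , inj₂ (q≤1 , _) , sᵇ≤qᵃ)) 1≤q k | inj₂ 1≤s =
      0∈p λ 0∈p → k (approximation s r<s 1≤s 0 0 0∈p (ℚₚ.≤-trans (ℚₚ.≤-reflexive (ℚₚ.*-identityʳ s))
        (^-cancelˡ-≤ 0≤1 b (ℚₚ.≤-trans sᵇ≤qᵃ (ℚₚ.≤-reflexive (trans
          (cong (_^ a) (ℚₚ.≤-antisym q≤1 1≤q)) (trans (^-one a) (sym (^-one (suc b))))))))))

    pow-≥0 : ∀ q → fromℚ 0ℚ ≤ℝ ∣ q ∣^ p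
    pow-≥0 q r<0 k = k (0ℚ , r<0 , inj₁ ℚₚ.≤-refl)

    pow-zero : ∀ q → ∣ q ∣ ≡ 0ℚ → ∣ q ∣^ p ≤ℝ fromℚ 0ℚ
    pow-zero q q≡0 {r} (s , r<s , inj₁ s≤0) k = k (ℚₚ.<-≤-trans r<s s≤0)
    pow-zero q q≡0 {r} (s , r<s , inj₂ (a , b , inj₁ (1≤q , _) , _)) k =
      contradiction (subst (1ℚ ≤_) q≡0 1≤q) (<⇒≱ 0<1)
    -- The exponent 0 would admit 0^0 = 1; it is excluded because 0 lies below `p`.
    pow-zero q q≡0 {r} (s , r<s , inj₂ (zero , b , inj₂ (_ , e∉p) , sᵇ≤qᵃ)) k = 0∈p λ 0∈p → e∉p (subst (Below p) (sym (ℚₚ.0/n≡0 (suc b))) 0∈p)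
    pow-zero q q≡0 {r} (s , r<s , inj₂ (suc a , b , inj₂ (_ , e∉p) , sᵇ≤qᵃ)) k =
      k (ℚₚ.<-≤-trans r<s (^-cancelˡ-≤ ℚₚ.≤-refl b (subst (s ^ suc b ≤_)
        (trans (cong (λ x → x ^ suc a) q≡0) (trans (ℚₚ.*-zeroˡ (0ℚ ^ a)) (sym (ℚₚ.*-zeroˡ (0ℚ ^ b))))) sᵇ≤qᵃ)))

    pow-one : ∀ q → ∣ q ∣ ≡ 1ℚ → ∣ q ∣^ p ≤ℝ fromℚ 1ℚ
    pow-one q q≡1 {r} (s , r<s , inj₁ s≤0) k = k (ℚₚ.<-≤-trans r<s (ℚₚ.≤-trans s≤0 0≤1))
    pow-one q q≡1 {r} (s , r<s , inj₂ (a , b , _ , sᵇ≤qᵃ)) k =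
      k (ℚₚ.<-≤-trans r<s (^-cancelˡ-≤ 0≤1 b (subst (s ^ suc b ≤_)
        (trans (cong (_^ a) q≡1) (trans (^-one a) (sym (^-one (suc b))))) sᵇ≤qᵃ)))

    -- x^(b/(b+1)) tends to x, and b/(b+1) < 1 ≤ p.
    pow-≥ : ∀ q → 1ℚ ≤ ∣ q ∣ → fromℚ ∣ q ∣ ≤ℝ ∣ q ∣^ p
    pow-≥ q 1≤q {r} r<q k with ℚₚ.<-dense r<q
    ... | s , r<s , s<q with 0ℚ <? s
    ...   | no s≤0 = k (s , r<s , inj₁ (ℚₚ.≮⇒≥ s≤0))
    ...   | yes 0<s =
      -- With s ρ = |q| and s ≤ ρ^b one has s^(b+1) ≤ ρ^b s^b = |q|^b.
      let ρ , 1<ρ , sρ≡q = quotient>1 0<s s<q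
          b , s≤ρᵇ = powers-unbounded 1<ρ s
      in 1≤p (fraction-mono-< b b 1 0 (exponent b)) λ e∈p →
           k (s , r<s , inj₂ (b , b , inj₁ (1≤q , e∈p) ,
             subst (s * s ^ b ≤_) (trans (sym (^-distrib-* ρ s b)) (cong (_^ b) (trans (ℚₚ.*-comm ρ s) sρ≡q)))
               (ℚₚ.*-monoʳ-≤-nonNeg (s ^ b) {{nonNegative (^-≥0 (ℚₚ.<⇒≤ 0<s) b)}} s≤ρᵇ)))
      where
      exponent : ∀ b → b ℕ.* 1 ℕ.< 1 ℕ.* suc b
      exponent b = subst₂ ℕ._<_ (sym (ℕₚ.*-identityʳ b)) (sym (ℕₚ.*-identityˡ (suc b))) (ℕₚ.n<1+n b)

    powerSum-≥0 : ∀ {n} (v : Vec ℚ n) → fromℚ 0ℚ ≤ℝ powerSum v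
    powerSum-≥0 []      = ≤ℝ-refl (fromℚ 0ℚ)
    powerSum-≥0 (x ∷ v) = ≤ℝ-trans (fromℚ 0ℚ) (fromℚ 0ℚ +ℝ fromℚ 0ℚ) (powerSum (x ∷ v)) (fromℚ-+-≥ 0ℚ 0ℚ)
      (+ℝ-mono (fromℚ 0ℚ) (∣ x ∣^ p) (fromℚ 0ℚ) (powerSum v) (pow-≥0 x) (powerSum-≥0 v))

    -- A substitute for multiplicativity of the real power. An approximation s of x^p is divided by
    -- R = ρ^P; since a ≤ P (b+1), the quotient z satisfies z^(b+1) ≤ y^a, and so cannot exceed c.
    pow-bound : ∀ {x y ρ c} → 1ℚ ≤ x → 1ℚ ≤ y → 1ℚ ≤ ρ → x ≤ ρ * y →
      ∣ y ∣^ p ≤ℝ fromℚ c → ∣ x ∣^ p ≤ℝ fromℚ (c * ρ ^ proj₁ exponent-bound)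
    pow-bound {x} {y} {ρ} {c} 1≤x 1≤y 1≤ρ x≤ρy yᵖ≤c {r} r∈xᵖ k =
      pow-elim {x} r∈xᵖ (subst (1ℚ ≤_) (sym ∣x∣≡x) 1≤x) λ (approximation s r<s 1≤s a b e∈p sᵇ≤xᵃ) →
        let z , Rz≡s = divide s 0<R
            z≤c = ℚₚ.≮⇒≥ λ c<z → yᵖ≤c
              (z , c<z , inj₂ (a , b , inj₁ (subst (1ℚ ≤_) (sym ∣y∣≡y) 1≤y , e∈p) ,
                step z s a b Rz≡s (proj₂ exponent-bound a b e∈p) sᵇ≤xᵃ)) (ℚₚ.<-irrefl refl)
        in k (ℚₚ.<-≤-trans r<s (subst₂ _≤_ Rz≡s (ℚₚ.*-comm R c) (ℚₚ.*-monoˡ-≤-nonNeg R {{nonNegative (ℚₚ.<⇒≤ 0<R)}} z≤c)))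
      where
      P = proj₁ exponent-bound
      R = ρ ^ P
      0<ρ = ℚₚ.<-≤-trans 0<1 1≤ρ
      0<R : 0ℚ < R
      0<R = ^-pos 0<ρ P
      0≤x = ℚₚ.≤-trans 0≤1 1≤x
      0≤y = ℚₚ.≤-trans 0≤1 1≤y
      ∣x∣≡x = ℚₚ.0≤p⇒∣p∣≡p 0≤x
      ∣y∣≡y = ℚₚ.0≤p⇒∣p∣≡p 0≤y
      step : ∀ z s a b → R * z ≡ s → a ℕ.≤ P ℕ.* suc b → s ^ suc b ≤ ∣ x ∣ ^ a → z ^ suc b ≤ ∣ y ∣ ^ a
      step z s a b Rz≡s a≤Pb sᵇ≤xᵃ = ℚₚ.*-cancelˡ-≤-pos (R ^ suc b) {{positive (^-pos 0<R (suc b))}} (begin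
        R ^ suc b * z ^ suc b       ≡⟨ ^-distrib-* R z (suc b) ⟨
        (R * z) ^ suc b             ≡⟨ cong (_^ suc b) Rz≡s ⟩
        s ^ suc b                   ≤⟨ sᵇ≤xᵃ ⟩
        ∣ x ∣ ^ a                   ≡⟨ cong (_^ a) ∣x∣≡x ⟩
        x ^ a                       ≤⟨ ^-monoˡ-≤ 0≤x x≤ρy a ⟩
        (ρ * y) ^ a                 ≡⟨ ^-distrib-* ρ y a ⟩
        ρ ^ a * y ^ a               ≤⟨ ℚₚ.*-monoʳ-≤-nonNeg (y ^ a) {{nonNegative (^-≥0 0≤y a)}} (^-monoʳ-≤ 1≤ρ a≤Pb) ⟩
        ρ ^ (P ℕ.* suc b) * y ^ a   ≡⟨ cong₂ _*_ (sym (^-assocʳ ρ P (suc b))) (cong (_^ a) (sym ∣y∣≡y)) ⟩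
        R ^ suc b * ∣ y ∣ ^ a       ∎)
        where open ℚₚ.≤-Reasoning

    root-mono : ∀ x y → x ≤ℝ y → root p 1≤p x ≤ℝ root p 1≤p y
    root-mono x y x≤y (s , r<s , inj₁ s≤0)          k = k (s , r<s , inj₁ s≤0)
    root-mono x y x≤y (s , r<s , inj₂ (0<s , sᵖ≤x)) k =
      k (s , r<s , inj₂ (0<s , λ {q} → ≤ℝ-trans (∣ s ∣^ p) x y sᵖ≤x x≤y {q}))

    -- If root x ≤ root c held for some d > c below x, then every power of a σ > 1
    -- close enough to 1 would have its p-th power below d.
    root-strict : ∀ x {c d} → 1ℚ ≤ c → c < d → fromℚ d ≤ℝ x → ¬ (root p 1≤p x ≤ℝ root p 1≤p (fromℚ c))
    root-strict x {c} {d} 1≤c c<d d≤x root≤ =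
      let k , d+1≤σᵏ = powers-unbounded 1<σ (d + 1ℚ)
      in <⇒≱ (subst (_< d + 1ℚ) (ℚₚ.+-identityʳ d) (ℚₚ.+-monoʳ-< d 0<1))
          (ℚₚ.≤-trans d+1≤σᵏ (ℚₚ.≤-trans (^-monoʳ-≤ 1≤σ (ℕₚ.n≤1+n k)) (powers≤d k)))
      where
      P = proj₁ exponent-bound
      -- The exponent is 2 P because the induction below compares σ^(k+2) with a rational above σ^k.
      -- The ratio is at most ρ = σ², so what is needed is c ρ^P ≤ d.
      factor = small-factor (ℚₚ.<-≤-trans 0<1 1≤c) c<d (P ℕ.+ P)
      σ = proj₁ factor
      1<σ : 1ℚ < σ
      1<σ = proj₁ (proj₂ factor)
      1≤σ = ℚₚ.<⇒≤ 1<σ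
      0<σ = ℚₚ.<-trans 0<1 1<σ
      ρ = σ * σ
      1≤ρ : 1ℚ ≤ ρ
      1≤ρ = 1≤* 1≤σ 1≤σ
      cρᴾ≤d : c * ρ ^ P ≤ d
      cρᴾ≤d = ℚₚ.<⇒≤ (subst (_< d) (cong (c *_) (trans (^-homo-* σ P P) (sym (^-distrib-* σ σ P)))) (proj₂ (proj₂ factor)))

      powers-pow≤d : ∀ k → ∣ σ ^ suc k ∣^ p ≤ℝ fromℚ d
      powers-pow≤d zero = ≤ℝ-trans (∣ σ ^ 1 ∣^ p) (fromℚ (1ℚ * ρ ^ P)) (fromℚ d)
        (pow-bound (^-≥1 1≤σ 1) ℚₚ.≤-refl 1≤ρ
          (subst (σ ^ 1 ≤_) (sym (ℚₚ.*-identityʳ ρ)) (ℚₚ.*-monoˡ-≤-nonNeg σ {{nonNegative (ℚₚ.<⇒≤ 0<σ)}} 1≤σ))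
          (pow-one 1ℚ refl))
        (fromℚ-mono (ℚₚ.≤-trans (ℚₚ.*-monoʳ-≤-nonNeg (ρ ^ P) {{nonNegative (^-≥0 (ℚₚ.≤-trans 0≤1 1≤ρ) P)}} 1≤c) cρᴾ≤d))
      powers-pow≤d (suc k) {r} r∈ nr∈d =
        -- By induction σ^(k+1) is a witness for σ^k below the root of x. The assumed inequality
        -- then gives some s above σ^k with s^p ≤ c, and σ^(k+2) ≤ ρ s yields the bound c ρ^P ≤ d
        -- for the next power.
        root≤ {σ ^ k} (σ ^ suc k , σᵏ<σᵏ⁺¹ , inj₂ (^-pos 0<σ (suc k) , λ {q} →
          ≤ℝ-trans (∣ σ ^ suc k ∣^ p) (fromℚ d) x (λ {q} → powers-pow≤d k {q}) d≤x {q})) conclude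
        where
        σᵏ<σᵏ⁺¹ : σ ^ k < σ ^ suc k
        σᵏ<σᵏ⁺¹ = subst (_< σ ^ suc k) (ℚₚ.*-identityˡ (σ ^ k)) (ℚₚ.*-monoˡ-<-pos (σ ^ k) {{positive (^-pos 0<σ k)}} 1<σ)
        conclude : ¬ Below (root p 1≤p (fromℚ c)) (σ ^ k)
        conclude (s , σᵏ<s , inj₁ s≤0) = <⇒≱ (ℚₚ.<-trans (^-pos 0<σ k) σᵏ<s) s≤0
        conclude (s , σᵏ<s , inj₂ (0<s , sᵖ≤c)) =
          pow-bound (^-≥1 1≤σ (suc (suc k))) (ℚₚ.≤-trans (^-≥1 1≤σ k) (ℚₚ.<⇒≤ σᵏ<s)) 1≤ρ
            (subst (_≤ ρ * s) (ℚₚ.*-assoc σ σ (σ ^ k))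
              (ℚₚ.*-monoˡ-≤-nonNeg ρ {{nonNegative (ℚₚ.≤-trans 0≤1 1≤ρ)}} (ℚₚ.<⇒≤ σᵏ<s)))
            (λ {q} → sᵖ≤c {q}) {r} r∈ (λ r<c → nr∈d (ℚₚ.<-≤-trans r<c cρᴾ≤d))

      powers≤d : ∀ k → σ ^ suc k ≤ d
      powers≤d k = subst (_≤ d) ∣σ∣≡σ (fromℚ-cancel {∣ σ ^ suc k ∣}
        (≤ℝ-trans (fromℚ ∣ σ ^ suc k ∣) (∣ σ ^ suc k ∣^ p) (fromℚ d)
          (pow-≥ (σ ^ suc k) (subst (1ℚ ≤_) (sym ∣σ∣≡σ) (^-≥1 1≤σ (suc k)))) (λ {q} → powers-pow≤d k {q})))
        where
        ∣σ∣≡σ = ℚₚ.0≤p⇒∣p∣≡p (ℚₚ.<⇒≤ (^-pos 0<σ (suc k)))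

    module _ {u a b} (1≤u : 1ℚ ≤ u) (e∈p : Below p (+ a / suc b)) (uᵇ≤2ᵃ : u ^ suc b ≤ 2ℚ ^ a) where

      private
        0<u = ℚₚ.<-≤-trans 0<1 1≤u

        ∣2x∣ : ∀ x → ∣ 2ℚ * x ∣ ≡ 2ℚ * ∣ x ∣
        ∣2x∣ x = ℚₚ.∣p*q∣≡∣p∣*∣q∣ 2ℚ x

        u*negative : ∀ {w} → w < 0ℚ → u * w < 0ℚ
        u*negative {w} w<0 = subst (u * w <_) (ℚₚ.*-zeroʳ u) (ℚₚ.*-monoʳ-<-pos u {{positive 0<u}} w<0)

      -- Here u is at most 2^(a/(b+1)), while the approximation of |x|^p brings its own exponent
      -- c/(d+1). The larger of the two exponents is still below `p` and serves for the product, as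
      -- both bases are at least 1. For x = 0 the rational w is negative and so is u w.
      pow-scale : ∀ {x w} → ∣ x ∣ ≡ 0ℚ ⊎ 1ℚ ≤ ∣ x ∣ → Below (∣ x ∣^ p) w → ¬ ¬ Below (∣ 2ℚ * x ∣^ p) (u * w)
      pow-scale {x} {w} (inj₁ x≡0) w∈ k = pow-zero x x≡0 w∈ λ w<0 → pow-≥0 (2ℚ * x) (u*negative w<0) k
      pow-scale {x} {w} (inj₂ 1≤x) w∈ k = pow-elim {x} w∈ 1≤x λ (approximation s w<s 1≤s c d e′∈p sᵈ≤xᶜ) →
        k (pow-intro {2ℚ * x} 1≤2x (scaled w<s 1≤s c d e′∈p sᵈ≤xᶜ))
        where
        1≤2x = subst (1ℚ ≤_) (sym (∣2x∣ x)) (1≤* 1≤2 1≤x)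
        scaled : ∀ {s} → w < s → 1ℚ ≤ s → ∀ c d → Below p (+ c / suc d) → s ^ suc d ≤ ∣ x ∣ ^ c →
          Approximation (2ℚ * x) (u * w)
        scaled {s} w<s 1≤s c d e′∈p sᵈ≤xᶜ with ℕₚ.≤-total (a ℕ.* suc d) (c ℕ.* suc b)
        ... | inj₁ ad≤cb = approximation (u * s) (ℚₚ.*-monoʳ-<-pos u {{positive 0<u}} w<s) (1≤* 1≤u 1≤s) c d e′∈p
              (subst (λ y → (u * s) ^ suc d ≤ y ^ c) (sym (∣2x∣ x))
                (*-power-≤ a b c d (ℚₚ.<⇒≤ 0<u) (ℚₚ.≤-trans 0≤1 1≤s) 1≤2 1≤x uᵇ≤2ᵃ sᵈ≤xᶜ ad≤cb))
        ... | inj₂ cb≤ad = approximation (u * s) (ℚₚ.*-monoʳ-<-pos u {{positive 0<u}} w<s) (1≤* 1≤u 1≤s) a b e∈p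
              (subst₂ (λ x y → x ^ suc b ≤ y ^ a) (ℚₚ.*-comm s u) (trans (ℚₚ.*-comm ∣ x ∣ 2ℚ) (sym (∣2x∣ x)))
                (*-power-≤ c d a b (ℚₚ.≤-trans 0≤1 1≤s) (ℚₚ.<⇒≤ 0<u) 1≤x 1≤2 sᵈ≤xᶜ uᵇ≤2ᵃ cb≤ad))

      powerSum-scale : ∀ {n} {v : Vec ℚ n} {w} → All (λ x → ∣ x ∣ ≡ 0ℚ ⊎ 1ℚ ≤ ∣ x ∣) v →
        Below (powerSum v) w → ¬ ¬ Below (powerSum (Vec.map (2ℚ *_) v)) (u * w)
      powerSum-scale []       w<0 k = k (u*negative w<0)
      powerSum-scale {v = x ∷ v} {w} (hx ∷ hv) (y , z , y∈ , z∈ , w<y+z) k =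
        pow-scale {x} hx y∈ λ uy∈ → powerSum-scale hv z∈ λ uz∈ → k (u * y , u * z , uy∈ , uz∈ ,
          subst (u * w <_) (ℚₚ.*-distribˡ-+ u y z) (ℚₚ.*-monoʳ-<-pos u {{positive 0<u}} w<y+z))

    -- A rational below (2s)^p is a product u w with u below 2^p and w below s^p;
    -- then w is below the sum of the |x|^p, hence u w below the sum of the |2x|^p.
    pow-double : ∀ {n s} {v : Vec ℚ n} → 1ℚ ≤ s → All (λ x → ∣ x ∣ ≡ 0ℚ ⊎ 1ℚ ≤ ∣ x ∣) v →
      ∣ s ∣^ p ≤ℝ powerSum v → ∣ 2ℚ * s ∣^ p ≤ℝ powerSum (Vec.map (2ℚ *_) v)
    pow-double {s = s} {v} 1≤s hv sᵖ≤v {r} r∈ k =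
      pow-elim {2ℚ * s} r∈ (subst (1ℚ ≤_) (sym ∣2s∣≡2s) 1≤2s) λ (approximation r₀ r<r₀ 1≤r₀ a b e∈p r₀ᵇ≤) →
        factor r<r₀ (ℚₚ.<-≤-trans 0<1 1≤r₀) a b e∈p (subst (λ x → r₀ ^ suc b ≤ x ^ a) ∣2s∣≡2s r₀ᵇ≤)
      where
      1≤2s : 1ℚ ≤ 2ℚ * s
      1≤2s = 1≤* 1≤2 1≤s
      0≤s = ℚₚ.≤-trans 0≤1 1≤s
      ∣2s∣≡2s = ℚₚ.0≤p⇒∣p∣≡p (ℚₚ.≤-trans 0≤1 1≤2s)
      ∣s∣≡s = ℚₚ.0≤p⇒∣p∣≡p 0≤s

      factor : ∀ {r₀} → r < r₀ → 0ℚ < r₀ → ∀ a b → Below p (+ a / suc b) → r₀ ^ suc b ≤ (2ℚ * s) ^ a → ⊥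
      factor {r₀} r<r₀ 0<r₀ a b e∈p r₀ᵇ≤ =
        -- The gap between r₁ and r₀ = r₁ ρ pays for u = ρ^l, which falls short of 2^(a/(b+1)) by a
        -- factor less than ρ. The bound r₁ > 0 is what makes ρ available.
        let r₁ , m<r₁ , r₁<r₀ = ℚₚ.<-dense (maximum< r<r₀ 0<r₀)
            0<r₁ = ℚₚ.≤-<-trans (ℚₚ.p≤q⊔p r 0ℚ) m<r₁
            r<r₁ = ℚₚ.≤-<-trans (ℚₚ.p≤p⊔q r 0ℚ) m<r₁
            ρ , 1<ρ , r₁ρ≡r₀ = quotient>1 0<r₁ r₁<r₀
            l , uᵇ≤2ᵃ , 2ᵃ<ρuᵇ = power-crossing 1<ρ (^-≥1 1≤2 a) b
            u = ρ ^ l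
            1≤u = ^-≥1 (ℚₚ.<⇒≤ 1<ρ) l
            0<u = ℚₚ.<-≤-trans 0<1 1≤u
            w , uw≡r₁ = divide r₁ 0<u
            t , ut≡r = divide r 0<u
            t<w = ℚₚ.*-cancelˡ-<-nonNeg u {{nonNegative (ℚₚ.<⇒≤ 0<u)}} (subst₂ _<_ (sym ut≡r) (sym uw≡r₁) r<r₁)
            wᵇ≤sᵃ = root-part {ρ} {u} {w} {r₁} 1<ρ 0<u uw≡r₁ r₁ρ≡r₀ a b 2ᵃ<ρuᵇ r₀ᵇ≤
        in sᵖ≤v (w , t<w , inj₂ (a , b , inj₁ (subst (1ℚ ≤_) (sym ∣s∣≡s) 1≤s , e∈p) ,
             subst (λ x → w ^ suc b ≤ x ^ a) (sym ∣s∣≡s) wᵇ≤sᵃ)) λ t∈v →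
           powerSum-scale {u} {a} {b} 1≤u e∈p uᵇ≤2ᵃ hv t∈v λ ut∈2v → k (subst (Below (powerSum (Vec.map (2ℚ *_) v))) ut≡r ut∈2v)
        where
        maximum< : ∀ {x y z} → x < z → y < z → x ⊔ y < z
        maximum< {x} {y} {z} x<z y<z with ℚₚ.⊔-sel x y
        ... | inj₁ eq = subst (_< z) (sym eq) x<z
        ... | inj₂ eq = subst (_< z) (sym eq) y<z

        root-part : ∀ {ρ u w r₁} → 1ℚ < ρ → 0ℚ < u → u * w ≡ r₁ → r₁ * ρ ≡ r₀ → ∀ a b →
          2ℚ ^ a < (ρ * u) ^ suc b → r₀ ^ suc b ≤ (2ℚ * s) ^ a → w ^ suc b ≤ s ^ a
        root-part {ρ} {u} {w} {r₁} 1<ρ 0<u uw≡r₁ r₁ρ≡r₀ a b 2ᵃ<ρuᵇ r₀ᵇ≤ =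
          ℚₚ.*-cancelˡ-≤-pos ((ρ * u) ^ suc b) {{positive (^-pos (*-pos (ℚₚ.<-trans 0<1 1<ρ) 0<u) (suc b))}} (begin
            (ρ * u) ^ suc b * w ^ suc b   ≡⟨ ^-distrib-* (ρ * u) w (suc b) ⟨
            (ρ * u * w) ^ suc b           ≡⟨ cong (_^ suc b) (trans (ℚₚ.*-assoc ρ u w) (trans (cong (ρ *_) uw≡r₁) (trans (ℚₚ.*-comm ρ r₁) r₁ρ≡r₀))) ⟩
            r₀ ^ suc b                    ≤⟨ r₀ᵇ≤ ⟩
            (2ℚ * s) ^ a                  ≡⟨ ^-distrib-* 2ℚ s a ⟩
            2ℚ ^ a * s ^ a                ≤⟨ ℚₚ.*-monoʳ-≤-nonNeg (s ^ a) {{nonNegative (^-≥0 0≤s a)}} (ℚₚ.<⇒≤ 2ᵃ<ρuᵇ) ⟩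
            (ρ * u) ^ suc b * s ^ a       ∎)
          where open ℚₚ.≤-Reasoning

    -- A rational s with s^p at most the power sum of v is doubled by `pow-double`, which asks for s
    -- ≥ 1. Since the power sum is at least 1, any smaller s may be raised to 1 first.
    norm-half : ∀ {n} {v : Vec ℚ n} x → fromℚ 1ℚ ≤ℝ powerSum v → All (λ x → ∣ x ∣ ≡ 0ℚ ⊎ 1ℚ ≤ ∣ x ∣) v →
      norm p 1≤p (Vec.map (2ℚ *_) v) ≤ℝ root p 1≤p x → norm p 1≤p v ≤ℝ ½ · root p 1≤p x
    norm-half {v = v} x 1≤v hv 2v≤x {r} r∈ k =
      let s , r<s , 1≤s , sᵖ≤v = at-least-1 r∈
          t , r<t , t<s = ℚₚ.<-dense r<s
      in 2v≤x (2ℚ * s , ℚₚ.*-monoʳ-<-pos 2ℚ t<s ,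
                inj₂ (*-pos (ℚₚ.<-≤-trans 0<1 1≤2) (ℚₚ.<-≤-trans 0<1 1≤s) , λ {q} → pow-double 1≤s hv sᵖ≤v {q}))
           λ 2t∈ → k (2ℚ * t , 2t∈ , subst (r <_) (sym (half-double t)) r<t)
      where
      half-double : ∀ t → ½ * (2ℚ * t) ≡ t
      half-double t = trans (sym (ℚₚ.*-assoc ½ 2ℚ t)) (ℚₚ.*-identityˡ t)

      at-least-1 : Below (norm p 1≤p v) r → ∃[ s ] r < s × 1ℚ ≤ s × (∣ s ∣^ p ≤ℝ powerSum v)
      at-least-1 (s , r<s , h) with ℚₚ.≤-total s 1ℚ
      ... | inj₁ s≤1 = 1ℚ , ℚₚ.<-≤-trans r<s s≤1 , ℚₚ.≤-refl ,
                       λ {q} → ≤ℝ-trans (∣ 1ℚ ∣^ p) (fromℚ 1ℚ) (powerSum v) (pow-one 1ℚ refl) 1≤v {q}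
      at-least-1 (s , r<s , inj₁ s≤0)         | inj₂ 1≤s = contradiction (ℚₚ.≤-trans 1≤s s≤0) (<⇒≱ 0<1)
      at-least-1 (s , r<s , inj₂ (_ , sᵖ≤v)) | inj₂ 1≤s = s , r<s , 1≤s , sᵖ≤v

module Lattices where
  open import Data.Bool using (Bool; true; false; if_then_else_)
  open import Data.Empty using (⊥; ⊥-elim)
  open import Data.Fin.Subset using (Subset) renaming (∣_∣ to card)
  open import Data.Integer as ℤ using (ℤ; +_; -[1+_]; 0ℤ)
  import Data.Integer.Properties as ℤₚ
  open import Data.Integer.Tactic.RingSolver using (solve-∀)
  open import Data.Nat as ℕ using (ℕ; zero; suc)
  import Data.Nat.Properties as ℕₚ
  open import Data.Product using (∃-syntax; _×_; _,_; proj₁; proj₂)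
  open import Data.Rational
  import Data.Rational.Properties as ℚₚ
  open import Data.Rational.Solver using (module +-*-Solver)
  open import Data.Sum using (_⊎_; inj₁; inj₂)
  open import Data.Vec as Vec using (Vec; []; _∷_; zipWith; replicate)
  import Data.Vec.Properties as Vecₚ
  open import Data.Vec.Relation.Unary.All using (All; []; _∷_)
  open import Relation.Binary.PropositionalEquality
  open import Relation.Nullary using (¬_; contradiction)
  open Reals

  -- Integer vectors of small ℓ₁-norm.

  dot : ∀ {n} → Vec ℕ n → Vec ℤ n → ℤ
  dot a x = sumℤ (zipWith (λ aᵢ xᵢ → + aᵢ ℤ.* xᵢ) a x)

  ℓ₁ : ∀ {n} → Vec ℤ n → ℕ
  ℓ₁ x = Vec.sum (Vec.map ℤ.∣_∣ x)

  interleave : ∀ {A : Set} {n} → Vec A n → A → A → Vec A (n ℕ.* 3)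
  interleave []       a b = []
  interleave (y ∷ ys) a b = y ∷ a ∷ b ∷ interleave ys a b

  ℓ₁-interleave : ∀ {n} (y : Vec ℤ n) a b → ℓ₁ (interleave y a b) ≡ ℓ₁ y ℕ.+ n ℕ.* (ℤ.∣ a ∣ ℕ.+ ℤ.∣ b ∣)
  ℓ₁-interleave []      a b = refl
  ℓ₁-interleave {suc n} (x ∷ y) a b rewrite ℓ₁-interleave y a b = rearrange ℤ.∣ x ∣ ℤ.∣ a ∣ ℤ.∣ b ∣ (ℓ₁ y) n
    where
    open import Data.Nat.Tactic.RingSolver renaming (solve-∀ to solveℕ-∀)
    rearrange : ∀ x a b y n → x ℕ.+ (a ℕ.+ (b ℕ.+ (y ℕ.+ n ℕ.* (a ℕ.+ b)))) ≡ x ℕ.+ y ℕ.+ (a ℕ.+ b ℕ.+ n ℕ.* (a ℕ.+ b))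
    rearrange = solveℕ-∀

  ∣sum∣≤ℓ₁ : ∀ {n} (y : Vec ℤ n) → ℤ.∣ sumℤ y ∣ ℕ.≤ ℓ₁ y
  ∣sum∣≤ℓ₁ []      = ℕ.z≤n
  ∣sum∣≤ℓ₁ (x ∷ y) = ℕₚ.≤-trans (ℤₚ.∣i+j∣≤∣i∣+∣j∣ x (sumℤ y)) (ℕₚ.+-monoʳ-≤ ℤ.∣ x ∣ (∣sum∣≤ℓ₁ y))

  centred : ∀ {n} → ℤ → Vec ℤ n → Vec ℤ n
  centred t = Vec.map λ xᵢ → + 2 ℤ.* xᵢ ℤ.- t

  sum-centred : ∀ {n} t (x : Vec ℤ n) → sumℤ (centred t x) ≡ + 2 ℤ.* sumℤ x ℤ.- + n ℤ.* t
  sum-centred t []      = identity t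
    where
    identity : ∀ t → 0ℤ ≡ + 2 ℤ.* 0ℤ ℤ.- 0ℤ ℤ.* t
    identity = solve-∀
  sum-centred {suc n} t (x ∷ xs) = trans (cong (λ s → + 2 ℤ.* x ℤ.- t ℤ.+ s) (sum-centred t xs)) (identity t x (sumℤ xs) (+ n))
    where
    identity : ∀ t x s n → + 2 ℤ.* x ℤ.- t ℤ.+ (+ 2 ℤ.* s ℤ.- n ℤ.* t) ≡ + 2 ℤ.* (x ℤ.+ s) ℤ.- (+ 1 ℤ.+ n) ℤ.* t
    identity = solve-∀

  ℓ₁≡0 : ∀ {n} (y : Vec ℤ n) → ℓ₁ y ≡ 0 → y ≡ replicate n 0ℤ
  ℓ₁≡0 []      _ = refl
  ℓ₁≡0 (x ∷ y) h = cong₂ _∷_ (ℤₚ.∣i∣≡0⇒i≡0 (ℕₚ.m+n≡0⇒m≡0 ℤ.∣ x ∣ h)) (ℓ₁≡0 y (ℕₚ.m+n≡0⇒n≡0 ℤ.∣ x ∣ h))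

  centred-0≡0 : ∀ {n} (x : Vec ℤ n) → centred 0ℤ x ≡ replicate n 0ℤ → x ≡ replicate n 0ℤ
  centred-0≡0 []      _ = refl
  centred-0≡0 (x ∷ xs) h = cong₂ _∷_
    (ℤₚ.*-cancelˡ-≡ (+ 2) x 0ℤ (trans (sym (ℤₚ.+-identityʳ (+ 2 ℤ.* x))) (Vecₚ.∷-injectiveˡ h)))
    (centred-0≡0 xs (Vecₚ.∷-injectiveʳ h))

  ∣i∣≡∣j∣⇒i≡±j : ∀ i j → ℤ.∣ i ∣ ≡ ℤ.∣ j ∣ → i ≡ j ⊎ i ≡ ℤ.- j
  ∣i∣≡∣j∣⇒i≡±j (+ m)    (+ n)    eq = inj₁ (cong +_ eq)
  ∣i∣≡∣j∣⇒i≡±j (+ m)    -[1+ n ] eq = inj₂ (cong +_ eq)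
  ∣i∣≡∣j∣⇒i≡±j -[1+ m ] (+ n)    eq = inj₂ (cong (λ k → ℤ.- (+ k)) eq)
  ∣i∣≡∣j∣⇒i≡±j -[1+ m ] -[1+ n ] eq = inj₁ (cong (λ k → ℤ.- (+ k)) eq)

  -- A 0/1-coordinate multiplied by t, so that solutions of both signs are treated at once.
  bit : ℤ → Bool → ℤ
  bit t b = if b then t else 0ℤ

  sum-bits : ∀ {n} t (b : Subset n) → sumℤ (Vec.map (bit t) b) ≡ t ℤ.* + card b
  sum-bits t []          = sym (ℤₚ.*-zeroʳ t)
  sum-bits t (true ∷ b)  = trans (cong (λ s → t ℤ.+ s) (sum-bits t b)) (identity t (+ card b))
    where
    identity : ∀ t c → t ℤ.+ t ℤ.* c ≡ t ℤ.* (+ 1 ℤ.+ c)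
    identity = solve-∀
  sum-bits t (false ∷ b) = trans (ℤₚ.+-identityˡ _) (sum-bits t b)

  dot-bits : ∀ {n} t (a : Vec ℕ n) (b : Subset n) → dot a (Vec.map (bit t) b) ≡ t ℤ.* + subsetSum a b
  dot-bits t []      []          = sym (ℤₚ.*-zeroʳ t)
  dot-bits t (a ∷ as) (true ∷ b)  = trans (cong (λ s → + a ℤ.* t ℤ.+ s) (dot-bits t as b)) (identity t (+ a) (+ subsetSum as b))
    where
    identity : ∀ t a c → a ℤ.* t ℤ.+ t ℤ.* c ≡ t ℤ.* (a ℤ.+ c)
    identity = solve-∀
  dot-bits t (a ∷ as) (false ∷ b) = trans (cong₂ ℤ._+_ (ℤₚ.*-zeroʳ (+ a)) (dot-bits t as b)) (ℤₚ.+-identityˡ _)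

  module _ (t : ℤ) (∣t∣≡1 : ℤ.∣ t ∣ ≡ 1) where

    -- Parity: were the difference 0, then 2 |x| = 1.
    ∣2x-t∣≥1 : ∀ x → 1 ℕ.≤ ℤ.∣ + 2 ℤ.* x ℤ.- t ∣
    ∣2x-t∣≥1 x = ℕₚ.n≢0⇒n>0 λ h → even≢odd ℤ.∣ x ∣ (trans (sym (ℤₚ.abs-* (+ 2) x))
      (trans (cong ℤ.∣_∣ (ℤₚ.i-j≡0⇒i≡j (+ 2 ℤ.* x) t (ℤₚ.∣i∣≡0⇒i≡0 h))) ∣t∣≡1))
      where
      even≢odd : ∀ m → 2 ℕ.* m ≢ 1
      even≢odd (suc m) h with () ← trans (sym (ℕₚ.+-suc m (m ℕ.+ 0))) (ℕₚ.suc-injective h)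

    ℓ₁-centred≥n : ∀ {n} (x : Vec ℤ n) → n ℕ.≤ ℓ₁ (centred t x)
    ℓ₁-centred≥n []       = ℕ.z≤n
    ℓ₁-centred≥n (x ∷ xs) = ℕₚ.+-mono-≤ (∣2x-t∣≥1 x) (ℓ₁-centred≥n xs)

    -- Entries that are at least 1 and add up to at most n are all equal to 1. Then 2x - t is t or
    -- -t, that is, x is t or 0.
    bits : ∀ {n} (x : Vec ℤ n) → ℓ₁ (centred t x) ℕ.≤ n → ∃[ b ] x ≡ Vec.map (bit t) b
    bits []       h = [] , refl
    bits (x ∷ xs) h =
      -- The head takes at least 1 of the budget, which leaves the tail its own length; conversely
      -- the tail takes all but 1.
      let b , xs≡ = bits xs (ℕₚ.+-cancelˡ-≤ 1 _ _ (ℕₚ.≤-trans (ℕₚ.+-monoˡ-≤ _ (∣2x-t∣≥1 x)) h))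
          c , x≡ = digit (∣i∣≡∣j∣⇒i≡±j (+ 2 ℤ.* x ℤ.- t) t (trans (ℕₚ.≤-antisym head≤1 (∣2x-t∣≥1 x)) (sym ∣t∣≡1)))
      in c ∷ b , cong₂ _∷_ x≡ xs≡
      where
      n = Vec.length xs
      head≤1 : ℤ.∣ + 2 ℤ.* x ℤ.- t ∣ ℕ.≤ 1
      head≤1 = ℕₚ.+-cancelʳ-≤ n _ 1 (ℕₚ.≤-trans (ℕₚ.+-monoʳ-≤ ℤ.∣ + 2 ℤ.* x ℤ.- t ∣ (ℓ₁-centred≥n xs)) h)
      cancel-t : ∀ x t → + 2 ℤ.* x ≡ + 2 ℤ.* x ℤ.- t ℤ.+ t
      cancel-t = solve-∀
      twice : ∀ t → t ℤ.+ t ≡ + 2 ℤ.* t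
      twice = solve-∀
      digit : + 2 ℤ.* x ℤ.- t ≡ t ⊎ + 2 ℤ.* x ℤ.- t ≡ ℤ.- t → ∃[ c ] x ≡ bit t c
      digit (inj₁ h) = true , ℤₚ.*-cancelˡ-≡ (+ 2) x t (trans (cancel-t x t) (trans (cong (ℤ._+ t) h) (twice t)))
      digit (inj₂ h) = false , ℤₚ.*-cancelˡ-≡ (+ 2) x 0ℤ (trans (cancel-t x t) (trans (cong (ℤ._+ t) h) (ℤₚ.+-inverseˡ t)))

    ∣centred-bit∣≡1 : ∀ b → ℤ.∣ + 2 ℤ.* bit t b ℤ.- t ∣ ≡ 1
    ∣centred-bit∣≡1 true  = trans (cong ℤ.∣_∣ (identity t)) ∣t∣≡1
      where
      identity : ∀ t → + 2 ℤ.* t ℤ.- t ≡ t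
      identity = solve-∀
    ∣centred-bit∣≡1 false = trans (cong ℤ.∣_∣ (ℤₚ.+-identityˡ (ℤ.- t))) (trans (ℤₚ.∣-i∣≡∣i∣ t) ∣t∣≡1)

  module Combinatorics {n} (a : Vec ℕ n) (s : ℕ) {{_ : ℕ.NonZero n}} where

    weightDefect : ℤ → Vec ℤ n → ℤ
    weightDefect t x = dot a x ℤ.- t ℤ.* + s

    sizeDefect : ℤ → Vec ℤ n → ℤ
    sizeDefect t x = + 6 ℤ.* sumℤ x ℤ.- t ℤ.* + (5 ℕ.* n)

    size-identity : ∀ t x → + 2 ℤ.* (+ n ℤ.* t) ≡ + 3 ℤ.* sumℤ (centred t x) ℤ.- sizeDefect t x
    size-identity t x = sym (trans
      (cong₂ (λ y m → + 3 ℤ.* y ℤ.- (+ 6 ℤ.* sumℤ x ℤ.- t ℤ.* m)) (sum-centred t x) (ℤₚ.pos-* 5 n))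
      (identity t (sumℤ x) (+ n)))
      where
      identity : ∀ t s n → + 3 ℤ.* (+ 2 ℤ.* s ℤ.- n ℤ.* t) ℤ.- (+ 6 ℤ.* s ℤ.- t ℤ.* (+ 5 ℤ.* n)) ≡ + 2 ℤ.* (n ℤ.* t)
      identity = solve-∀

    -- The size defect is kept in the bound, since one case of `short-cases` uses it while the
    -- defect may still be 1.
    size-bound : ∀ t x → 2 ℕ.* (n ℕ.* ℤ.∣ t ∣) ℕ.≤ 3 ℕ.* ℓ₁ (centred t x) ℕ.+ ℤ.∣ sizeDefect t x ∣
    size-bound t x = begin
      2 ℕ.* (n ℕ.* ℤ.∣ t ∣)                                     ≡⟨ cong (2 ℕ.*_) (ℤₚ.abs-* (+ n) t) ⟨
      2 ℕ.* ℤ.∣ + n ℤ.* t ∣                                     ≡⟨ ℤₚ.abs-* (+ 2) (+ n ℤ.* t) ⟨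
      ℤ.∣ + 2 ℤ.* (+ n ℤ.* t) ∣                                 ≡⟨ cong ℤ.∣_∣ (size-identity t x) ⟩
      ℤ.∣ + 3 ℤ.* Σy ℤ.- sizeDefect t x ∣                       ≤⟨ ℤₚ.∣i-j∣≤∣i∣+∣j∣ (+ 3 ℤ.* Σy) (sizeDefect t x) ⟩
      ℤ.∣ + 3 ℤ.* Σy ∣ ℕ.+ ℤ.∣ sizeDefect t x ∣                 ≡⟨ cong (ℕ._+ ℤ.∣ sizeDefect t x ∣) (ℤₚ.abs-* (+ 3) Σy) ⟩
      3 ℕ.* ℤ.∣ Σy ∣ ℕ.+ ℤ.∣ sizeDefect t x ∣                   ≤⟨ ℕₚ.+-monoˡ-≤ _ (ℕₚ.*-monoʳ-≤ 3 (∣sum∣≤ℓ₁ (centred t x))) ⟩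
      3 ℕ.* ℓ₁ (centred t x) ℕ.+ ℤ.∣ sizeDefect t x ∣           ∎
      where
      open ℕₚ.≤-Reasoning
      Σy = sumℤ (centred t x)

    -- A repeated entry of absolute value 1 has ℓ₁-norm exactly n, so repetition alone does not
    -- exclude it. But then nothing is left for the centred entries, the size defect is at most 1,
    -- and 2 n |t| ≤ 1 gives t = 0 and x = 0. If both repeated entries vanish, 2 n |t| ≤ 3 n.
    short-cases : ∀ t x → ¬ (t ≡ 0ℤ × x ≡ replicate n 0ℤ) →
      ℓ₁ (interleave (centred t x) (weightDefect t x) (sizeDefect t x)) ℕ.≤ n →
      (t ≡ 0ℤ ⊎ ℤ.∣ t ∣ ≡ 1) × ℓ₁ (centred t x) ℕ.≤ n × weightDefect t x ≡ 0ℤ × sizeDefect t x ≡ 0ℤ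
    short-cases t x t,x≢0 short = cases (D ℕ.+ Z) refl
      (subst (ℕ._≤ n) (ℓ₁-interleave (centred t x) (weightDefect t x) (sizeDefect t x)) short)
      where
      L = ℓ₁ (centred t x)
      D = ℤ.∣ weightDefect t x ∣
      Z = ℤ.∣ sizeDefect t x ∣
      open ℕₚ.≤-Reasoning

      cases : ∀ m → m ≡ D ℕ.+ Z → L ℕ.+ n ℕ.* m ℕ.≤ n →
        (t ≡ 0ℤ ⊎ ℤ.∣ t ∣ ≡ 1) × L ℕ.≤ n × weightDefect t x ≡ 0ℤ × sizeDefect t x ≡ 0ℤ
      cases zero eq le = t-cases ℤ.∣ t ∣ refl 2t≤3 , L≤n
                       , ℤₚ.∣i∣≡0⇒i≡0 (ℕₚ.m+n≡0⇒m≡0 D (sym eq)) , ℤₚ.∣i∣≡0⇒i≡0 Z≡0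
        where
        L≤n = ℕₚ.m+n≤o⇒m≤o L le
        Z≡0 = ℕₚ.m+n≡0⇒n≡0 D (sym eq)
        2t≤3 : 2 ℕ.* ℤ.∣ t ∣ ℕ.≤ 3
        2t≤3 = ℕₚ.*-cancelˡ-≤ n (begin
          n ℕ.* (2 ℕ.* ℤ.∣ t ∣)    ≡⟨ ℕₚ.*-assoc n 2 _ ⟨
          n ℕ.* 2 ℕ.* ℤ.∣ t ∣      ≡⟨ cong (ℕ._* ℤ.∣ t ∣) (ℕₚ.*-comm n 2) ⟩
          2 ℕ.* n ℕ.* ℤ.∣ t ∣      ≡⟨ ℕₚ.*-assoc 2 n _ ⟩
          2 ℕ.* (n ℕ.* ℤ.∣ t ∣)    ≤⟨ size-bound t x ⟩
          3 ℕ.* L ℕ.+ Z            ≡⟨ cong (3 ℕ.* L ℕ.+_) Z≡0 ⟩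
          3 ℕ.* L ℕ.+ 0            ≡⟨ ℕₚ.+-identityʳ _ ⟩
          3 ℕ.* L                  ≤⟨ ℕₚ.*-monoʳ-≤ 3 L≤n ⟩
          3 ℕ.* n                  ≡⟨ ℕₚ.*-comm 3 n ⟩
          n ℕ.* 3                  ∎)
        t-cases : ∀ k → k ≡ ℤ.∣ t ∣ → 2 ℕ.* k ℕ.≤ 3 → t ≡ 0ℤ ⊎ ℤ.∣ t ∣ ≡ 1
        t-cases 0             eq _ = inj₁ (ℤₚ.∣i∣≡0⇒i≡0 (sym eq))
        t-cases 1             eq _ = inj₂ (sym eq)
        t-cases (suc (suc k)) eq h = contradiction (ℕₚ.≤-trans (ℕₚ.*-monoʳ-≤ 2 (ℕ.s≤s (ℕ.s≤s (ℕ.z≤n {k})))) h) λ { (ℕ.s≤s (ℕ.s≤s (ℕ.s≤s ()))) }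
      cases (suc m) eq le = contradiction (t≡0 , x≡0) t,x≢0
        where
        n≤nm : n ℕ.≤ n ℕ.* suc m
        n≤nm = ℕₚ.m≤m*n n (suc m)
        L≡0 : L ≡ 0
        L≡0 = ℕₚ.n≤0⇒n≡0 (ℕₚ.+-cancelʳ-≤ n L 0 (ℕₚ.≤-trans (ℕₚ.+-monoʳ-≤ L n≤nm) le))
        Z≤1 : Z ℕ.≤ 1
        Z≤1 = ℕₚ.≤-trans (subst (Z ℕ.≤_) (sym eq) (ℕₚ.m≤n+m Z D)) (ℕₚ.*-cancelˡ-≤ n
          (subst (n ℕ.* suc m ℕ.≤_) (sym (ℕₚ.*-identityʳ n)) (ℕₚ.m+n≤o⇒n≤o L le)))
        2nt≤1 : 2 ℕ.* (n ℕ.* ℤ.∣ t ∣) ℕ.≤ 1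
        2nt≤1 = ℕₚ.≤-trans (size-bound t x) (subst (λ l → 3 ℕ.* l ℕ.+ Z ℕ.≤ 1) (sym L≡0) Z≤1)
        nt≡0 : ∀ k → 2 ℕ.* k ℕ.≤ 1 → k ≡ 0
        nt≡0 zero    _ = refl
        nt≡0 (suc k) h with ℕ.s≤s () ← subst (ℕ._≤ 1) (cong suc (ℕₚ.+-suc k (k ℕ.+ 0))) h
        t≡0 : t ≡ 0ℤ
        t≡0 = ℤₚ.∣i∣≡0⇒i≡0 (ℕₚ.m*n≡0⇒m≡0 ℤ.∣ t ∣ n (trans (ℕₚ.*-comm ℤ.∣ t ∣ n) (nt≡0 _ 2nt≤1)))
        x≡0 = centred-0≡0 x (subst (λ u → centred u x ≡ replicate n 0ℤ) t≡0 (ℓ₁≡0 (centred t x) L≡0))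

  -- The basis and its linear combinations.

  doubledUnits : ∀ n → Vec (Vec ℤ n) n
  doubledUnits zero    = []
  doubledUnits (suc n) = (+ 2 ∷ replicate n 0ℤ) ∷ Vec.map (0ℤ ∷_) (doubledUnits n)

  weightRow : ∀ {n} → Vec ℤ n → ℕ → Vec ℤ (n ℕ.* 3)
  weightRow δ aᵢ = interleave δ (+ aᵢ) (+ 6)

  targetRow : ∀ n → ℕ → Vec ℤ (n ℕ.* 3)
  targetRow n s = interleave (replicate n (ℤ.- + 1)) (ℤ.- + s) (ℤ.- + (5 ℕ.* n))

  rows : ∀ {n} → Vec ℕ n → ℕ → Vec (Vec ℤ (n ℕ.* 3)) (suc n)
  rows {n} a s = targetRow n s ∷ zipWith weightRow (doubledUnits n) a

  zeros : ∀ n → Vec ℚ n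
  zeros n = replicate n 0ℚ

  interleave-zeros : ∀ n → interleave (zeros n) 0ℚ 0ℚ ≡ zeros (n ℕ.* 3)
  interleave-zeros zero    = refl
  interleave-zeros (suc n) = cong (λ v → 0ℚ ∷ 0ℚ ∷ 0ℚ ∷ v) (interleave-zeros n)

  map-interleave : ∀ {A B : Set} (f : A → B) {n} (y : Vec A n) a b →
    Vec.map f (interleave y a b) ≡ interleave (Vec.map f y) (f a) (f b)
  map-interleave f []      a b = refl
  map-interleave f (x ∷ y) a b = cong (λ v → f x ∷ f a ∷ f b ∷ v) (map-interleave f y a b)

  zipWith-interleave : ∀ {A : Set} (f : A → A → A) {n} (y y′ : Vec A n) a a′ b b′ →
    zipWith f (interleave y a b) (interleave y′ a′ b′) ≡ interleave (zipWith f y y′) (f a a′) (f b b′)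
  zipWith-interleave f []      []        a a′ b b′ = refl
  zipWith-interleave f (x ∷ y) (x′ ∷ y′) a a′ b b′ =
    cong (λ v → f x x′ ∷ f a a′ ∷ f b b′ ∷ v) (zipWith-interleave f y y′ a a′ b b′)

  interleave-injective : ∀ {A : Set} {n} (y y′ : Vec A n) {a a′ b b′} → n ≢ 0 →
    interleave y a b ≡ interleave y′ a′ b′ → y ≡ y′ × a ≡ a′ × b ≡ b′
  interleave-injective []          []        n≢0 _  = contradiction refl n≢0
  interleave-injective (x ∷ y) (x′ ∷ y′) _   eq =
    cong₂ _∷_ (Vecₚ.∷-injectiveˡ eq) (tails y y′ (Vecₚ.∷-injectiveʳ (Vecₚ.∷-injectiveʳ (Vecₚ.∷-injectiveʳ eq)))) ,
    Vecₚ.∷-injectiveˡ (Vecₚ.∷-injectiveʳ eq) , Vecₚ.∷-injectiveˡ (Vecₚ.∷-injectiveʳ (Vecₚ.∷-injectiveʳ eq))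
    where
    tails : ∀ {A : Set} {n} (y y′ : Vec A n) {a a′ b b′} → interleave y a b ≡ interleave y′ a′ b′ → y ≡ y′
    tails []      []        _  = refl
    tails (x ∷ y) (x′ ∷ y′) eq = cong₂ _∷_ (Vecₚ.∷-injectiveˡ eq)
      (tails y y′ (Vecₚ.∷-injectiveʳ (Vecₚ.∷-injectiveʳ (Vecₚ.∷-injectiveʳ eq))))

  dotℚ : ∀ {n} → Vec ℚ n → Vec ℕ n → ℚ
  dotℚ []       []       = 0ℚ
  dotℚ (x ∷ xs) (a ∷ as) = x * toℚ (+ a) + dotℚ xs as

  +-zeros : ∀ {n} x (v : Vec ℚ n) → zipWith _+_ (Vec.map (x *_) (zeros n)) v ≡ v
  +-zeros x []      = refl
  +-zeros x (y ∷ v) = cong₂ _∷_ (trans (cong (_+ y) (ℚₚ.*-zeroʳ x)) (ℚₚ.+-identityˡ y)) (+-zeros x v)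

  combination-zeros : ∀ {n m} (B : Vec (Vec ℚ m) n) → combination (zeros n) B ≡ zeros m
  combination-zeros []      = refl
  combination-zeros (b ∷ B) = trans (cong (zipWith _+_ (Vec.map (0ℚ *_) b)) (combination-zeros B)) (head b)
    where
    head : ∀ {m} (b : Vec ℚ m) → zipWith _+_ (Vec.map (0ℚ *_) b) (zeros m) ≡ zeros m
    head []      = refl
    head (x ∷ b) = cong₂ _∷_ (trans (ℚₚ.+-identityʳ (0ℚ * x)) (ℚₚ.*-zeroˡ x)) (head b)

  -- Rows and columns are counted separately, as the induction removes rows and keeps all columns.
  combination-weightRows : ∀ {n m} (xs : Vec ℚ n) (δ : Vec (Vec ℤ m) n) (a : Vec ℕ n) →
    combination xs (Vec.map (Vec.map toℚ) (zipWith weightRow δ a))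
      ≡ interleave (combination xs (Vec.map (Vec.map toℚ) δ)) (dotℚ xs a) (dotℚ xs (replicate n 6))
  combination-weightRows {m = m} []  []      []       = sym (interleave-zeros m)
  combination-weightRows (x ∷ xs) (d ∷ δ) (a ∷ as)
    rewrite combination-weightRows xs δ as
          | map-interleave toℚ d (+ a) (+ 6)
          | map-interleave (x *_) (Vec.map toℚ d) (toℚ (+ a)) (toℚ (+ 6))
    = zipWith-interleave _+_ _ _ _ _ _ _

  combination-shift : ∀ {n m} (xs : Vec ℚ n) (U : Vec (Vec ℤ m) n) →
    combination xs (Vec.map (Vec.map toℚ) (Vec.map (0ℤ ∷_) U)) ≡ 0ℚ ∷ combination xs (Vec.map (Vec.map toℚ) U)
  combination-shift []       []      = refl
  combination-shift (x ∷ xs) (u ∷ U) rewrite combination-shift xs U =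
    cong (_∷ zipWith _+_ (Vec.map (x *_) (Vec.map toℚ u)) (combination xs (Vec.map (Vec.map toℚ) U)))
      (trans (ℚₚ.+-identityʳ (x * 0ℚ)) (ℚₚ.*-zeroʳ x))

  combination-doubledUnits : ∀ {n} (xs : Vec ℚ n) →
    combination xs (Vec.map (Vec.map toℚ) (doubledUnits n)) ≡ Vec.map (2ℚ *_) xs
  combination-doubledUnits []       = refl
  combination-doubledUnits {suc n} (x ∷ xs)
    rewrite combination-shift xs (doubledUnits n)
          | Vecₚ.map-replicate toℚ 0ℤ n
          | +-zeros x (combination xs (Vec.map (Vec.map toℚ) (doubledUnits n)))
    = cong₂ _∷_ (trans (ℚₚ.+-identityʳ (x * toℚ (+ 2))) (ℚₚ.*-comm x 2ℚ)) (combination-doubledUnits xs)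

  -- The coefficients are rational because linear independence and the shape of the lattice vectors
  -- are both read off from this formula.
  combination-rows : ∀ {n} t (xs : Vec ℚ n) (a : Vec ℕ n) s →
    combination (t ∷ xs) (Vec.map (Vec.map toℚ) (rows a s))
      ≡ interleave (Vec.map (λ x → 2ℚ * x - t) xs) (dotℚ xs a - t * toℚ (+ s))
          (dotℚ xs (replicate n 6) - t * toℚ (+ (5 ℕ.* n)))
  combination-rows {n} t xs a s
    rewrite combination-weightRows xs (doubledUnits n) a
          | combination-doubledUnits xs
          | map-interleave toℚ (replicate n (ℤ.- + 1)) (ℤ.- + s) (ℤ.- + (5 ℕ.* n))
          | map-interleave (t *_) (Vec.map toℚ (replicate n (ℤ.- + 1))) (toℚ (ℤ.- + s)) (toℚ (ℤ.- + (5 ℕ.* n)))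
          | zipWith-interleave _+_ (Vec.map (t *_) (Vec.map toℚ (replicate n (ℤ.- + 1)))) (Vec.map (2ℚ *_) xs)
              (t * toℚ (ℤ.- + s)) (dotℚ xs a) (t * toℚ (ℤ.- + (5 ℕ.* n))) (dotℚ xs (replicate n 6))
          | Vecₚ.map-replicate toℚ (ℤ.- + 1) n
    = trans (cong (λ y → interleave y (t * toℚ (ℤ.- + s) + dotℚ xs a) (t * toℚ (ℤ.- + (5 ℕ.* n)) + dotℚ xs (replicate n 6))) (centre xs))
      (cong₂ (interleave (Vec.map (λ x → 2ℚ * x - t) xs)) (defect s (dotℚ xs a)) (defect (5 ℕ.* n) (dotℚ xs (replicate n 6))))
    where
    open +-*-Solver
    defect : ∀ s d → t * toℚ (ℤ.- + s) + d ≡ d - t * toℚ (+ s)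
    defect s d = trans (cong (λ z → t * z + d) (toℚ-neg (+ s)))
      (solve 3 (λ t s d → t :* (:- s) :+ d := d :- t :* s) refl t (toℚ (+ s)) d)
    centre : ∀ {n} (xs : Vec ℚ n) → zipWith _+_ (Vec.map (t *_) (replicate n (- 1ℚ))) (Vec.map (2ℚ *_) xs) ≡ Vec.map (λ x → 2ℚ * x - t) xs
    centre []       = refl
    centre (x ∷ xs) = cong₂ _∷_
      (solve 2 (λ t y → t :* (:- con 1ℚ) :+ y := y :- t) refl t (2ℚ * x)) (centre xs)

  -- Vanishing centred entries give 2xⱼ = t, so 6 times the sum of the xⱼ is 3 n t. The size entry
  -- equates it with 5 n t, whence t = 0 and then every xⱼ = 0.
  rows-independent : ∀ {n} (a : Vec ℕ n) s → n ≢ 0 → LinearlyIndependent (Vec.map (Vec.map toℚ) (rows a s))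
  rows-independent {n} a s n≢0 (t ∷ xs) comb≡0 = cong₂ _∷_ t≡0 (xs≡0 xs (subst (λ t → Vec.map (λ x → 2ℚ * x - t) xs ≡ zeros n) t≡0 y≡0))
    where
    components = interleave-injective (Vec.map (λ x → 2ℚ * x - t) xs) (zeros n) n≢0
      (trans (sym (combination-rows t xs a s)) (trans comb≡0 (sym (interleave-zeros n))))
    y≡0 = proj₁ components
    N = toℚ (+ n)

    sum≡ : ∀ {n} (xs : Vec ℚ n) → Vec.map (λ x → 2ℚ * x - t) xs ≡ zeros n →
      dotℚ xs (replicate n 6) ≡ toℚ (+ n) * (toℚ (+ 3) * t)
    sum≡ []       _  = sym (ℚₚ.*-zeroˡ (toℚ (+ 3) * t))
    sum≡ {suc n} (x ∷ xs) eq = begin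
      x * toℚ (+ 6) + dotℚ xs (replicate n 6)                          ≡⟨ cong₂ _+_ head (sum≡ xs (Vecₚ.∷-injectiveʳ eq)) ⟩
      (toℚ (+ 3) * t) + toℚ (+ n) * (toℚ (+ 3) * t)                    ≡⟨ solve 2 (λ u n → u :+ n :* u := (con 1ℚ :+ n) :* u) refl (toℚ (+ 3) * t) (toℚ (+ n)) ⟩
      (1ℚ + toℚ (+ n)) * (toℚ (+ 3) * t)                               ≡⟨ cong (_* (toℚ (+ 3) * t)) (toℚ-homo-+ (+ 1) (+ n)) ⟨
      toℚ (+ suc n) * (toℚ (+ 3) * t)                                  ∎
      where
      open ≡-Reasoning
      open +-*-Solver
      head : x * toℚ (+ 6) ≡ toℚ (+ 3) * t
      head = begin
        x * toℚ (+ 6)                          ≡⟨ solve 2 (λ x t → x :* con (toℚ (+ 6)) := con (toℚ (+ 3)) :* (con 2ℚ :* x :- t) :+ con (toℚ (+ 3)) :* t) refl x t ⟩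
        toℚ (+ 3) * (2ℚ * x - t) + toℚ (+ 3) * t ≡⟨ cong (λ z → toℚ (+ 3) * z + toℚ (+ 3) * t) (Vecₚ.∷-injectiveˡ eq) ⟩
        toℚ (+ 3) * 0ℚ + toℚ (+ 3) * t         ≡⟨ ℚₚ.+-identityˡ (toℚ (+ 3) * t) ⟩
        toℚ (+ 3) * t                          ∎

    0<2N : 0ℚ < 2ℚ * N
    0<2N = *-pos (ℚₚ.<-≤-trans 0<1 1≤2) (toℚ-mono-< (+ 0) (+ n) (ℤ.+<+ (ℕₚ.n≢0⇒n>0 n≢0)))

    t≡0 : t ≡ 0ℚ
    t≡0 = cancel-positive 0<2N (begin
      2ℚ * N * t
        ≡⟨ solve 2 (λ N t → con 2ℚ :* N :* t := :- (N :* (con (toℚ (+ 3)) :* t) :- t :* (con (toℚ (+ 5)) :* N))) refl N t ⟩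
      - (N * (toℚ (+ 3) * t) - t * (toℚ (+ 5) * N))
        ≡⟨ cong₂ (λ u v → - (u - t * v)) (sum≡ xs y≡0) (trans (cong toℚ (ℤₚ.pos-* 5 n)) (toℚ-homo-* (+ 5) (+ n))) ⟨
      - (dotℚ xs (replicate n 6) - t * toℚ (+ (5 ℕ.* n)))
        ≡⟨ cong -_ (proj₂ (proj₂ components)) ⟩
      0ℚ
        ≡⟨ ℚₚ.*-zeroʳ (2ℚ * N) ⟨
      2ℚ * N * 0ℚ ∎)
      where
      open ≡-Reasoning
      open +-*-Solver

    xs≡0 : ∀ {n} (xs : Vec ℚ n) → Vec.map (λ x → 2ℚ * x - 0ℚ) xs ≡ zeros n → xs ≡ zeros n
    xs≡0 []       _  = refl
    xs≡0 (x ∷ xs) eq = cong₂ _∷_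
      (cancel-positive {2ℚ} (ℚₚ.<-≤-trans 0<1 1≤2)
        (trans (sym (ℚₚ.+-identityʳ (2ℚ * x))) (trans (Vecₚ.∷-injectiveˡ eq) (sym (ℚₚ.*-zeroʳ 2ℚ)))))
      (xs≡0 xs (Vecₚ.∷-injectiveʳ eq))

  dotℚ-toℚ : ∀ {n} (x : Vec ℤ n) (a : Vec ℕ n) → dotℚ (Vec.map toℚ x) a ≡ toℚ (dot a x)
  dotℚ-toℚ []       []       = refl
  dotℚ-toℚ (x ∷ xs) (a ∷ as) = sym (trans (toℚ-homo-+ (+ a ℤ.* x) (dot as xs))
    (cong₂ _+_ (trans (toℚ-homo-* (+ a) x) (ℚₚ.*-comm (toℚ (+ a)) (toℚ x))) (sym (dotℚ-toℚ xs as))))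

  dot-replicate : ∀ {n} k (x : Vec ℤ n) → dot (replicate n k) x ≡ + k ℤ.* sumℤ x
  dot-replicate k []       = sym (ℤₚ.*-zeroʳ (+ k))
  dot-replicate k (x ∷ xs) = trans (cong (λ s → + k ℤ.* x ℤ.+ s) (dot-replicate k xs)) (sym (ℤₚ.*-distribˡ-+ (+ k) x (sumℤ xs)))

  map-toℚ-centred : ∀ {n} t (x : Vec ℤ n) → Vec.map (λ y → 2ℚ * y - toℚ t) (Vec.map toℚ x) ≡ Vec.map toℚ (centred t x)
  map-toℚ-centred t []       = refl
  map-toℚ-centred t (x ∷ xs) = cong₂ _∷_
    (sym (trans (toℚ-minus (+ 2 ℤ.* x) t) (cong (_- toℚ t) (toℚ-homo-* (+ 2) x)))) (map-toℚ-centred t xs)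

  module _ {n} (a : Vec ℕ n) (s : ℕ) {{_ : ℕ.NonZero n}} where
    open Combinatorics a s

    latticeVector : ℤ → Vec ℤ n → Vec ℤ (n ℕ.* 3)
    latticeVector t x = interleave (centred t x) (weightDefect t x) (sizeDefect t x)

    combination-integral : ∀ t x →
      combination (Vec.map toℚ (t ∷ x)) (Vec.map (Vec.map toℚ) (rows a s)) ≡ Vec.map toℚ (latticeVector t x)
    combination-integral t x = begin
      combination (toℚ t ∷ Vec.map toℚ x) (Vec.map (Vec.map toℚ) (rows a s))
        ≡⟨ combination-rows (toℚ t) (Vec.map toℚ x) a s ⟩
      interleave (Vec.map (λ y → 2ℚ * y - toℚ t) (Vec.map toℚ x)) (dotℚ (Vec.map toℚ x) a - toℚ t * toℚ (+ s))
        (dotℚ (Vec.map toℚ x) (replicate n 6) - toℚ t * toℚ (+ (5 ℕ.* n)))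
        ≡⟨ cong (λ y → interleave y (dotℚ (Vec.map toℚ x) a - toℚ t * toℚ (+ s))
             (dotℚ (Vec.map toℚ x) (replicate n 6) - toℚ t * toℚ (+ (5 ℕ.* n)))) (map-toℚ-centred t x) ⟩
      interleave (Vec.map toℚ (centred t x)) (dotℚ (Vec.map toℚ x) a - toℚ t * toℚ (+ s))
        (dotℚ (Vec.map toℚ x) (replicate n 6) - toℚ t * toℚ (+ (5 ℕ.* n)))
        ≡⟨ cong₂ (interleave (Vec.map toℚ (centred t x))) (defect a (dot a x) s refl) (defect (replicate n 6) (+ 6 ℤ.* sumℤ x) (5 ℕ.* n) (dot-replicate 6 x)) ⟩
      interleave (Vec.map toℚ (centred t x)) (toℚ (weightDefect t x)) (toℚ (sizeDefect t x))
        ≡⟨ map-interleave toℚ (centred t x) (weightDefect t x) (sizeDefect t x) ⟨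
      Vec.map toℚ (latticeVector t x) ∎
      where
      open ≡-Reasoning
      defect : ∀ c d s → dot c x ≡ d → dotℚ (Vec.map toℚ x) c - toℚ t * toℚ (+ s) ≡ toℚ (d ℤ.- t ℤ.* + s)
      defect c d s eq = sym (trans (toℚ-minus d (t ℤ.* + s))
        (cong₂ _-_ (trans (cong toℚ (sym eq)) (sym (dotℚ-toℚ x c))) (toℚ-homo-* t (+ s))))

  -- Short lattice vectors and solutions.

  module Reduction (p : ℝ) (1≤p : fromℚ 1ℚ ≤ℝ p) where
    open PowerSums p 1≤p

    integer-pow-≥ : ∀ z → fromℚ (toℚ (+ ℤ.∣ z ∣)) ≤ℝ ∣ toℚ z ∣^ p
    integer-pow-≥ z with ℤ.∣ z ∣ in eq
    ... | zero  = pow-≥0 (toℚ z)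
    ... | suc m = subst (λ x → fromℚ x ≤ℝ ∣ toℚ z ∣^ p) ∣z∣≡ (pow-≥ (toℚ z) (subst (1ℚ ≤_) (sym ∣z∣≡)
          (toℚ-mono-≤ (+ 1) (+ suc m) (ℤ.+≤+ (ℕ.s≤s ℕ.z≤n)))))
      where
      ∣z∣≡ : ∣ toℚ z ∣ ≡ toℚ (+ suc m)
      ∣z∣≡ = trans (∣toℚ∣ z) (cong (λ k → toℚ (+ k)) eq)

    powerSum-≥ℓ₁ : ∀ {m} (z : Vec ℤ m) → fromℚ (toℚ (+ ℓ₁ z)) ≤ℝ powerSum (Vec.map toℚ z)
    powerSum-≥ℓ₁ []      = ≤ℝ-refl (fromℚ 0ℚ)
    powerSum-≥ℓ₁ (x ∷ z) = ≤ℝ-trans (fromℚ (toℚ (+ ℓ₁ (x ∷ z)))) (fromℚ (toℚ (+ ℤ.∣ x ∣)) +ℝ fromℚ (toℚ (+ ℓ₁ z)))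
      (powerSum (Vec.map toℚ (x ∷ z)))
      (subst (λ q → fromℚ q ≤ℝ fromℚ (toℚ (+ ℤ.∣ x ∣)) +ℝ fromℚ (toℚ (+ ℓ₁ z)))
        (sym (toℚ-homo-+ (+ ℤ.∣ x ∣) (+ ℓ₁ z))) (fromℚ-+-≥ (toℚ (+ ℤ.∣ x ∣)) (toℚ (+ ℓ₁ z))))
      (+ℝ-mono (fromℚ (toℚ (+ ℤ.∣ x ∣))) (∣ toℚ x ∣^ p) (fromℚ (toℚ (+ ℓ₁ z))) (powerSum (Vec.map toℚ z))
        (integer-pow-≥ x) (powerSum-≥ℓ₁ z))

    integer-pow-≤ : ∀ z → ℤ.∣ z ∣ ≡ 0 ⊎ ℤ.∣ z ∣ ≡ 1 → ∣ toℚ z ∣^ p ≤ℝ fromℚ (toℚ (+ ℤ.∣ z ∣))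
    integer-pow-≤ z (inj₁ eq) = subst (λ k → ∣ toℚ z ∣^ p ≤ℝ fromℚ (toℚ (+ k))) (sym eq)
      (pow-zero (toℚ z) (trans (∣toℚ∣ z) (cong (λ k → toℚ (+ k)) eq)))
    integer-pow-≤ z (inj₂ eq) = subst (λ k → ∣ toℚ z ∣^ p ≤ℝ fromℚ (toℚ (+ k))) (sym eq)
      (pow-one (toℚ z) (trans (∣toℚ∣ z) (cong (λ k → toℚ (+ k)) eq)))

    powerSum-≤ℓ₁ : ∀ {m} {z : Vec ℤ m} → All (λ y → ℤ.∣ y ∣ ≡ 0 ⊎ ℤ.∣ y ∣ ≡ 1) z →
      powerSum (Vec.map toℚ z) ≤ℝ fromℚ (toℚ (+ ℓ₁ z))
    powerSum-≤ℓ₁ []      = ≤ℝ-refl (fromℚ 0ℚ)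
    powerSum-≤ℓ₁ {z = x ∷ z} (hx ∷ hz) = ≤ℝ-trans (powerSum (Vec.map toℚ (x ∷ z)))
      (fromℚ (toℚ (+ ℤ.∣ x ∣)) +ℝ fromℚ (toℚ (+ ℓ₁ z))) (fromℚ (toℚ (+ ℓ₁ (x ∷ z))))
      (+ℝ-mono (∣ toℚ x ∣^ p) (fromℚ (toℚ (+ ℤ.∣ x ∣))) (powerSum (Vec.map toℚ z)) (fromℚ (toℚ (+ ℓ₁ z)))
        (integer-pow-≤ x hx) (powerSum-≤ℓ₁ hz))
      (subst (λ q → fromℚ (toℚ (+ ℤ.∣ x ∣)) +ℝ fromℚ (toℚ (+ ℓ₁ z)) ≤ℝ fromℚ q)
        (sym (toℚ-homo-+ (+ ℤ.∣ x ∣) (+ ℓ₁ z))) (fromℚ-+-≤ (toℚ (+ ℤ.∣ x ∣)) (toℚ (+ ℓ₁ z))))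

    powerSum-interleave : ∀ {m} (y : Vec ℚ m) a b → powerSum y ≤ℝ powerSum (interleave y a b)
    powerSum-interleave []      a b = ≤ℝ-refl (fromℚ 0ℚ)
    powerSum-interleave (x ∷ y) a b =
      +ℝ-mono (∣ x ∣^ p) (∣ x ∣^ p) (powerSum y) (∣ a ∣^ p +ℝ (∣ b ∣^ p +ℝ R)) (≤ℝ-refl (∣ x ∣^ p))
        (≤ℝ-trans (powerSum y) R (∣ a ∣^ p +ℝ (∣ b ∣^ p +ℝ R)) (powerSum-interleave y a b)
          (≤ℝ-trans R (∣ b ∣^ p +ℝ R) (∣ a ∣^ p +ℝ (∣ b ∣^ p +ℝ R)) (≤ℝ-+ℝ (∣ b ∣^ p) R (pow-≥0 b))
            (≤ℝ-+ℝ (∣ a ∣^ p) (∣ b ∣^ p +ℝ R) (pow-≥0 a))))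
      where R = powerSum (interleave y a b)

    integer-zero-or-≥1 : ∀ {m} (z : Vec ℤ m) → All (λ x → ∣ x ∣ ≡ 0ℚ ⊎ 1ℚ ≤ ∣ x ∣) (Vec.map toℚ z)
    integer-zero-or-≥1 []      = []
    integer-zero-or-≥1 (x ∷ z) = coordinate x ∷ integer-zero-or-≥1 z
      where
      coordinate : ∀ x → ∣ toℚ x ∣ ≡ 0ℚ ⊎ 1ℚ ≤ ∣ toℚ x ∣
      coordinate x with ℤ.∣ x ∣ in eq
      ... | zero  = inj₁ (trans (∣toℚ∣ x) (cong (λ k → toℚ (+ k)) eq))
      ... | suc m = inj₂ (subst (1ℚ ≤_) (sym (trans (∣toℚ∣ x) (cong (λ k → toℚ (+ k)) eq)))
                      (toℚ-mono-≤ (+ 1) (+ suc m) (ℤ.+≤+ (ℕ.s≤s ℕ.z≤n))))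

    module _ {n} (a : Vec ℕ n) (s : ℕ) {{_ : ℕ.NonZero n}} (independent : ¬ Dependent p 1≤p ½ a) where
      open Combinatorics a s

      private
        B = Vec.map (Vec.map toℚ) (rows a s)
        radius = root p 1≤p (fromℚ (toℚ (+ n)))

      Solution : Subset n → Set
      Solution b = subsetSum a b ≡ s × 6 ℕ.* card b ≡ 5 ℕ.* n

      1≤n : 1 ℕ.≤ n
      1≤n = ℕ.>-nonZero⁻¹ n

      -- Were ℓ₁ larger than n, the power sum would exceed n by a definite rational amount, and
      -- `root-strict` would separate the roots.
      short⇒ℓ₁≤n : ∀ {m} (z : Vec ℤ m) → norm p 1≤p (Vec.map toℚ z) ≤ℝ radius → ℓ₁ z ℕ.≤ n
      short⇒ℓ₁≤n z short = ℕₚ.≮⇒≥ λ n<ℓ₁ → root-strict (powerSum (Vec.map toℚ z))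
        (toℚ-mono-≤ (+ 1) (+ n) (ℤ.+≤+ 1≤n)) (toℚ-mono-< (+ n) (+ ℓ₁ z) (ℤ.+<+ n<ℓ₁)) (powerSum-≥ℓ₁ z) short

      dependency : ∀ x → x ≢ replicate n 0ℤ → weightDefect 0ℤ x ≡ 0ℤ → sizeDefect 0ℤ x ≡ 0ℤ →
        norm p 1≤p (Vec.map toℚ (centred 0ℤ x)) ≤ℝ radius → ⊥
      dependency x x≢0 w≡0 z≡0 short = independent (x , x≢0 , trans (sym (ℤₚ.+-identityʳ (dot a x))) w≡0 ,
        ℤₚ.*-cancelˡ-≡ (+ 6) (sumℤ x) 0ℤ (trans (sym (ℤₚ.+-identityʳ (+ 6 ℤ.* sumℤ x))) z≡0) ,
        λ {q} → norm-half (fromℚ (toℚ (+ n))) 1≤sum (integer-zero-or-≥1 x)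
          (subst (λ v → norm p 1≤p v ≤ℝ radius) (doubled x) short) {q})
        where
        doubled : ∀ {n} (x : Vec ℤ n) → Vec.map toℚ (centred 0ℤ x) ≡ Vec.map (2ℚ *_) (Vec.map toℚ x)
        doubled []       = refl
        doubled (x ∷ xs) = cong₂ _∷_ (trans (cong toℚ (ℤₚ.+-identityʳ (+ 2 ℤ.* x))) (toℚ-homo-* (+ 2) x)) (doubled xs)
        1≤sum : fromℚ 1ℚ ≤ℝ powerSum (Vec.map toℚ x)
        1≤sum = ≤ℝ-trans (fromℚ 1ℚ) (fromℚ (toℚ (+ ℓ₁ x))) (powerSum (Vec.map toℚ x))
          (fromℚ-mono (toℚ-mono-≤ (+ 1) (+ ℓ₁ x) (ℤ.+≤+ (ℕₚ.n≢0⇒n>0 λ ℓ₁≡0′ → x≢0 (ℓ₁≡0 x ℓ₁≡0′))))) (powerSum-≥ℓ₁ x)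

      cancel-sign : ∀ t → ℤ.∣ t ∣ ≡ 1 → ∀ i j → t ℤ.* i ≡ t ℤ.* j → i ≡ j
      cancel-sign t ∣t∣≡1 i j = ℤₚ.*-cancelˡ-≡ t i j {{ℕ.≢-nonZero λ ∣t∣≡0 → ℕₚ.1+n≢0 (trans (sym ∣t∣≡1) ∣t∣≡0)}}

      bits⇒solution : ∀ {t} (∣t∣≡1 : ℤ.∣ t ∣ ≡ 1) b → let x = Vec.map (bit t) b in
        weightDefect t x ≡ 0ℤ → sizeDefect t x ≡ 0ℤ → Solution b
      bits⇒solution {t} ∣t∣≡1 b w≡0 z≡0 =
        ℤₚ.+-injective (cancel-sign t ∣t∣≡1 (+ subsetSum a b) (+ s)
          (trans (sym (dot-bits t a b)) (ℤₚ.i-j≡0⇒i≡j (dot a x) (t ℤ.* + s) w≡0))) ,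
        ℤₚ.+-injective (cancel-sign t ∣t∣≡1 (+ (6 ℕ.* card b)) (+ (5 ℕ.* n)) (trans six
          (trans (cong (+ 6 ℤ.*_) (sym (sum-bits t b))) (ℤₚ.i-j≡0⇒i≡j (+ 6 ℤ.* sumℤ x) (t ℤ.* + (5 ℕ.* n)) z≡0))))
        where
        x = Vec.map (bit t) b
        identity : ∀ t c → t ℤ.* (+ 6 ℤ.* c) ≡ + 6 ℤ.* (t ℤ.* c)
        identity = solve-∀
        six : t ℤ.* + (6 ℕ.* card b) ≡ + 6 ℤ.* (t ℤ.* + card b)
        six = trans (cong (t ℤ.*_) (ℤₚ.pos-* 6 (card b))) (identity t (+ card b))

      -- The solution serves NO instances, the lower bound on ℓ₁ serves minimality in YES instances.
      -- For t = 0 both follow from the contradiction with independence.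
      short⇒solution : ∀ t x → ¬ (t ≡ 0ℤ × x ≡ replicate n 0ℤ) →
        norm p 1≤p (Vec.map toℚ (latticeVector a s t x)) ≤ℝ radius →
        n ℕ.≤ ℓ₁ (latticeVector a s t x) × ∃[ b ] Solution b
      short⇒solution t x t,x≢0 short =
        let t-cases , ℓ₁≤n , w≡0 , z≡0 = short-cases t x t,x≢0 (short⇒ℓ₁≤n (latticeVector a s t x) short)
        in cases t-cases ℓ₁≤n w≡0 z≡0
        where
        cases : t ≡ 0ℤ ⊎ ℤ.∣ t ∣ ≡ 1 → ℓ₁ (centred t x) ℕ.≤ n → weightDefect t x ≡ 0ℤ → sizeDefect t x ≡ 0ℤ →
          n ℕ.≤ ℓ₁ (latticeVector a s t x) × ∃[ b ] Solution b
        cases (inj₁ t≡0) _ w≡0 z≡0 = ⊥-elim (dependency x (λ x≡0 → t,x≢0 (t≡0 , x≡0))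
          (subst (λ t → weightDefect t x ≡ 0ℤ) t≡0 w≡0) (subst (λ t → sizeDefect t x ≡ 0ℤ) t≡0 z≡0)
          (subst (λ t → norm p 1≤p (Vec.map toℚ (centred t x)) ≤ℝ radius) t≡0
            (≤ℝ-trans (norm p 1≤p y) (norm p 1≤p v) radius
              (root-mono (powerSum y) (powerSum v)
                (subst (λ v → powerSum y ≤ℝ powerSum v)
                  (sym (map-interleave toℚ (centred t x) (weightDefect t x) (sizeDefect t x)))
                  (powerSum-interleave y (toℚ (weightDefect t x)) (toℚ (sizeDefect t x)))))
              short)))
          where
          y = Vec.map toℚ (centred t x)
          v = Vec.map toℚ (latticeVector a s t x)
        cases (inj₂ ∣t∣≡1) ℓ₁≤n w≡0 z≡0 =
          subst (n ℕ.≤_) (sym (ℓ₁-interleave (centred t x) (weightDefect t x) (sizeDefect t x)))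
            (ℕₚ.≤-trans (ℓ₁-centred≥n t ∣t∣≡1 x) (ℕₚ.m≤m+n (ℓ₁ (centred t x)) (n ℕ.* (ℤ.∣ weightDefect t x ∣ ℕ.+ ℤ.∣ sizeDefect t x ∣)))) ,

          (let b , x≡ = bits t ∣t∣≡1 x ℓ₁≤n in b , bits⇒solution ∣t∣≡1 b
            (subst (λ x → weightDefect t x ≡ 0ℤ) x≡ w≡0) (subst (λ x → sizeDefect t x ≡ 0ℤ) x≡ z≡0))

      -- By stability the inequality may be assumed to fail. The vector is then short, hence of
      -- ℓ₁-norm at least n, which gives the inequality after all.
      radius≤norm : ∀ t x → ¬ (t ≡ 0ℤ × x ≡ replicate n 0ℤ) →
        radius ≤ℝ norm p 1≤p (Vec.map toℚ (latticeVector a s t x))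
      radius≤norm t x t,x≢0 = ≤ℝ-stable radius N λ ¬radius≤N →
        let n≤ℓ₁ , _ = short⇒solution t x t,x≢0 (≰ℝ⇒≥ℝ radius N ¬radius≤N)
        in ¬radius≤N (λ {q} → root-mono (fromℚ (toℚ (+ n))) (powerSum v)
             (≤ℝ-trans (fromℚ (toℚ (+ n))) (fromℚ (toℚ (+ ℓ₁ z))) (powerSum v)
               (fromℚ-mono (toℚ-mono-≤ (+ n) (+ ℓ₁ z) (ℤ.+≤+ n≤ℓ₁))) (powerSum-≥ℓ₁ z)) {q})
        where
        z = latticeVector a s t x
        v = Vec.map toℚ z
        N = norm p 1≤p v

      lattice-coefficients : ∀ v → v ∈Lattice B → v ≢ zeros (n ℕ.* 3) →
        ∃[ t ] ∃[ x ] ¬ (t ≡ 0ℤ × x ≡ replicate n 0ℤ) × Vec.map toℚ (latticeVector a s t x) ≡ v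
      lattice-coefficients v ((t ∷ x) , comb≡v) v≢0 = t , x , nonzero , trans (sym (combination-integral a s t x)) comb≡v
        where
        nonzero : ¬ (t ≡ 0ℤ × x ≡ replicate n 0ℤ)
        nonzero (refl , refl) = v≢0 (trans (sym comb≡v) (trans
          (cong (λ w → combination w B) (Vecₚ.map-replicate toℚ 0ℤ (suc n))) (combination-zeros B)))

      -- The vector of the solution is itself a shortest one: its norm is at most the radius, which
      -- by `radius≤norm` no nonzero lattice vector undercuts. Independence of the weights thus
      -- enters the YES case too.
      yes-instance : ∀ b → Solution b → ∃[ λ₁ ] IsFirstMinimum p 1≤p B λ₁ × λ₁ ≤ℝ 1ℚ · radius
      yes-instance b (sum≡s , size) = norm p 1≤p v ,
        ((v , (+ 1 ∷ x , combination-integral a s (+ 1) x) , v≢0 , (≤ℝ-refl (norm p 1≤p v) , ≤ℝ-refl (norm p 1≤p v))) , minimal) ,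
        ≤ℝ-trans (norm p 1≤p v) radius (1ℚ · radius) v≤radius (≤ℝ-1· {radius})
        where
        x = Vec.map (bit (+ 1)) b
        z = latticeVector a s (+ 1) x
        v = Vec.map toℚ z

        w≡0 : weightDefect (+ 1) x ≡ 0ℤ
        w≡0 = trans (cong (ℤ._- + 1 ℤ.* + s) (trans (dot-bits (+ 1) a b) (cong (λ k → + 1 ℤ.* + k) sum≡s)))
          (ℤₚ.+-inverseʳ (+ 1 ℤ.* + s))

        z≡0 : sizeDefect (+ 1) x ≡ 0ℤ
        z≡0 = trans (cong (λ k → + 6 ℤ.* k ℤ.- + 1 ℤ.* + (5 ℕ.* n)) (trans (sum-bits (+ 1) b) (ℤₚ.*-identityˡ (+ card b))))
          (trans (cong₂ ℤ._-_ (trans (sym (ℤₚ.pos-* 6 (card b))) (cong +_ size)) (ℤₚ.*-identityˡ (+ (5 ℕ.* n))))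
            (ℤₚ.+-inverseʳ (+ (5 ℕ.* n))))

        ℓ₁-centred-bits : ∀ {n} (b : Subset n) → ℓ₁ (centred (+ 1) (Vec.map (bit (+ 1)) b)) ≡ n
        ℓ₁-centred-bits []      = refl
        ℓ₁-centred-bits (c ∷ b) = cong₂ ℕ._+_ (∣centred-bit∣≡1 (+ 1) refl c) (ℓ₁-centred-bits b)

        ℓ₁≡n : ℓ₁ z ≡ n
        ℓ₁≡n = begin
          ℓ₁ z                                                  ≡⟨ ℓ₁-interleave (centred (+ 1) x) (weightDefect (+ 1) x) (sizeDefect (+ 1) x) ⟩
          ℓ₁ (centred (+ 1) x) ℕ.+ n ℕ.* (ℤ.∣ weightDefect (+ 1) x ∣ ℕ.+ ℤ.∣ sizeDefect (+ 1) x ∣)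
            ≡⟨ cong₂ (λ i j → ℓ₁ (centred (+ 1) x) ℕ.+ n ℕ.* (ℤ.∣ i ∣ ℕ.+ ℤ.∣ j ∣)) w≡0 z≡0 ⟩
          ℓ₁ (centred (+ 1) x) ℕ.+ n ℕ.* 0                      ≡⟨ cong₂ ℕ._+_ (ℓ₁-centred-bits b) (ℕₚ.*-zeroʳ n) ⟩
          n ℕ.+ 0                                               ≡⟨ ℕₚ.+-identityʳ n ⟩
          n                                                     ∎
          where open ≡-Reasoning

        unit-entries : ∀ {n} (b : Subset n) {i j} → i ≡ 0ℤ → j ≡ 0ℤ →
          All (λ y → ℤ.∣ y ∣ ≡ 0 ⊎ ℤ.∣ y ∣ ≡ 1) (interleave (centred (+ 1) (Vec.map (bit (+ 1)) b)) i j)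
        unit-entries []      _    _    = []
        unit-entries (c ∷ b) refl refl = inj₂ (∣centred-bit∣≡1 (+ 1) refl c) ∷ inj₁ refl ∷ inj₁ refl ∷ unit-entries b refl refl

        v≤radius : norm p 1≤p v ≤ℝ radius
        v≤radius = root-mono (powerSum v) (fromℚ (toℚ (+ n)))
          (subst (λ k → powerSum v ≤ℝ fromℚ (toℚ (+ k))) ℓ₁≡n (powerSum-≤ℓ₁ (unit-entries b w≡0 z≡0)))

        ℓ₁-zeros : ∀ {m} (z : Vec ℤ m) → Vec.map toℚ z ≡ zeros m → ℓ₁ z ≡ 0
        ℓ₁-zeros []      _  = refl
        ℓ₁-zeros (y ∷ z) eq = cong₂ ℕ._+_ (cong ℤ.∣_∣ (toℚ-injective y 0ℤ (Vecₚ.∷-injectiveˡ eq))) (ℓ₁-zeros z (Vecₚ.∷-injectiveʳ eq))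

        v≢0 : v ≢ zeros (n ℕ.* 3)
        v≢0 v≡0 = ℕₚ.<⇒≢ 1≤n (sym (trans (sym ℓ₁≡n) (ℓ₁-zeros z v≡0)))

        minimal : ∀ w → w ∈Lattice B → w ≢ zeros (n ℕ.* 3) → norm p 1≤p v ≤ℝ norm p 1≤p w
        minimal w w∈ w≢0 =
          let t , x , t,x≢0 , z≡w = lattice-coefficients w w∈ w≢0
          in ≤ℝ-trans (norm p 1≤p v) radius (norm p 1≤p w) v≤radius
               (subst (λ w → radius ≤ℝ norm p 1≤p w) z≡w (radius≤norm t x t,x≢0))

      no-instance : ¬ (∃[ b ] Solution b) → ∀ λ₁ → IsFirstMinimum p 1≤p B λ₁ → 1ℚ · radius <ℝ λ₁
      no-instance ¬solution λ₁ ((v , v∈ , v≢0 , (v≤λ₁ , _)) , _) λ₁≤radius =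
        let t , x , t,x≢0 , z≡v = lattice-coefficients v v∈ v≢0
        in ¬solution (proj₂ (short⇒solution t x t,x≢0 (subst (λ w → norm p 1≤p w ≤ℝ radius) (sym z≡v) v≤radius)))
        where
        v≤radius : norm p 1≤p v ≤ℝ radius
        v≤radius = ≤ℝ-trans (norm p 1≤p v) λ₁ radius v≤λ₁ (≤ℝ-trans λ₁ (1ℚ · radius) radius λ₁≤radius (1·-≤ℝ {radius}))

module Machine where
  open import Data.Bool using (Bool; true; false)
  open import Data.Fin using (Fin; zero; suc; #_)
  open import Data.List using (List; []; _∷_; _++_; _ʳ++_; length; head; drop; reverse)
  import Data.List as List
  import Data.List.Properties as Listₚ
  open import Data.List.Relation.Unary.All as All using (All; []; _∷_)
  open import Data.Maybe using (Maybe; just; nothing)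
  open import Data.Nat
  open import Data.Nat.Binary using (ℕᵇ; zero; 2[1+_]; 1+[2_]; fromℕ)
  import Data.Nat.Binary as ℕᵇ
  import Data.Nat.Binary.Properties as ℕᵇₚ
  open import Data.Nat.Properties
  open import Data.Product using (∃-syntax; _×_; _,_)
  open import Data.Sum using (_⊎_; inj₁; inj₂)
  open import Data.Unit using (⊤; tt)
  open import Data.Vec as Vec using (Vec; []; _∷_; lookup; updateAt)
  open import Function using (_∘_)
  open import Relation.Binary.PropositionalEquality

  -- Elementary stack programs.

  nonempty notComma isTwo : Maybe Symbol → Bool
  nonempty (just _) = true
  nonempty nothing  = false

  notComma (just comma) = false
  notComma (just _)     = true
  notComma nothing      = false

  isTwo (just two) = true
  isTwo _          = false

  module _ {k : ℕ} where

    popThen : Fin k → (Symbol → Program k) → Maybe Symbol → Program k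
    popThen i P nothing  = skip
    popThen i P (just x) = pop i ⨾ P x

    consume : Fin k → (Symbol → Program k) → Program k
    consume i P = branch i (popThen i P)

    transfer : (Maybe Symbol → Bool) → Fin k → Fin k → Program k
    transfer c i j = while i c (consume i (push j))

    clear : Fin k → Program k
    clear i = while i nonempty (pop i)

    pushWord : Fin k → Word → Program k
    pushWord i []      = skip
    pushWord i (x ∷ w) = pushWord i w ⨾ push i x

    -- Moving to `scratch` reverses the word and moving back reverses it again, so `from` is
    -- restored and `to` receives the word in its order.
    copy : (scratch from to : Fin k) → Program k
    copy scratch from to =
      transfer nonempty from scratch ⨾ while scratch nonempty (consume scratch λ x → push from x ⨾ push to x)

    -- The counter is unary, one symbol per round; spent symbols gather on `scratch` and are
    -- returned at the end.
    forEach : (scratch counter : Fin k) → Program k → Program k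
    forEach scratch counter P =
      while counter nonempty (consume counter (push scratch) ⨾ P) ⨾ transfer nonempty scratch counter

    incrementDigit : Fin k → Maybe Symbol → Program k
    incrementDigit i (just one) = pop i ⨾ push i two
    incrementDigit i _          = push i one

    -- With digits 1 and 2, every leading 2 turns into a 1 and carries.
    increment : (scratch counter : Fin k) → Program k
    increment scratch i =
      while i isTwo (pop i ⨾ push scratch one) ⨾ branch i (incrementDigit i) ⨾ transfer nonempty scratch i

  iter : {A : Set} → ℕ → (A → A) → A → A
  iter zero    f x = x
  iter (suc n) f x = f (iter n f x)

  wordCost : Word → ℕ
  wordCost []      = 1
  wordCost (_ ∷ w) = wordCost w + 1

  -- S u v are the stacks with u on stack i, v on stack j and fixed other contents.
  record TwoStacks {k} (i j : Fin k) (S : Word → Word → Stacks k) : Set where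
    constructor twoStacks
    field
      get₁ : ∀ u v → lookup (S u v) i ≡ u
      get₂ : ∀ u v → lookup (S u v) j ≡ v
      set₁ : ∀ f u v → updateAt (S u v) i f ≡ S (f u) v
      set₂ : ∀ f u v → updateAt (S u v) j f ≡ S u (f v)

  TwoStacks-swap : ∀ {k} {i j : Fin k} {S} → TwoStacks i j S → TwoStacks j i (λ v u → S u v)
  TwoStacks-swap (twoStacks g₁ g₂ s₁ s₂) = twoStacks (λ u v → g₂ v u) (λ u v → g₁ v u) (λ f u v → s₂ f v u) (λ f u v → s₁ f v u)

  replicate-ʳ++ : ∀ {A : Set} n (x : A) w → List.replicate n x ʳ++ w ≡ List.replicate n x ++ w
  replicate-ʳ++ zero    x w = refl
  replicate-ʳ++ (suc n) x w = trans (replicate-ʳ++ n x (x ∷ w)) (shift n)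
    where
    shift : ∀ n → List.replicate n x ++ x ∷ w ≡ x ∷ List.replicate n x ++ w
    shift zero    = refl
    shift (suc n) = cong (x ∷_) (shift n)

  ʳ++-involutive : ∀ {A : Set} (u : List A) → (u ʳ++ []) ʳ++ [] ≡ u
  ʳ++-involutive u = trans (Listₚ.ʳ++-ʳ++ u) (Listₚ.++-identityʳ u)

  length-ʳ++[] : ∀ {A : Set} (u : List A) → length (u ʳ++ []) ≡ length u
  length-ʳ++[] u = trans (Listₚ.length-ʳ++ u) (+-identityʳ (length u))

  carry : ∀ b → ∃[ m ] ∃[ r ]
    ((encodeℕᵇ b ≡ List.replicate m two ++ [] × encodeℕᵇ (ℕᵇ.suc b) ≡ List.replicate m one ++ one ∷ [])
    ⊎ (encodeℕᵇ b ≡ List.replicate m two ++ one ∷ r × encodeℕᵇ (ℕᵇ.suc b) ≡ List.replicate m one ++ two ∷ r))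
  carry zero     = 0 , [] , inj₁ (refl , refl)
  carry 1+[2 b ] = 0 , encodeℕᵇ b , inj₂ (refl , refl)
  carry 2[1+ b ] with carry b
  ... | m , r , inj₁ (e , e′) = suc m , r , inj₁ (cong (two ∷_) e , cong (one ∷_) e′)
  ... | m , r , inj₂ (e , e′) = suc m , r , inj₂ (cong (two ∷_) e , cong (one ∷_) e′)

  -- `fromℕ` does not unfold along successors, whereas `fromℕ'` does; hence the detour.
  encodeℕ-suc : ∀ n → encodeℕ (suc n) ≡ encodeℕᵇ (ℕᵇ.suc (fromℕ n))
  encodeℕ-suc n = cong encodeℕᵇ (trans (ℕᵇₚ.fromℕ≡fromℕ' (suc n)) (cong ℕᵇ.suc (sym (ℕᵇₚ.fromℕ≡fromℕ' n))))

  -- Running times up to powers of a size bound.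

  module Runs (X : ℕ) {{_ : NonZero X}} {K : ℕ} where

    -- X will bound the lengths of all words involved, so that each nesting of loops
    -- costs one more factor X.
    record Run (P : Program K) (σ τ : Stacks K) (k d : ℕ) : Set where
      constructor run
      field
        {time}     : ℕ
        derivation : ⟨ P , σ ⟩⇓[ time ] τ
        bound      : time ≤ k * X ^ d

    private
      variable
        P Q : Program K
        σ τ υ : Stacks K
        i j : Fin K
        k l d : ℕ

    1≤Xᵈ : ∀ d → 1 ≤ X ^ d
    1≤Xᵈ d = m^n>0 X d

    1≤1*Xᵈ : ∀ d → 1 ≤ 1 * X ^ d
    1≤1*Xᵈ d = subst (1 ≤_) (sym (*-identityˡ (X ^ d))) (1≤Xᵈ d)

    run-skip : Run skip σ σ 1 d
    run-skip {d = d} = run skip (1≤1*Xᵈ d)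

    run-push : ∀ {x} → Run (push i x) σ (updateAt σ i (x ∷_)) 1 d
    run-push {d = d} = run push (1≤1*Xᵈ d)

    run-pop : Run (pop i) σ (updateAt σ i (drop 1)) 1 d
    run-pop {d = d} = run pop (1≤1*Xᵈ d)

    infixr 5 _⨾ᵣ_
    _⨾ᵣ_ : Run P σ τ k d → Run Q τ υ l d → Run (P ⨾ Q) σ υ (k + l) d
    _⨾ᵣ_ {k = k} {d = d} {l = l} (run D s≤) (run E t≤) =
      run (seq D E) (≤-trans (+-mono-≤ s≤ t≤) (≤-reflexive (sym (*-distribʳ-+ (X ^ d) k l))))

    run-branch : ∀ {f} → Run (f (top σ i)) σ τ k d → Run (branch i f) σ τ (suc k) d
    run-branch {d = d} (run D t≤) = run (branch D) (+-mono-≤ (1≤Xᵈ d) t≤)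

    weaken : k ≤ l → Run P σ τ k d → Run P σ τ l d
    weaken {d = d} k≤l (run D t≤) = run D (≤-trans t≤ (*-monoˡ-≤ (X ^ d) k≤l))

    run-≡ : τ ≡ υ → Run P σ τ k d → Run P σ υ k d
    run-≡ refl r = r

    run-≡ˡ : σ ≡ τ → Run P σ υ k d → Run P τ υ k d
    run-≡ˡ refl r = r

    -- The list `u` schedules the rounds still to come and `acc` those done, in reverse. Its
    -- elements need not be symbols: units serve to count a carry, numbers to list the weights. At
    -- most X rounds of cost 1 + k X^d and a final test stay within (2 + k) X^(d+1).
    run-while : ∀ {A : Set} {c} (S : List A → List A → Stacks K) (Inv : List A → List A → Set) →
      (∀ acc x u → Inv acc (x ∷ u) →
         c (top (S acc (x ∷ u)) i) ≡ true × Run P (S acc (x ∷ u)) (S (x ∷ acc) u) k d × Inv (x ∷ acc) u) →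
      (∀ acc → c (top (S acc []) i) ≡ false) →
      ∀ {acc} u → Inv acc u → length u ≤ X →
      Run (while i c P) (S acc u) (S (u ʳ++ acc) []) (2 + k) (suc d)
    run-while {i = i} {P = P} {k = k} {d = d} {c = c} S Inv step halt u inv u≤X =
      let t , D , t≤ = loops u inv in run D (begin
        t                                        ≤⟨ t≤ ⟩
        1 + length u * (1 + k * X ^ d)           ≤⟨ +-monoʳ-≤ 1 (*-monoˡ-≤ (1 + k * X ^ d) u≤X) ⟩
        1 + X * (1 + k * X ^ d)                  ≡⟨ cong suc (trans (*-distribˡ-+ X 1 (k * X ^ d)) (cong₂ _+_ (*-identityʳ X) (swap X k (X ^ d)))) ⟩
        1 + (X + k * X ^ suc d)                  ≤⟨ +-mono-≤ (1≤Xᵈ (suc d)) (+-monoˡ-≤ (k * X ^ suc d) (m≤m*n X (X ^ d) {{>-nonZero (1≤Xᵈ d)}})) ⟩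
        (2 + k) * X ^ suc d                      ∎)
      where
      open ≤-Reasoning
      swap : ∀ x k y → x * (k * y) ≡ k * (x * y)
      swap x k y = trans (sym (*-assoc x k y)) (trans (cong (_* y) (*-comm x k)) (*-assoc k x y))

      loops : ∀ {acc} u → Inv acc u → ∃[ t ] ⟨ while i c P , S acc u ⟩⇓[ t ] S (u ʳ++ acc) [] × t ≤ 1 + length u * (1 + k * X ^ d)
      loops {acc} []      _   = 1 , done (halt acc) , ≤-refl
      loops {acc} (x ∷ u) inv with step acc x u inv
      ... | c≡true , run {s} D s≤ , inv′ with loops u inv′
      ...   | t , E , t≤ = _ , loop c≡true D E , s≤s (begin
        s + t                                                  ≤⟨ +-mono-≤ s≤ t≤ ⟩
        k * X ^ d + (1 + length u * (1 + k * X ^ d))           ≡⟨ +-suc (k * X ^ d) _ ⟩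
        1 + k * X ^ d + length u * (1 + k * X ^ d)             ∎)

    run-consume : ∀ {f x} → top σ i ≡ just x → Run (f x) (updateAt σ i (drop 1)) τ k d → Run (consume i f) σ τ (2 + k) d
    run-consume {σ = σ} {i} {τ} {k} {d} {f} {x} eq r =
      run-branch (subst (λ m → Run (popThen i f m) σ τ (1 + k) d) (sym eq) (run-pop ⨾ᵣ r))

    run-transfer : ∀ {c S} → TwoStacks i j S → ∀ u {r v} → All (λ x → c (just x) ≡ true) u → c (head r) ≡ false → length u ≤ X →
      Run (transfer c i j) (S (u ++ r) v) (S r (u ʳ++ v)) 5 (suc d)
    run-transfer {i = i} {j} {c = c} {S} (twoStacks g₁ g₂ s₁ s₂) u {r} {v} hu hr u≤X =
      run-while (λ acc w → S (w ++ r) acc) (λ _ w → All (λ x → c (just x) ≡ true) w) step stop u hu u≤X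
      where
      step : ∀ acc x w → All (λ x → c (just x) ≡ true) (x ∷ w) → _
      step acc x w (hx ∷ hw) =
        trans (cong (c ∘ head) (g₁ (x ∷ w ++ r) acc)) hx ,
        run-consume {i = i} (cong head (g₁ (x ∷ w ++ r) acc))
          (run-≡ˡ (sym (s₁ (drop 1) (x ∷ w ++ r) acc)) (run-≡ (s₂ (x ∷_) (w ++ r) acc) run-push)) ,
        hw
      stop : ∀ acc → c (top (S r acc) i) ≡ false
      stop acc = trans (cong (c ∘ head) (g₁ r acc)) hr

    run-transfer-all : ∀ {S} → TwoStacks i j S → ∀ u {v} → length u ≤ X →
      Run (transfer nonempty i j) (S u v) (S [] (u ʳ++ v)) 5 (suc d)
    run-transfer-all {S = S} pair u {v} u≤X =
      run-≡ˡ (cong (λ w → S w v) (Listₚ.++-identityʳ u)) (run-transfer pair u (All.universal (λ _ → refl) u) refl u≤X)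

    run-carry : ∀ {S} → TwoStacks i j S → ∀ m {r} → isTwo (head r) ≡ false → m ≤ X →
      Run (while i isTwo (pop i ⨾ push j one)) (S (List.replicate m two ++ r) []) (S r (List.replicate m one)) 4 (suc d)
    run-carry {i = i} {j} {S = S} (twoStacks g₁ g₂ s₁ s₂) m {r} halt m≤X =
      run-≡ˡ (cong (λ w → S (w ++ r) []) (Listₚ.map-replicate (λ _ → two) m tt))
        (run-≡ (cong (S r) ones)
          (run-while carried (λ _ _ → ⊤) step halts (List.replicate m tt) tt
            (subst (_≤ X) (sym (Listₚ.length-replicate m)) m≤X)))
      where
      carried : List ⊤ → List ⊤ → Stacks K
      carried acc w = S (List.map (λ _ → two) w ++ r) (List.map (λ _ → one) acc)
      ones : List.map (λ _ → one) (List.replicate m tt ʳ++ []) ≡ List.replicate m one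
      ones = trans (cong (List.map (λ _ → one)) (trans (replicate-ʳ++ m tt []) (Listₚ.++-identityʳ _)))
        (Listₚ.map-replicate (λ _ → one) m tt)
      halts : ∀ acc → isTwo (top (carried acc []) i) ≡ false
      halts acc = trans (cong (isTwo ∘ head) (g₁ r (List.map (λ _ → one) acc))) halt
      step : ∀ acc x w → ⊤ → isTwo (top (carried acc (x ∷ w)) i) ≡ true ×
        Run (pop i ⨾ push j one) (carried acc (x ∷ w)) (carried (x ∷ acc) w) 2 d × ⊤
      step acc x w _ = cong (isTwo ∘ head) (g₁ (two ∷ W) A) ,
        run-≡ (s₁ (drop 1) (two ∷ W) A) run-pop ⨾ᵣ run-≡ (s₂ (one ∷_) W A) run-push , tt
        where
        W = List.map (λ _ → two) w ++ r
        A = List.map (λ _ → one) acc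

    run-increment : ∀ {S} → TwoStacks i j S → ∀ n → length (encodeℕ n) ≤ X →
      Run (increment j i) (S (encodeℕ n) []) (S (encodeℕ (suc n)) []) 12 (suc d)
    run-increment {i = i} {j} {d} {S} pair@(twoStacks g₁ g₂ s₁ s₂) n n≤X = by-carry (carry (fromℕ n))
      where
      increment-after : ∀ m r r′ → encodeℕ n ≡ List.replicate m two ++ r →
        encodeℕᵇ (ℕᵇ.suc (fromℕ n)) ≡ List.replicate m one ++ r′ → isTwo (head r) ≡ false →
        (∀ v → Run (incrementDigit i (head r)) (S r v) (S r′ v) 2 (suc d)) →
        Run (increment j i) (S (encodeℕ n) []) (S (encodeℕ (suc n)) []) 12 (suc d)
      increment-after m r r′ e e′ halt digit =
        run-≡ˡ (cong (λ w → S w []) (sym e))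
          (run-≡ (cong (λ w → S w []) (trans (replicate-ʳ++ m one r′) (trans (sym e′) (sym (encodeℕ-suc n)))))
            (run-carry pair m halt m≤X
             ⨾ᵣ run-branch {i = i} (subst (λ w → Run (incrementDigit i (head w)) (S r ones) (S r′ ones) 2 (suc d)) (sym (g₁ r ones)) (digit ones))
             ⨾ᵣ run-transfer-all (TwoStacks-swap pair) ones (subst (_≤ X) (sym (Listₚ.length-replicate m)) m≤X)))
        where
        ones = List.replicate m one
        m≤X : m ≤ X
        m≤X = ≤-trans (subst (m ≤_) (trans (cong (_+ length r) (sym (Listₚ.length-replicate m)))
          (trans (sym (Listₚ.length-++ (List.replicate m two))) (cong length (sym e)))) (m≤m+n m (length r))) n≤X

      by-carry : (∃[ m ] ∃[ r ]
        ((encodeℕ n ≡ List.replicate m two ++ [] × encodeℕᵇ (ℕᵇ.suc (fromℕ n)) ≡ List.replicate m one ++ one ∷ [])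
        ⊎ (encodeℕ n ≡ List.replicate m two ++ one ∷ r × encodeℕᵇ (ℕᵇ.suc (fromℕ n)) ≡ List.replicate m one ++ two ∷ r))) →
        Run (increment j i) (S (encodeℕ n) []) (S (encodeℕ (suc n)) []) 12 (suc d)
      by-carry (m , r , inj₁ (e , e′)) = increment-after m [] (one ∷ []) e e′ refl λ v →
        weaken (s≤s z≤n) (run-≡ (s₁ (one ∷_) [] v) run-push)
      by-carry (m , r , inj₂ (e , e′)) = increment-after m (one ∷ r) (two ∷ r) e e′ refl λ v →
        run-≡ (s₁ (drop 1) (one ∷ r) v) run-pop ⨾ᵣ run-≡ (s₁ (two ∷_) r v) run-push

  denominator : Word
  denominator = slash ∷ one ∷ comma ∷ []

  -- What is pushed on the output stack is described by its effect on the output,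
  -- the integer with code w being written as the fraction w/1.
  entry : Word → Word → Word
  entry w out = w ++ denominator ++ out

  column : Word → Word → Word → Word → Word
  column w₁ w₂ w₃ out = entry w₁ (entry w₂ (entry w₃ out))

  module _ {k : ℕ} where

    pushEntry : Word → Program (suc k)
    pushEntry w = pushWord zero (w ++ denominator)

    copyEntry : (scratch from : Fin (suc k)) → Program (suc k)
    copyEntry scratch from = pushWord zero denominator ⨾ copy scratch from zero

  TwoStacks-∷ : ∀ {k} {i j : Fin k} {R} → TwoStacks i j R → ∀ out → TwoStacks (suc i) (suc j) (λ u v → out ∷ R u v)
  TwoStacks-∷ (twoStacks g₁ g₂ s₁ s₂) out = twoStacks g₁ g₂
    (λ f u v → cong (out ∷_) (s₁ f u v)) (λ f u v → cong (out ∷_) (s₂ f u v))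

  -- Programs that extend the output.

  module Emissions (X : ℕ) {{_ : NonZero X}} {K : ℕ} where
    open Runs X {suc K}

    -- All stacks but the output return to their contents `r`, so that emissions compose as
    -- functions of the output alone.
    Emits : Program (suc K) → Vec Word K → (Word → Word) → ℕ → ℕ → Set
    Emits P r f k d = ∀ out → Run P (out ∷ r) (f out ∷ r) k d

    private
      variable
        r : Vec Word K
        i j : Fin K
        d : ℕ

    emits-word : ∀ w → Emits (pushWord zero w) r (w ++_) (wordCost w) d
    emits-word []      out = run-skip
    emits-word (x ∷ w) out = emits-word w out ⨾ᵣ run-push

    emits-entry : ∀ w → Emits (pushEntry w) r (entry w) (wordCost (w ++ denominator)) d
    emits-entry w out = run-≡ (cong (_∷ _) (Listₚ.++-assoc w denominator out)) (emits-word (w ++ denominator) out)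

    emits-copy : ∀ {R} → TwoStacks i j R → ∀ u → length u ≤ X → Emits (copy (suc j) (suc i) zero) (R u []) (u ++_) 11 (suc d)
    emits-copy {i = i} {j} {d} {R} pair@(twoStacks g₁ g₂ s₁ s₂) u u≤X out =
      run-transfer-all (TwoStacks-∷ pair out) u u≤X
      ⨾ᵣ run-≡ (cong (λ w → (w ++ out) ∷ R w []) (ʳ++-involutive u))
           (run-while copied (λ _ _ → ⊤) step (λ acc → cong (nonempty ∘ head) (g₂ acc []))
             (u ʳ++ []) tt (subst (_≤ X) (sym (length-ʳ++[] u)) u≤X))
      where
      copied : Word → Word → Stacks (suc K)
      copied acc w = (acc ++ out) ∷ R acc w
      step : ∀ acc x w → ⊤ → nonempty (top (copied acc (x ∷ w)) (suc j)) ≡ true ×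
        Run (consume (suc j) (λ x → push (suc i) x ⨾ push zero x)) (copied acc (x ∷ w)) (copied (x ∷ acc) w) 4 d × ⊤
      step acc x w _ = cong (nonempty ∘ head) (g₂ acc (x ∷ w)) ,
        run-consume {i = suc j} (cong head (g₂ acc (x ∷ w)))
          (run-≡ˡ (cong ((acc ++ out) ∷_) (sym (s₂ (drop 1) acc (x ∷ w))))
            (run-≡ (cong ((acc ++ out) ∷_) (s₁ (x ∷_) acc w)) run-push ⨾ᵣ run-push)) , tt

    emits-copyEntry : ∀ {R} → TwoStacks i j R → ∀ u → length u ≤ X → Emits (copyEntry (suc j) (suc i)) (R u []) (entry u) 15 (suc d)
    emits-copyEntry pair u u≤X out = emits-word denominator out ⨾ᵣ emits-copy pair u u≤X (denominator ++ out)

    emits-forEach : ∀ {R P f k} → TwoStacks i j R → (∀ u v → Emits P (R u v) f k d) → ∀ n → n ≤ X →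
      Emits (forEach (suc j) (suc i) P) (R (List.replicate n one) []) (iter n f) (2 + (3 + k) + 5) (suc d)
    emits-forEach {i = i} {j} {d} {R} {P} {f} {k} pair@(twoStacks g₁ g₂ s₁ s₂) emits n n≤X out =
      run-≡ (cong₂ (λ m v → iter m f out ∷ R [] v) length-ones ones-reversed)
        (run-while emitted (λ _ _ → ⊤) step (λ acc → cong (nonempty ∘ head) (g₁ [] acc)) ones tt ones≤X)
      ⨾ᵣ run-≡ (cong (λ v → iter n f out ∷ R v []) ones-reversed)
           (run-transfer-all (TwoStacks-∷ (TwoStacks-swap pair) (iter n f out)) ones ones≤X)
      where
      ones = List.replicate n one
      ones≤X : length ones ≤ X
      ones≤X = subst (_≤ X) (sym (Listₚ.length-replicate n)) n≤X
      ones-reversed : ones ʳ++ [] ≡ ones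
      ones-reversed = trans (replicate-ʳ++ n one []) (Listₚ.++-identityʳ ones)
      length-ones : length (ones ʳ++ []) ≡ n
      length-ones = trans (length-ʳ++[] ones) (Listₚ.length-replicate n)
      emitted : Word → Word → Stacks (suc K)
      emitted acc w = iter (length acc) f out ∷ R w acc
      step : ∀ acc x w → ⊤ → nonempty (top (emitted acc (x ∷ w)) (suc i)) ≡ true ×
        Run (consume (suc i) (push (suc j)) ⨾ P) (emitted acc (x ∷ w)) (emitted (x ∷ acc) w) (3 + k) d × ⊤
      step acc x w _ = cong (nonempty ∘ head) (g₁ (x ∷ w) acc) ,
        run-consume {i = suc i} (cong head (g₁ (x ∷ w) acc))
          (run-≡ˡ (cong (iter (length acc) f out ∷_) (sym (s₁ (drop 1) (x ∷ w) acc)))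
            (run-≡ (cong (iter (length acc) f out ∷_) (s₂ (x ∷_) w acc)) run-push))
        ⨾ᵣ emits w (x ∷ acc) (iter (length acc) f out) , tt

    run-clear : ∀ {S : Word → Stacks (suc K)} {i} → (∀ u → lookup (S u) i ≡ u) → (∀ f u → updateAt (S u) i f ≡ S (f u)) →
      ∀ u → length u ≤ X → Run (clear i) (S u) (S []) 3 (suc d)
    run-clear {S = S} g s u u≤X = run-while (λ _ w → S w) (λ _ _ → ⊤)
      (λ _ x w _ → cong (nonempty ∘ head) (g (x ∷ w)) , run-≡ (s (drop 1) (x ∷ w)) run-pop , tt)
      (λ _ → cong (nonempty ∘ head) (g [])) {[]} u tt u≤X

  -- The program of the reduction.

  input output reversed item scratch goal finished left count count5 temp : Fin 10
  input    = # 0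
  -- Input and output share the first stack: the input is used up before anything is written.
  output   = # 0
  reversed = # 1
  item     = # 2
  scratch  = # 3
  goal   = # 4
  finished = # 5
  left     = # 6
  count    = # 7
  count5   = # 8
  temp     = # 9

  -- In digits 1 and 2 the number 6 is 2 + 2 · 2.
  six : Word
  six = two ∷ two ∷ []

  -- Each comma closes one weight. It adds 1 to n in unary and in binary, and five increments keep 5
  -- n without any multiplication.
  tally : Symbol → Program 10
  tally comma = push left one ⨾ increment scratch count ⨾
    increment scratch count5 ⨾ increment scratch count5 ⨾ increment scratch count5 ⨾
    increment scratch count5 ⨾ increment scratch count5
  tally _     = skip

  weightColumn : Word → Program 10
  weightColumn w = pushEntry six ⨾ copyEntry scratch item ⨾ pushEntry w

  -- Both copied stacks carry a leading minus sign by the time this runs, whence the entries -5 n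
  -- and -s.
  targetColumn : Program 10
  targetColumn = copyEntry scratch count5 ⨾ copyEntry scratch item ⨾ pushEntry (minus ∷ one ∷ [])

  -- Weights arrive last first and each row is written from its right end. The columns of the
  -- weights already `finished` therefore come first, then the diagonal entry 2, then the columns of
  -- those `left`. The first two pops remove the comma of the current weight and its mark on `left`.
  pushWeightRow : Program 10
  pushWeightRow =
    pop reversed ⨾ pop left ⨾ transfer notComma reversed item ⨾ push output semicolon ⨾
    forEach temp finished (weightColumn []) ⨾ weightColumn (two ∷ []) ⨾ forEach temp left (weightColumn []) ⨾
    push finished one ⨾ clear item

  -- A stack receives its last symbol first, hence the output is produced from its end
  -- and the weights are reversed while being read.
  readTarget readWeights pushThreshold pushTargetRow reductionProgram : Program 10
  readTarget = transfer notComma input goal ⨾ pop input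
  readWeights = while input nonempty (consume input λ x → push reversed x ⨾ tally x)
  pushThreshold =
    pushWord output denominator ⨾ transfer nonempty count scratch ⨾ transfer nonempty scratch output ⨾
    pushWord output (one ∷ denominator)
  pushTargetRow =
    -- `goal` holds the target in reverse, and the transfer turns it round. By now `finished` counts
    -- all n weights.
    transfer nonempty goal item ⨾ push item minus ⨾ push count5 minus ⨾ push output semicolon ⨾
    forEach temp finished targetColumn
  reductionProgram = readTarget ⨾ readWeights ⨾ pushThreshold ⨾ while reversed nonempty pushWeightRow ⨾ pushTargetRow

  weightRowOut : ℕ → ℕ → ℕ → Word → Word
  weightRowOut m a d out =
    iter m (column [] (encodeℕ a) six) (column (two ∷ []) (encodeℕ a) six (iter d (column [] (encodeℕ a) six) (semicolon ∷ out)))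

  weightRowsOut : ℕ → List ℕ → Word → Word
  weightRowsOut m []       out = out
  weightRowsOut m (a ∷ as) out = weightRowOut m a (length as) (weightRowsOut (suc m) as out)

  targetRowOut : ℕ → ℕ → Word → Word
  targetRowOut n s out =
    iter n (column (minus ∷ one ∷ []) (minus ∷ encodeℕ s) (minus ∷ encodeℕ (n * 5))) (semicolon ∷ out)

  thresholdOut : ℕ → Word
  thresholdOut n = one ∷ denominator ++ encodeℕ n ++ denominator

  reductionOut : ℕ → List ℕ → Word
  reductionOut s as = targetRowOut (length as) s (weightRowsOut 0 as (thresholdOut (length as)))

  commas : Word → ℕ
  commas []          = 0
  commas (comma ∷ w) = suc (commas w)
  commas (_ ∷ w)     = commas w

  commas≤length : ∀ w → commas w ≤ length w
  commas≤length []              = z≤n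
  commas≤length (one ∷ w)       = m≤n⇒m≤1+n (commas≤length w)
  commas≤length (two ∷ w)       = m≤n⇒m≤1+n (commas≤length w)
  commas≤length (minus ∷ w)     = m≤n⇒m≤1+n (commas≤length w)
  commas≤length (slash ∷ w)     = m≤n⇒m≤1+n (commas≤length w)
  commas≤length (comma ∷ w)     = s≤s (commas≤length w)
  commas≤length (semicolon ∷ w) = m≤n⇒m≤1+n (commas≤length w)

  NoComma : Word → Set
  NoComma = All (λ x → notComma (just x) ≡ true)

  encodeℕ-noComma : ∀ n → NoComma (encodeℕ n)
  encodeℕ-noComma n = digits (fromℕ n)
    where
    digits : ∀ b → NoComma (encodeℕᵇ b)
    digits zero     = []
    digits 2[1+ b ] = refl ∷ digits b
    digits 1+[2 b ] = refl ∷ digits b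

  -- Linear instead of logarithmic, which is enough: it is applied only to counters that are
  -- themselves at most X.
  length-encodeℕ : ∀ n → length (encodeℕ n) ≤ n
  length-encodeℕ zero    = z≤n
  length-encodeℕ (suc n) = subst (_≤ suc n) (cong length (sym (encodeℕ-suc n)))
    (≤-trans (grow (fromℕ n)) (s≤s (length-encodeℕ n)))
    where
    grow : ∀ b → length (encodeℕᵇ (ℕᵇ.suc b)) ≤ suc (length (encodeℕᵇ b))
    grow zero     = ≤-refl
    grow 2[1+ b ] = s≤s (grow b)
    grow 1+[2 b ] = m≤n⇒m≤1+n ≤-refl

  commas-ʳ++ : ∀ {w} → NoComma w → ∀ v → commas (w ʳ++ v) ≡ commas v
  commas-ʳ++ []                 v = refl
  commas-ʳ++ {x ∷ w} (hx ∷ hw) v = trans (commas-ʳ++ hw (x ∷ v)) (skip-digit x hx)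
    where
    skip-digit : ∀ x → notComma (just x) ≡ true → commas (x ∷ v) ≡ commas v
    skip-digit one       _ = refl
    skip-digit two       _ = refl
    skip-digit minus     _ = refl
    skip-digit slash     _ = refl
    skip-digit semicolon _ = refl

  weightsWord : List ℕ → Word
  weightsWord = encodeList encodeℕ comma

  -- The contents of the stack `reversed`: the closing comma of a weight comes on top of its digits,
  -- most significant first.
  reversedWord : List ℕ → Word
  reversedWord []       = []
  reversedWord (a ∷ as) = comma ∷ (encodeℕ a ʳ++ reversedWord as)

  weightsWord-ʳ++ : ∀ as bs → weightsWord as ʳ++ reversedWord bs ≡ reversedWord (as ʳ++ bs)
  weightsWord-ʳ++ []       bs = refl
  weightsWord-ʳ++ (a ∷ as) bs = trans (Listₚ.++-ʳ++ (encodeℕ a ++ comma ∷ []))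
    (trans (cong (weightsWord as ʳ++_) (Listₚ.++-ʳ++ (encodeℕ a))) (weightsWord-ʳ++ as (a ∷ bs)))

  commas-weightsWord : ∀ as v → commas (weightsWord as ʳ++ v) ≡ length as + commas v
  commas-weightsWord []       v = refl
  commas-weightsWord (a ∷ as) v = trans (cong commas (Listₚ.++-ʳ++ (encodeℕ a ++ comma ∷ [])))
    (trans (cong (λ w → commas (weightsWord as ʳ++ w)) (Listₚ.++-ʳ++ (encodeℕ a)))
      (trans (commas-weightsWord as (comma ∷ (encodeℕ a ʳ++ v)))
        (trans (+-suc (length as) _) (cong (λ c → suc (length as + c)) (commas-ʳ++ (encodeℕ-noComma a) v)))))

  All-ʳ++ : ∀ {A : Set} {P : A → Set} {u v} → All P u → All P v → All P (u ʳ++ v)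
  All-ʳ++ []        hv = hv
  All-ʳ++ (hx ∷ hu) hv = All-ʳ++ hu (hx ∷ hv)

  -- Correctness and running time of the program.

  module ProgramRun (X : ℕ) {{_ : NonZero X}} where
    open Runs X {10}
    open Emissions X {9}

    private
      variable
        d : ℕ

    emits-weightColumn : ∀ w a {rev tgt fin lft cnt cnt5 tmp} → length (encodeℕ a) ≤ X →
      Emits (weightColumn w) (rev ∷ encodeℕ a ∷ [] ∷ tgt ∷ fin ∷ lft ∷ cnt ∷ cnt5 ∷ tmp ∷ [])
        (column w (encodeℕ a) six) (6 + (15 + wordCost (w ++ denominator))) (suc d)
    emits-weightColumn {d = d} w a {rev} {tgt} {fin} {lft} {cnt} {cnt5} {tmp} a≤X out =
      emits-entry six out
      ⨾ᵣ emits-copyEntry {R = λ u v → rev ∷ u ∷ v ∷ tgt ∷ fin ∷ lft ∷ cnt ∷ cnt5 ∷ tmp ∷ []}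
           (twoStacks (λ _ _ → refl) (λ _ _ → refl) (λ _ _ _ → refl) (λ _ _ _ → refl)) (encodeℕ a) a≤X (entry six out)
      ⨾ᵣ emits-entry w (entry (encodeℕ a) (entry six out))

    emits-targetColumn : ∀ u v {rev tgt fin lft cnt tmp} → length u ≤ X → length v ≤ X →
      Emits targetColumn (rev ∷ u ∷ [] ∷ tgt ∷ fin ∷ lft ∷ cnt ∷ v ∷ tmp ∷ [])
        (column (minus ∷ one ∷ []) u v) 36 (suc d)
    emits-targetColumn {d = d} u v {rev} {tgt} {fin} {lft} {cnt} {tmp} u≤X v≤X out =
      emits-copyEntry {R = λ v w → rev ∷ u ∷ w ∷ tgt ∷ fin ∷ lft ∷ cnt ∷ v ∷ tmp ∷ []}
        (twoStacks (λ _ _ → refl) (λ _ _ → refl) (λ _ _ _ → refl) (λ _ _ _ → refl)) v v≤X out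
      ⨾ᵣ emits-copyEntry {R = λ u w → rev ∷ u ∷ w ∷ tgt ∷ fin ∷ lft ∷ cnt ∷ v ∷ tmp ∷ []}
           (twoStacks (λ _ _ → refl) (λ _ _ → refl) (λ _ _ _ → refl) (λ _ _ _ → refl)) u u≤X (entry v out)
      ⨾ᵣ emits-entry (minus ∷ one ∷ []) (entry u (entry v out))

    run-readTarget : ∀ s w → length (encodeℕ s) ≤ X →
      Run readTarget ((encodeℕ s ++ comma ∷ w) ∷ Vec.replicate 9 [])
        (w ∷ [] ∷ [] ∷ [] ∷ (encodeℕ s ʳ++ []) ∷ [] ∷ [] ∷ [] ∷ [] ∷ [] ∷ []) 6 (suc d)
    run-readTarget s w s≤X =
      run-transfer {S = λ u v → u ∷ [] ∷ [] ∷ [] ∷ v ∷ [] ∷ [] ∷ [] ∷ [] ∷ [] ∷ []}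
        (twoStacks (λ _ _ → refl) (λ _ _ → refl) (λ _ _ _ → refl) (λ _ _ _ → refl))
        (encodeℕ s) {comma ∷ w} {[]} (encodeℕ-noComma s) refl s≤X
      ⨾ᵣ run-pop

    weightsRead : Word → Word → Word → Stacks 10
    weightsRead tgt acc u =
      u ∷ acc ∷ [] ∷ [] ∷ tgt ∷ [] ∷ List.replicate (commas acc) one ∷ encodeℕ (commas acc) ∷ encodeℕ (commas acc * 5) ∷ [] ∷ []

    -- One push and six increments cost 1 + 6 · 12 = 73. The product is kept as `c * 5` because
    -- `suc c * 5` unfolds to five successors of it.
    run-tally-comma : ∀ {rest acc tgt lft} c → suc c * 5 ≤ X →
      Run (tally comma) (rest ∷ acc ∷ [] ∷ [] ∷ tgt ∷ [] ∷ lft ∷ encodeℕ c ∷ encodeℕ (c * 5) ∷ [] ∷ [])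
        (rest ∷ acc ∷ [] ∷ [] ∷ tgt ∷ [] ∷ (one ∷ lft) ∷ encodeℕ (suc c) ∷ encodeℕ (suc c * 5) ∷ [] ∷ []) 73 (suc d)
    run-tally-comma {d = d} {rest} {acc} {tgt} {lft} c c≤X =
      run-push
      ⨾ᵣ run-increment {S = λ u v → rest ∷ acc ∷ [] ∷ v ∷ tgt ∷ [] ∷ (one ∷ lft) ∷ u ∷ encodeℕ (c * 5) ∷ [] ∷ []}
           (twoStacks (λ _ _ → refl) (λ _ _ → refl) (λ _ _ _ → refl) (λ _ _ _ → refl)) c
           (≤-trans (length-encodeℕ c) (≤-trans (m≤n⇒m≤1+n (m≤m*n c 5)) (≤-trans (s≤s (m≤n+m (c * 5) 4)) c≤X)))
      ⨾ᵣ five 0 (s≤s z≤n) ⨾ᵣ five 1 (s≤s (s≤s z≤n)) ⨾ᵣ five 2 (s≤s (s≤s (s≤s z≤n)))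
      ⨾ᵣ five 3 (s≤s (s≤s (s≤s (s≤s z≤n)))) ⨾ᵣ five 4 ≤-refl
      where
      five : ∀ i → suc i ≤ 5 →
        Run (increment scratch count5)
          (rest ∷ acc ∷ [] ∷ [] ∷ tgt ∷ [] ∷ (one ∷ lft) ∷ encodeℕ (suc c) ∷ encodeℕ (i + c * 5) ∷ [] ∷ [])
          (rest ∷ acc ∷ [] ∷ [] ∷ tgt ∷ [] ∷ (one ∷ lft) ∷ encodeℕ (suc c) ∷ encodeℕ (suc i + c * 5) ∷ [] ∷ []) 12 (suc d)
      five i i<5 = run-increment {S = λ u v → rest ∷ acc ∷ [] ∷ v ∷ tgt ∷ [] ∷ (one ∷ lft) ∷ encodeℕ (suc c) ∷ u ∷ [] ∷ []}
        (twoStacks (λ _ _ → refl) (λ _ _ → refl) (λ _ _ _ → refl) (λ _ _ _ → refl)) (i + c * 5)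
        (≤-trans (length-encodeℕ (i + c * 5)) (≤-trans (+-monoˡ-≤ (c * 5) (≤-trans (n≤1+n i) i<5)) c≤X))

    run-readWeights : ∀ w tgt → length w * 5 ≤ X →
      Run readWeights (weightsRead tgt [] w) (weightsRead tgt (w ʳ++ []) []) 78 (2 + d)
    -- The invariant bounds the number of commas read so far, hence both binary counters, by the
    -- length of the input.
    run-readWeights {d = d} w tgt w≤X = run-while (weightsRead tgt) (λ acc u → length acc + length u ≤ length w) step (λ _ → refl) {[]} w ≤-refl
      (≤-trans (m≤m*n (length w) 5) w≤X)
      where
      step : ∀ acc x u → length acc + suc (length u) ≤ length w → nonempty (just x) ≡ true ×
        Run (consume input λ x → push reversed x ⨾ tally x) (weightsRead tgt acc (x ∷ u)) (weightsRead tgt (x ∷ acc) u) 76 (suc d) ×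
        suc (length acc) + length u ≤ length w
      step acc x u le = refl , run-consume {i = input} {x = x} refl (run-push ⨾ᵣ tallied x) , le′
        where
        le′ : suc (length acc) + length u ≤ length w
        le′ = subst (_≤ length w) (+-suc (length acc) (length u)) le
        acc≤X : suc (commas acc) * 5 ≤ X
        acc≤X = ≤-trans (*-monoˡ-≤ 5 (≤-trans (s≤s (commas≤length acc)) (m+n≤o⇒m≤o (suc (length acc)) le′))) w≤X
        tallied : ∀ x → Run (tally x)
          (u ∷ (x ∷ acc) ∷ [] ∷ [] ∷ tgt ∷ [] ∷ List.replicate (commas acc) one ∷ encodeℕ (commas acc) ∷ encodeℕ (commas acc * 5) ∷ [] ∷ [])
          (weightsRead tgt (x ∷ acc) u) 73 (suc d)
        tallied one       = weaken (s≤s z≤n) run-skip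
        tallied two       = weaken (s≤s z≤n) run-skip
        tallied minus     = weaken (s≤s z≤n) run-skip
        tallied slash     = weaken (s≤s z≤n) run-skip
        tallied comma     = run-tally-comma (commas acc) acc≤X
        tallied semicolon = weaken (s≤s z≤n) run-skip

    run-pushThreshold : ∀ n rev tgt lft cnt5 → length (encodeℕ n) ≤ X →
      Run pushThreshold ([] ∷ rev ∷ [] ∷ [] ∷ tgt ∷ [] ∷ lft ∷ encodeℕ n ∷ cnt5 ∷ [] ∷ [])
        (thresholdOut n ∷ rev ∷ [] ∷ [] ∷ tgt ∷ [] ∷ lft ∷ [] ∷ cnt5 ∷ [] ∷ []) 19 (suc d)
    run-pushThreshold n rev tgt lft cnt5 n≤X =
      emits-word denominator []
      ⨾ᵣ run-transfer-all {S = λ u v → denominator ∷ rev ∷ [] ∷ v ∷ tgt ∷ [] ∷ lft ∷ u ∷ cnt5 ∷ [] ∷ []}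
           (twoStacks (λ _ _ → refl) (λ _ _ → refl) (λ _ _ _ → refl) (λ _ _ _ → refl)) (encodeℕ n) {[]} n≤X
      ⨾ᵣ run-transfer-all {S = λ u v → v ∷ rev ∷ [] ∷ u ∷ tgt ∷ [] ∷ lft ∷ [] ∷ cnt5 ∷ [] ∷ []}
           (twoStacks (λ _ _ → refl) (λ _ _ → refl) (λ _ _ _ → refl) (λ _ _ _ → refl)) (encodeℕ n ʳ++ []) {denominator}
           (subst (_≤ X) (sym (length-ʳ++[] (encodeℕ n))) n≤X)
      ⨾ᵣ run-≡ (cong (λ w → (one ∷ denominator ++ w) ∷ _) (Listₚ.ʳ++-ʳ++ (encodeℕ n)))
           (emits-word (one ∷ denominator) ((encodeℕ n ʳ++ []) ʳ++ denominator))

    weightsPushed : Word → Word → Word → List ℕ → List ℕ → Stacks 10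
    weightsPushed out tgt cnt5 acc u =
      weightRowsOut (length u) acc out ∷ reversedWord u ∷ [] ∷ [] ∷ tgt ∷
      List.replicate (length acc) one ∷ List.replicate (length u) one ∷ [] ∷ cnt5 ∷ [] ∷ []

    run-pushWeightRow : ∀ out tgt cnt5 acc a u → length acc ≤ X → length u ≤ X → length (encodeℕ a) ≤ X →
      Run pushWeightRow (weightsPushed out tgt cnt5 acc (a ∷ u)) (weightsPushed out tgt cnt5 (a ∷ acc) u) 108 (2 + d)
    run-pushWeightRow out tgt cnt5 acc a u acc≤X u≤X a≤X =
      run-pop ⨾ᵣ run-pop
      ⨾ᵣ run-≡ˡ (cong (λ w → o ∷ w ∷ [] ∷ [] ∷ tgt ∷ D ∷ L ∷ [] ∷ cnt5 ∷ [] ∷ []) (sym (Listₚ.ʳ++-defn A)))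
           (run-≡ (cong (λ w → o ∷ V ∷ w ∷ [] ∷ tgt ∷ D ∷ L ∷ [] ∷ cnt5 ∷ [] ∷ []) (ʳ++-involutive A))
             (run-transfer {S = λ v w → o ∷ v ∷ w ∷ [] ∷ tgt ∷ D ∷ L ∷ [] ∷ cnt5 ∷ [] ∷ []}
               (twoStacks (λ _ _ → refl) (λ _ _ → refl) (λ _ _ _ → refl) (λ _ _ _ → refl))
               (reverse A) {V} {[]} (All-ʳ++ (encodeℕ-noComma a) []) (comma-first u)
               (subst (_≤ X) (sym (Listₚ.length-reverse A)) a≤X)))
      ⨾ᵣ run-push
      ⨾ᵣ emits-forEach {R = λ v w → V ∷ A ∷ [] ∷ tgt ∷ v ∷ L ∷ [] ∷ cnt5 ∷ w ∷ []}
           (twoStacks (λ _ _ → refl) (λ _ _ → refl) (λ _ _ _ → refl) (λ _ _ _ → refl))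
           (λ _ _ → emits-weightColumn [] a a≤X) (length acc) acc≤X (semicolon ∷ o)
      ⨾ᵣ emits-weightColumn (two ∷ []) a a≤X o₁
      ⨾ᵣ emits-forEach {R = λ v w → V ∷ A ∷ [] ∷ tgt ∷ D ∷ v ∷ [] ∷ cnt5 ∷ w ∷ []}
           (twoStacks (λ _ _ → refl) (λ _ _ → refl) (λ _ _ _ → refl) (λ _ _ _ → refl))
           (λ _ _ → emits-weightColumn [] a a≤X) (length u) u≤X (column (two ∷ []) A six o₁)
      ⨾ᵣ run-push
      ⨾ᵣ run-clear {S = λ w → weightRowsOut (length u) (a ∷ acc) out ∷ V ∷ w ∷ [] ∷ tgt ∷ (one ∷ D) ∷ L ∷ [] ∷ cnt5 ∷ [] ∷ []}
           (λ _ → refl) (λ _ _ → refl) A a≤X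
      where
      o = weightRowsOut (suc (length u)) acc out
      A = encodeℕ a
      V = reversedWord u
      D = List.replicate (length acc) one
      L = List.replicate (length u) one
      o₁ = iter (length acc) (column [] A six) (semicolon ∷ o)
      comma-first : ∀ u → notComma (head (reversedWord u)) ≡ false
      comma-first []      = refl
      comma-first (_ ∷ _) = refl

    run-pushWeightRows : ∀ out tgt cnt5 u → length u ≤ X → All (λ a → length (encodeℕ a) ≤ X) u →
      Run (while reversed nonempty pushWeightRow) (weightsPushed out tgt cnt5 [] u) (weightsPushed out tgt cnt5 (u ʳ++ []) []) 110 (3 + d)
    run-pushWeightRows {d = d} out tgt cnt5 u u≤X hu = run-while (weightsPushed out tgt cnt5)
      (λ acc u → length acc + length u ≤ X × All (λ a → length (encodeℕ a) ≤ X) u) step (λ _ → refl) {[]} u (u≤X , hu) u≤X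
      where
      step : ∀ acc a u → length acc + suc (length u) ≤ X × All (λ a → length (encodeℕ a) ≤ X) (a ∷ u) → true ≡ true ×
        Run pushWeightRow (weightsPushed out tgt cnt5 acc (a ∷ u)) (weightsPushed out tgt cnt5 (a ∷ acc) u) 108 (2 + d) ×
        suc (length acc) + length u ≤ X × All (λ a → length (encodeℕ a) ≤ X) u
      step acc a u (le , ha ∷ hu) = refl ,
        run-pushWeightRow out tgt cnt5 acc a u (m+n≤o⇒m≤o (length acc) le) (≤-trans (n≤1+n (length u)) (m+n≤o⇒n≤o (length acc) le)) ha ,
        subst (_≤ X) (+-suc (length acc) (length u)) le , hu

    -- The strict bounds leave room for the minus signs put in front of the two words.
    run-pushTargetRow : ∀ n s o → n * 5 < X → length (encodeℕ s) < X →
      Run pushTargetRow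
        (o ∷ [] ∷ [] ∷ [] ∷ (encodeℕ s ʳ++ []) ∷ List.replicate n one ∷ [] ∷ [] ∷ encodeℕ (n * 5) ∷ [] ∷ [])
        (targetRowOut n s o ∷ [] ∷ (minus ∷ encodeℕ s) ∷ [] ∷ [] ∷ List.replicate n one ∷ [] ∷ [] ∷ (minus ∷ encodeℕ (n * 5)) ∷ [] ∷ []) 54 (2 + d)
    run-pushTargetRow n s o n<X s<X =
      run-≡ (cong (λ w → o ∷ [] ∷ w ∷ [] ∷ [] ∷ List.replicate n one ∷ [] ∷ [] ∷ encodeℕ (n * 5) ∷ [] ∷ []) (ʳ++-involutive (encodeℕ s)))
        (run-transfer-all {S = λ u v → o ∷ [] ∷ v ∷ [] ∷ u ∷ List.replicate n one ∷ [] ∷ [] ∷ encodeℕ (n * 5) ∷ [] ∷ []}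
          (twoStacks (λ _ _ → refl) (λ _ _ → refl) (λ _ _ _ → refl) (λ _ _ _ → refl)) (encodeℕ s ʳ++ []) {[]}
          (subst (_≤ X) (sym (length-ʳ++[] (encodeℕ s))) (<⇒≤ s<X)))
      ⨾ᵣ run-push ⨾ᵣ run-push ⨾ᵣ run-push
      ⨾ᵣ emits-forEach {R = λ v w → [] ∷ (minus ∷ encodeℕ s) ∷ [] ∷ [] ∷ v ∷ [] ∷ [] ∷ (minus ∷ encodeℕ (n * 5)) ∷ w ∷ []}
           (twoStacks (λ _ _ → refl) (λ _ _ → refl) (λ _ _ _ → refl) (λ _ _ _ → refl))
           (λ _ _ → emits-targetColumn (minus ∷ encodeℕ s) (minus ∷ encodeℕ (n * 5)) s<X (≤-trans (s≤s (length-encodeℕ (n * 5))) n<X))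
           n (≤-trans (m≤m*n n 5) (<⇒≤ n<X)) (semicolon ∷ o)

    -- The exponent 3 reflects the nesting of rows, columns and digits; 267 is 6 + 78 + 19 + 110 +
    -- 54, one summand per phase.
    run-reductionProgram : ∀ s as → length (weightsWord as) * 5 ≤ X → length as * 5 < X → length (encodeℕ s) < X →
      All (λ a → length (encodeℕ a) ≤ X) as →
      ∃[ τ ] Run reductionProgram (weightsWord (s ∷ as) ∷ Vec.replicate 9 []) τ 267 3 × lookup τ output ≡ reductionOut s as
    run-reductionProgram s as w≤X n<X s<X has = _ ,
      (run-≡ˡ (cong (_∷ Vec.replicate 9 []) (sym (Listₚ.++-assoc (encodeℕ s) (comma ∷ []) (weightsWord as))))
         (run-readTarget s (weightsWord as) (<⇒≤ s<X))
      ⨾ᵣ run-≡ read (run-readWeights (weightsWord as) (encodeℕ s ʳ++ []) w≤X)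
      ⨾ᵣ run-pushThreshold n (reversedWord (as ʳ++ [])) (encodeℕ s ʳ++ []) (List.replicate n one) (encodeℕ (n * 5))
           (≤-trans (length-encodeℕ n) n≤X)
      ⨾ᵣ run-≡ˡ (cong (λ m → thresholdOut n ∷ reversedWord (as ʳ++ []) ∷ [] ∷ [] ∷ (encodeℕ s ʳ++ []) ∷ [] ∷ List.replicate m one ∷ [] ∷ encodeℕ (n * 5) ∷ [] ∷ []) (length-ʳ++[] as))
           (run-≡ (cong (λ bs → weightsPushed (thresholdOut n) (encodeℕ s ʳ++ []) (encodeℕ (n * 5)) bs []) (ʳ++-involutive as))
             (run-pushWeightRows (thresholdOut n) (encodeℕ s ʳ++ []) (encodeℕ (n * 5)) (as ʳ++ [])
               (subst (_≤ X) (sym (length-ʳ++[] as)) n≤X) (All-ʳ++ has [])))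
      ⨾ᵣ run-pushTargetRow n s (weightRowsOut 0 as (thresholdOut n)) n<X s<X) ,
      refl
      where
      n = length as
      n≤X = ≤-trans (m≤m*n n 5) (<⇒≤ n<X)
      read : weightsRead (encodeℕ s ʳ++ []) (weightsWord as ʳ++ []) [] ≡
        [] ∷ reversedWord (as ʳ++ []) ∷ [] ∷ [] ∷ (encodeℕ s ʳ++ []) ∷ [] ∷ List.replicate n one ∷ encodeℕ n ∷ encodeℕ (n * 5) ∷ [] ∷ []
      read = cong₂ (λ w m → [] ∷ w ∷ [] ∷ [] ∷ (encodeℕ s ʳ++ []) ∷ [] ∷ List.replicate m one ∷ encodeℕ m ∷ encodeℕ (m * 5) ∷ [] ∷ [])
        (weightsWord-ʳ++ as []) (trans (commas-weightsWord as []) (+-identityʳ n))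

open import Data.Fin.Subset using (Subset) renaming (∣_∣ to card)
open import Data.Integer as ℤ using (ℤ; 0ℤ)
import Data.Integer.GCD as ℤ
import Data.Integer.Properties as ℤₚ
open import Data.List as List using (List; []; _∷_; _++_; length)
import Data.List.Properties as Listₚ
open import Data.List.Relation.Unary.All as All using (All; []; _∷_)
open import Data.Nat as ℕ using (ℕ; zero)
import Data.Nat.GCD as ℕ
import Data.Nat.Properties as ℕₚ
open import Data.Product using (∃-syntax; _×_; _,_)
open import Data.Rational using (_*_; positive; ↥_; ↧_)
import Data.Rational.Properties as ℚₚ
open import Data.Vec as Vec using (Vec; []; _∷_; toList; zipWith; replicate)
import Data.Vec.Properties as Vecₚ
open import Function using (_∘_)
open import Relation.Binary.PropositionalEquality
open Reals
open Lattices
open Machine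

-- The program's output is the encoded lattice.

encodeℚ-toℚ : ∀ z → encodeℚ (toℚ z) ≡ encodeℤ z ++ slash ∷ one ∷ []
encodeℚ-toℚ z = cong₂ (λ i d → encodeℤ i ++ slash ∷ encodeℕ d)
  (trans (unit (↥ toℚ z)) (ℚₚ.↥-/ z 1)) (cong ℤ.∣_∣ (trans (unit (↧ toℚ z)) (ℚₚ.↧-/ z 1)))
  where
  unit : ∀ i → i ≡ i ℤ.* ℤ.gcd z (+ 1)
  unit i = trans (sym (ℤₚ.*-identityʳ i)) (cong (λ g → i ℤ.* + g) (sym (ℕ.gcd-zeroʳ ℤ.∣ z ∣)))

encode-entry : ∀ z rest → (encodeℚ (toℚ z) ++ comma ∷ []) ++ rest ≡ entry (encodeℤ z) rest
encode-entry z rest = trans (cong (λ w → (w ++ comma ∷ []) ++ rest) (encodeℚ-toℚ z))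
  (trans (cong (_++ rest) (Listₚ.++-assoc (encodeℤ z) (slash ∷ one ∷ []) (comma ∷ [])))
    (Listₚ.++-assoc (encodeℤ z) denominator rest))

columns : List ℤ → Word → Word → Word → Word
columns []      u w out = out
columns (d ∷ δ) u w out = column (encodeℤ d) u w (columns δ u w out)

columns-replicate : ∀ m d δ u w out →
  columns (List.replicate m d ++ δ) u w out ≡ iter m (column (encodeℤ d) u w) (columns δ u w out)
columns-replicate zero    d δ u w out = refl
columns-replicate (suc m) d δ u w out = cong (column (encodeℤ d) u w) (columns-replicate m d δ u w out)

rowWord : ∀ {m} → Vec ℤ m → Word
rowWord r = encodeList encodeℚ comma (toList (Vec.map toℚ r))

encode-interleave : ∀ {n} (δ : Vec ℤ n) b c out →
  rowWord (interleave δ b c) ++ out ≡ columns (toList δ) (encodeℤ b) (encodeℤ c) out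
encode-interleave []      b c out = refl
encode-interleave (d ∷ δ) b c out = begin
  (E d ++ E b ++ E c ++ W) ++ out     ≡⟨ Listₚ.++-assoc (E d) _ out ⟩
  E d ++ (E b ++ E c ++ W) ++ out     ≡⟨ cong (E d ++_) (Listₚ.++-assoc (E b) _ out) ⟩
  E d ++ E b ++ (E c ++ W) ++ out     ≡⟨ cong (λ v → E d ++ E b ++ v) (Listₚ.++-assoc (E c) W out) ⟩
  E d ++ E b ++ E c ++ W ++ out       ≡⟨ cong (λ v → E d ++ E b ++ E c ++ v) (encode-interleave δ b c out) ⟩
  E d ++ E b ++ E c ++ rest           ≡⟨ encode-entry d (E b ++ E c ++ rest) ⟩
  entry (encodeℤ d) (E b ++ E c ++ rest)
    ≡⟨ cong (entry (encodeℤ d)) (trans (encode-entry b (E c ++ rest)) (cong (entry (encodeℤ b)) (encode-entry c rest))) ⟩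
  column (encodeℤ d) (encodeℤ b) (encodeℤ c) rest ∎
  where
  open ≡-Reasoning
  E : ℤ → Word
  E z = encodeℚ (toℚ z) ++ comma ∷ []
  W = rowWord (interleave δ b c)
  rest = columns (toList δ) (encodeℤ b) (encodeℤ c) out

basisWord : ∀ {n m} → Vec (Vec ℤ m) n → Word
basisWord B = encodeList (encodeList encodeℚ comma ∘ toList) semicolon (toList (Vec.map (Vec.map toℚ) B))

basisWord-∷ : ∀ {n m} (r : Vec ℤ m) (B : Vec (Vec ℤ m) n) out →
  basisWord (r ∷ B) ++ out ≡ rowWord r ++ semicolon ∷ basisWord B ++ out
basisWord-∷ r B out = trans (Listₚ.++-assoc (rowWord r ++ semicolon ∷ []) (basisWord B) out)
  (Listₚ.++-assoc (rowWord r) (semicolon ∷ []) (basisWord B ++ out))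

-- Each level of `doubledUnits` prepends a zero to all remaining rows. The number m collects these
-- zeros, so that the induction can proceed on the smaller matrix.
paddedRows : ∀ {n k} → ℕ → Vec (Vec ℤ k) n → Vec ℕ n → Word → Word
paddedRows m []      []       out = out
paddedRows m (δ ∷ U) (a ∷ as) out =
  columns (List.replicate m 0ℤ ++ toList δ) (encodeℕ a) six (semicolon ∷ paddedRows m U as out)

basisWord-weightRows : ∀ {n k} (U : Vec (Vec ℤ k) n) as out →
  basisWord (zipWith weightRow U as) ++ out ≡ paddedRows 0 U as out
basisWord-weightRows []      []       out = refl
basisWord-weightRows (δ ∷ U) (a ∷ as) out = trans (basisWord-∷ (weightRow δ a) (zipWith weightRow U as) out)
  (trans (encode-interleave δ (+ a) (+ 6) (semicolon ∷ basisWord (zipWith weightRow U as) ++ out))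
    (cong (λ v → columns (toList δ) (encodeℕ a) six (semicolon ∷ v)) (basisWord-weightRows U as out)))

paddedRows-shift : ∀ {n k} m (U : Vec (Vec ℤ k) n) as out →
  paddedRows m (Vec.map (0ℤ ∷_) U) as out ≡ paddedRows (suc m) U as out
paddedRows-shift m []      []       out = refl
paddedRows-shift m (δ ∷ U) (a ∷ as) out =
  cong₂ (λ δ v → columns δ (encodeℕ a) six (semicolon ∷ v)) (shift m) (paddedRows-shift m U as out)
  where
  shift : ∀ m → List.replicate m 0ℤ ++ 0ℤ ∷ toList δ ≡ 0ℤ ∷ List.replicate m 0ℤ ++ toList δ
  shift zero    = refl
  shift (suc m) = cong (0ℤ ∷_) (shift m)

paddedRows-doubledUnits : ∀ {n} m (as : Vec ℕ n) out →
  paddedRows m (doubledUnits n) as out ≡ weightRowsOut m (toList as) out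
paddedRows-doubledUnits m []       out = refl
paddedRows-doubledUnits {suc n} m (a ∷ as) out = begin
  columns (List.replicate m 0ℤ ++ + 2 ∷ toList (replicate n 0ℤ)) A six (semicolon ∷ paddedRows m (Vec.map (0ℤ ∷_) (doubledUnits n)) as out)
    ≡⟨ cong (λ v → columns (List.replicate m 0ℤ ++ + 2 ∷ toList (replicate n 0ℤ)) A six (semicolon ∷ v))
         (trans (paddedRows-shift m (doubledUnits n) as out) (paddedRows-doubledUnits (suc m) as out)) ⟩
  columns (List.replicate m 0ℤ ++ + 2 ∷ toList (replicate n 0ℤ)) A six rest
    ≡⟨ columns-replicate m 0ℤ (+ 2 ∷ toList (replicate n 0ℤ)) A six rest ⟩
  iter m C (column (two ∷ []) A six (columns (toList (replicate n 0ℤ)) A six rest))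
    ≡⟨ cong (λ v → iter m C (column (two ∷ []) A six v)) zeros-right ⟩
  iter m C (column (two ∷ []) A six (iter (length (toList as)) C rest)) ∎
  where
  open ≡-Reasoning
  A = encodeℕ a
  C = column [] A six
  rest = semicolon ∷ weightRowsOut (suc m) (toList as) out
  zeros-right : columns (toList (replicate n 0ℤ)) A six rest ≡ iter (length (toList as)) C rest
  zeros-right = trans (cong (λ δ → columns δ A six rest)
      (trans (Vecₚ.toList-replicate n 0ℤ) (sym (Listₚ.++-identityʳ (List.replicate n 0ℤ)))))
    (trans (columns-replicate n 0ℤ [] A six rest) (cong (λ k → iter k C rest) (sym (Vecₚ.length-toList as))))

-- Zero has the empty code without a sign, hence the condition on n.
encodeℤ-neg : ∀ n .{{_ : ℕ.NonZero n}} → encodeℤ (ℤ.- + n) ≡ minus ∷ encodeℕ n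
encodeℤ-neg (suc n) = refl

thresholdWord : ∀ n → encodeList encodeℚ comma (1ℚ ∷ toℚ (+ n) ∷ []) ≡ thresholdOut n
thresholdWord n = cong (λ v → one ∷ denominator ++ v) (encode-entry (+ n) [])

rows-word : ∀ {n} (a : Vec ℕ n) s .{{_ : ℕ.NonZero n}} .{{_ : ℕ.NonZero s}} →
  basisWord (rows a s) ++ encodeList encodeℚ comma (1ℚ ∷ toℚ (+ n) ∷ []) ≡ reductionOut s (toList a)
rows-word {n} a s = begin
  basisWord (rows a s) ++ encodeList encodeℚ comma (1ℚ ∷ toℚ (+ n) ∷ [])
    ≡⟨ cong (basisWord (rows a s) ++_) (thresholdWord n) ⟩
  basisWord (rows a s) ++ thresholdOut n
    ≡⟨ basisWord-∷ (targetRow n s) (zipWith weightRow (doubledUnits n) a) (thresholdOut n) ⟩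
  rowWord (targetRow n s) ++ semicolon ∷ basisWord (zipWith weightRow (doubledUnits n) a) ++ thresholdOut n
    ≡⟨ cong (λ v → rowWord (targetRow n s) ++ semicolon ∷ v)
         (trans (basisWord-weightRows (doubledUnits n) a (thresholdOut n)) (paddedRows-doubledUnits 0 a (thresholdOut n))) ⟩
  rowWord (targetRow n s) ++ semicolon ∷ W n
    ≡⟨ encode-interleave (replicate n (ℤ.- + 1)) (ℤ.- + s) (ℤ.- + (5 ℕ.* n)) (semicolon ∷ W n) ⟩
  columns (toList (replicate n (ℤ.- + 1))) (encodeℤ (ℤ.- + s)) (encodeℤ (ℤ.- + (5 ℕ.* n))) (semicolon ∷ W n)
    ≡⟨ cong (λ δ → columns δ (encodeℤ (ℤ.- + s)) (encodeℤ (ℤ.- + (5 ℕ.* n))) (semicolon ∷ W n))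
         (trans (Vecₚ.toList-replicate n (ℤ.- + 1)) (sym (Listₚ.++-identityʳ (List.replicate n (ℤ.- + 1))))) ⟩
  columns (List.replicate n (ℤ.- + 1) ++ []) (encodeℤ (ℤ.- + s)) (encodeℤ (ℤ.- + (5 ℕ.* n))) (semicolon ∷ W n)
    ≡⟨ columns-replicate n (ℤ.- + 1) [] (encodeℤ (ℤ.- + s)) (encodeℤ (ℤ.- + (5 ℕ.* n))) (semicolon ∷ W n) ⟩
  iter n (column (minus ∷ one ∷ []) (encodeℤ (ℤ.- + s)) (encodeℤ (ℤ.- + (5 ℕ.* n)))) (semicolon ∷ W n)
    ≡⟨ cong₂ (λ u v → iter n (column (minus ∷ one ∷ []) u v) (semicolon ∷ W n)) (encodeℤ-neg s) five-n ⟩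
  targetRowOut n s (W n)
    ≡⟨ cong (λ k → targetRowOut k s (W k)) (Vecₚ.length-toList a) ⟨
  reductionOut s (toList a) ∎
  where
  open ≡-Reasoning
  W : ℕ → Word
  W k = weightRowsOut 0 (toList a) (thresholdOut k)
  five-n : encodeℤ (ℤ.- + (5 ℕ.* n)) ≡ minus ∷ encodeℕ (n ℕ.* 5)
  five-n = trans (encodeℤ-neg (5 ℕ.* n) {{ℕₚ.m*n≢0 5 n}}) (cong (λ k → minus ∷ encodeℕ k) (ℕₚ.*-comm 5 n))

weights-short : ∀ as → All (λ a → length (encodeℕ a) ℕ.≤ length (weightsWord as)) as
weights-short []       = []
weights-short (a ∷ as) = head≤ ∷ All.map (λ h → ℕₚ.≤-trans h tail≤) (weights-short as)
  where
  E = encodeℕ a ++ comma ∷ []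
  head≤ : length (encodeℕ a) ℕ.≤ length (E ++ weightsWord as)
  head≤ = ℕₚ.≤-trans (ℕₚ.m≤m+n (length (encodeℕ a)) 1) (subst (ℕ._≤ length (E ++ weightsWord as)) (Listₚ.length-++ (encodeℕ a))
    (subst (length E ℕ.≤_) (sym (Listₚ.length-++ E)) (ℕₚ.m≤m+n (length E) _)))
  tail≤ : length (weightsWord as) ℕ.≤ length (E ++ weightsWord as)
  tail≤ = subst (length (weightsWord as) ℕ.≤_) (sym (Listₚ.length-++ E)) (ℕₚ.m≤n+m _ (length E))

length-weightsWord-∷ : ∀ a as → length (weightsWord (a ∷ as)) ≡ length (encodeℕ a) ℕ.+ suc (length (weightsWord as))
length-weightsWord-∷ a as = trans (cong length (Listₚ.++-assoc (encodeℕ a) (comma ∷ []) (weightsWord as))) (Listₚ.length-++ (encodeℕ a))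

length≤weightsWord : ∀ as → length as ℕ.≤ length (weightsWord as)
length≤weightsWord []       = ℕ.z≤n
length≤weightsWord (a ∷ as) = subst (suc (length as) ℕ.≤_) (sym (length-weightsWord-∷ a as))
  (ℕₚ.≤-trans (ℕ.s≤s (length≤weightsWord as)) (ℕₚ.m≤n+m (suc (length (weightsWord as))) (length (encodeℕ a))))

-- The factor 125 is 5 ^ 3, as the size bound is five times the input length.
cost : ℕ
cost = 267 ℕ.* 125

reduction-time : ∀ s as → ∃[ t ] ∃[ τ ] ⟨ reductionProgram , weightsWord (s ∷ as) ∷ Vec.replicate 9 [] ⟩⇓[ t ] τ
  × Vec.lookup τ output ≡ reductionOut s as × t ℕ.≤ cost ℕ.+ cost ℕ.* length (weightsWord (s ∷ as)) ℕ.^ 3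
reduction-time s as =
  let τ , run {t} D t≤ , out = run-reductionProgram s as
        (ℕₚ.*-monoˡ-≤ 5 (ℕₚ.<⇒≤ weights<L)) (ℕₚ.*-monoˡ-< 5 (ℕₚ.≤-<-trans (length≤weightsWord as) weights<L))
        (ℕₚ.<-≤-trans s<L L≤X) (All.map (λ h → ℕₚ.≤-trans h (ℕₚ.≤-trans (ℕₚ.<⇒≤ weights<L) L≤X)) (weights-short as))
  in t , τ , D , out , ℕₚ.≤-trans t≤ (cube 267 L)
  where
  L = length (weightsWord (s ∷ as))
  -- The factor 5 makes room for the counter that reaches 5 n.
  X = L ℕ.* 5
  L≡ = length-weightsWord-∷ s as
  weights<L : length (weightsWord as) ℕ.< L
  weights<L = subst (suc (length (weightsWord as)) ℕ.≤_) (sym L≡) (ℕₚ.m≤n+m _ (length (encodeℕ s)))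
  s<L : length (encodeℕ s) ℕ.< L
  s<L = subst (length (encodeℕ s) ℕ.<_) (sym L≡) (ℕₚ.m<m+n (length (encodeℕ s)) (ℕ.s≤s ℕ.z≤n))
  L≤X : L ℕ.≤ X
  L≤X = ℕₚ.m≤m*n L 5
  instance
    X≢0 : ℕ.NonZero X
    X≢0 = ℕ.>-nonZero (ℕₚ.≤-trans (ℕ.s≤s ℕ.z≤n) (ℕₚ.≤-trans s<L L≤X))
  open ProgramRun X
  open Runs X {10}
  cube : ∀ k L → k ℕ.* (L ℕ.* 5) ℕ.^ 3 ℕ.≤ k ℕ.* 125 ℕ.+ k ℕ.* 125 ℕ.* L ℕ.^ 3
  cube k L = subst (ℕ._≤ k ℕ.* 125 ℕ.+ k ℕ.* 125 ℕ.* L ℕ.^ 3) (sym (identity k L)) (ℕₚ.m≤n+m (k ℕ.* 125 ℕ.* L ℕ.^ 3) (k ℕ.* 125))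
    where
    open import Data.Nat.Tactic.RingSolver using (solve-∀)
    identity : ∀ k L → k ℕ.* (L ℕ.* 5 ℕ.* (L ℕ.* 5 ℕ.* (L ℕ.* 5 ℕ.* 1))) ≡ k ℕ.* 125 ℕ.* (L ℕ.* (L ℕ.* (L ℕ.* 1)))
    identity = solve-∀

-- The reduction on instances.

module _ (I : SSInstance (+ 5 / 6)) where
  open SSInstance I

  size-correct : 5 ℕ.* n ≡ 6 ℕ.* cn
  size-correct = ℤₚ.+-injective (toℚ-injective (+ (5 ℕ.* n)) (+ (6 ℕ.* cn)) (begin
    toℚ (+ (5 ℕ.* n))                    ≡⟨ trans (cong toℚ (ℤₚ.pos-* 5 n)) (toℚ-homo-* (+ 5) (+ n)) ⟩
    toℚ (+ 5) * toℚ (+ n)                ≡⟨⟩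
    toℚ (+ 6) * (+ 5 / 6) * toℚ (+ n)    ≡⟨ ℚₚ.*-assoc (toℚ (+ 6)) (+ 5 / 6) (toℚ (+ n)) ⟩
    toℚ (+ 6) * ((+ 5 / 6) * toℚ (+ n))  ≡⟨ cong (toℚ (+ 6) *_) cn-correct ⟩
    toℚ (+ 6) * toℚ (+ cn)               ≡⟨ trans (cong toℚ (ℤₚ.pos-* 6 cn)) (toℚ-homo-* (+ 6) (+ cn)) ⟨
    toℚ (+ (6 ℕ.* cn))                   ∎))
    where open ≡-Reasoning

  n≢0 : n ≢ 0
  n≢0 n≡0 = ℕ.≢-nonZero⁻¹ cn (ℕₚ.m*n≡0⇒m≡0 cn 6 (trans (ℕₚ.*-comm cn 6) (trans (sym size-correct) (cong (5 ℕ.*_) n≡0))))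

  toSVP : SVPInstance
  toSVP = record
    { rank        = suc n
    ; dimension   = n ℕ.* 3
    ; basis       = Vec.map (Vec.map toℚ) (rows weights target)
    ; independent = rows-independent weights target n≢0
    ; factor      = 1ℚ
    ; radicand    = toℚ (+ n)
    ; radicand>0  = positive (toℚ-mono-< (+ 0) (+ n) (ℤ.+<+ (ℕₚ.n≢0⇒n>0 n≢0)))
    }

  encode-toSVP : encodeSVP toSVP ≡ reductionOut target (toList weights)
  encode-toSVP = rows-word weights target {{ℕ.≢-nonZero n≢0}}

corollary3p11 : (p : ℝ) (1≤p : fromℚ 1ℚ ≤ℝ p) →
    Σ (KarpReduction (SSIndep p 1≤p (+ 5 / 6) ½) (GapSVP p 1≤p)) λ R →
    ∀ I → SVPInstance.rank (KarpReduction.map R I) ≡ suc (SSInstance.n (proj₁ I))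
corollary3p11 p 1≤p = record
  { map      = λ (I , _) → toSVP I
  ; polytime = 9 , reductionProgram , cost , 3 , λ (I , _) →
      let open SSInstance I
          t , τ , D , out , t≤ = reduction-time target (toList weights)
      in t , τ , D , trans out (sym (encode-toSVP I)) , t≤
  ; yes⇒yes  = λ (I , independent) (x , sum≡target , card≡cn) →
      let open SSInstance I
      in yes-instance weights target {{ℕ.≢-nonZero (n≢0 I)}} independent x
           (sum≡target , trans (cong (6 ℕ.*_) card≡cn) (sym (size-correct I)))
  ; no⇒no    = λ (I , independent) unsolvable →
      let open SSInstance I
      in no-instance weights target {{ℕ.≢-nonZero (n≢0 I)}} independent λ (x , sum≡target , size) →
           unsolvable (x , sum≡target , ℕₚ.*-cancelˡ-≡ (card x) cn 6 (trans size (size-correct I)))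
  } , λ _ → refl
  where open Reduction p 1≤p
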